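{- Let $p$ be a prime with $p \equiv 1 \pmod 4$, and let $\ell \neq p$ be a prime. Let $\alpha, \beta \colon \mathbf{F}_p^{\boxtimes} \to \mathbf{Z}/\ell$ be voltage assignments, and let $X^\alpha$ and $X^\beta$ be the associated translation invariant $\mathbf{Z}/\ell$-covers of the Paley graph $X(\mathbf{F}_p)$. Suppose the adjacency spectra of $X^\alpha$ and $X^\beta$ coincide as multisets. Then there is some $n \in (\mathbf{Z}/\ell)^\times$ and an isomorphism of $\mathbf{Z}/\ell$-covering graphs $X^\alpha \cong X^{n\beta}$. In particular, $X^\alpha$ and $X^\beta$ are isomorphic as graphs.
   Context: For a finite field $\mathbf{F}_q$ ($q = p^r$, $q \equiv 1 \pmod 4$), $\mathbf{F}_q^{\boxtimes} = \{x^2 : x \in \mathbf{F}_q^\times\}$ denotes the set of nonzero squares. The Paley graph $X(\mathbf{F}_q)$ has vertex set $\mathbf{F}_q$, with $x$ adjacent to $y$ iff $y - x \in \mathbf{F}_q^{\boxtimes}$. A voltage assignment is a function $\alpha \colon \mathbf{F}_q^{\boxtimes} \to \mathbf{Z}/\ell$ that is not identically zero and satisfies $\alpha(-s) = -\alpha(s)$ for all $s \in \mathbf{F}_q^{\boxtimes}$. The graph $X^\alpha$ has vertex set $\mathbf{F}_q \times \mathbf{Z}/\ell$, with an edge between $(x,i)$ and $(y,j)$ iff $y - x \in \mathbf{F}_q^{\boxtimes}$ and $j - i = \alpha(y-x)$; it carries the free $\mathbf{Z}/\ell$-action $(x,i) \mapsto (x, i+1)$ and projection $(x,i) \mapsto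 x$ to $X(\mathbf{F}_q)$. For $n \in (\mathbf{Z}/\ell)^\times$, $n\beta$ is the voltage assignment $s \mapsto n\beta(s)$. An isomorphism of $\mathbf{Z}/\ell$-covering graphs $X^\alpha \to X^\beta$ is a graph isomorphism $f$ satisfying $f(x, i+1) = f(x,i) + (0,1)$ for all vertices $(x,i)$. The adjacency spectrum is the multiset of eigenvalues of the adjacency matrix. -}

module Defs where

open import Data.Nat as ℕ using (ℕ; zero; suc; NonZero; _%_)
open import Data.Nat.DivMod using (_mod_)
open import Data.Fin as Fin using (Fin; toℕ; punchIn; remQuot)
open import Data.Fin.Properties using (any?) renaming (_≟_ to _≟F_)
open import Data.Integer as ℤ using (ℤ; +_; -_)
open import Data.Product using (Σ; _×_; _,_; proj₁; proj₂)
open import Data.Bool using (if_then_else_)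
open import Relation.Nullary using (¬_; Dec; yes; no)
open import Relation.Nullary.Decidable using (_×-dec_; ¬?; ⌊_⌋)
open import Relation.Binary.PropositionalEquality using (_≡_)
open import Function.Bundles using (_↔_; Inverse)

module _ (n : ℕ) .{{_ : NonZero n}} where
  addM : Fin n → Fin n → Fin n
  addM x y = (toℕ x ℕ.+ toℕ y) mod n

  negM : Fin n → Fin n
  negM x = (n ℕ.∸ toℕ x) mod n

  subM : Fin n → Fin n → Fin n
  subM x y = addM x (negM y)

  mulM : Fin n → Fin n → Fin n
  mulM x y = (toℕ x ℕ.* toℕ y) mod n

  zeroM : Fin n
  zeroM = 0 mod n

  oneM : Fin n
  oneM = 1 mod n

  IsUnit : Fin n → Set
  IsUnit a = Σ (Fin n) λ b → mulM a b ≡ oneM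

module _ (p : ℕ) .{{_ : NonZero p}} where
  NonzeroSquare : Fin p → Set
  NonzeroSquare s = (¬ s ≡ zeroM p) × Σ (Fin p) λ x → mulM p x x ≡ s

  nonzeroSquare? : (s : Fin p) → Dec (NonzeroSquare s)
  nonzeroSquare? s = ¬? (s ≟F zeroM p) ×-dec any? (λ x → mulM p x x ≟F s)

-- Voltage assignments α : 𝔽_p^⊠ → ℤ/ℓ.  Represented by a function on all
-- of Fin p; only its values on nonzero squares are ever used.

module _ (p ℓ : ℕ) .{{_ : NonZero p}} .{{_ : NonZero ℓ}} where
  IsVoltage : (Fin p → Fin ℓ) → Set
  IsVoltage α =
    (Σ (Fin p) λ s → NonzeroSquare p s × ¬ α s ≡ zeroM ℓ)
    × (∀ s → NonzeroSquare p s → α (negM p s) ≡ negM ℓ (α s))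

  scaleV : Fin ℓ → (Fin p → Fin ℓ) → (Fin p → Fin ℓ)
  scaleV n β s = mulM ℓ n (β s)

  Vtx : Set
  Vtx = Fin p × Fin ℓ

  Adj : (Fin p → Fin ℓ) → Vtx → Vtx → Set
  Adj α (x , i) (y , j) = NonzeroSquare p (subM p y x) × (subM ℓ j i ≡ α (subM p y x))

  adj? : (α : Fin p → Fin ℓ) → (u v : Vtx) → Dec (Adj α u v)
  adj? α (x , i) (y , j) = nonzeroSquare? p (subM p y x) ×-dec (subM ℓ j i ≟F α (subM p y x))

  shift : Vtx → Vtx
  shift (x , i) = (x , addM ℓ i (oneM ℓ))

  IsGraphIso : (α β : Fin p → Fin ℓ) → (Vtx ↔ Vtx) → Set
  IsGraphIso α β f = ∀ u v → (Adj α u v → Adj β (to u) (to v)) × (Adj β (to u) (to v) → Adj α u v)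
    where open Inverse f

  GraphIsomorphic : (α β : Fin p → Fin ℓ) → Set
  GraphIsomorphic α β = Σ (Vtx ↔ Vtx) (IsGraphIso α β)

  CoverIsomorphic : (α β : Fin p → Fin ℓ) → Set
  CoverIsomorphic α β = Σ (Vtx ↔ Vtx) λ f →
    IsGraphIso α β f × (∀ u → Inverse.to f (shift u) ≡ shift (Inverse.to f u))

sumFin : ∀ n → (Fin n → ℤ) → ℤ
sumFin zero    f = + 0
sumFin (suc n) f = f Fin.zero ℤ.+ sumFin n (λ i → f (Fin.suc i))

sgn : ℕ → ℤ
sgn zero    = + 1
sgn (suc k) = - sgn k

det : ∀ n → (Fin n → Fin n → ℤ) → ℤ
det zero    A = + 1
det (suc n) A = sumFin (suc n) λ j →
  sgn (toℕ j) ℤ.* A Fin.zero j ℤ.* det n (λ r c → A (Fin.suc r) (punchIn j c))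

charPoly : ∀ n → (Fin n → Fin n → ℤ) → ℤ → ℤ
charPoly n A t = det n λ u v → (if ⌊ u ≟F v ⌋ then t else + 0) ℤ.- A u v

module _ (p ℓ : ℕ) .{{_ : NonZero p}} .{{_ : NonZero ℓ}} where
  adjMatrix : (Fin p → Fin ℓ) → Fin (p ℕ.* ℓ) → Fin (p ℕ.* ℓ) → ℤ
  adjMatrix α u v = if ⌊ adj? p ℓ α (remQuot ℓ u) (remQuot ℓ v) ⌋ then + 1 else + 0

  -- X^α and X^β have the same adjacency spectrum (as multisets):
  -- equal characteristic polynomials (compared as polynomial functions on ℤ).
  Cospectral : (α β : Fin p → Fin ℓ) → Set
  Cospectral α β = ∀ t → charPoly (p ℕ.* ℓ) (adjMatrix α) t ≡ charPoly (p ℕ.* ℓ) (adjMatrix β) t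

{-# OPTIONS --safe #-}
-- X^α is a Cayley graph of ℤ/p × ℤ/ℓ, so its eigenvalues are the character sums
-- λ_{a,b}(α) = Σ_{s ∈ □} ζ_p^{as} ζ_ℓ^{bα(s)}.  If the spectra agree, λ_{1,1}(α) = λ_{a,b}(β)
-- for some (a, b).  Since ζ_p, …, ζ_p^{p-1} are linearly independent over ℚ(ζ_ℓ), comparing coefficients
-- gives a ≠ 0 (there is a nonsquare), a□ = □ and α(x) = bβ(x/a) on □, so (x, i) ↦ (x/a, i) is an
-- isomorphism X^α → X^{bβ}.
--
-- The ring ℤ[ζ_p, ζ_ℓ] is modelled as ℤ[ℤ/p × ℤ/ℓ] modulo the kernel of the trace form, where
-- independence is built in but the absence of zero divisors has to be shown.  If zw = 0 then
-- z^r ≡ σ_r(z) mod r gives σ_r(z)w ≡ 0 mod r, hence σ_r(z)w = 0 for every prime r larger than all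
-- coefficients involved.  Each Galois automorphism is a product of such σ_r, so Tr(z)w = 0; replacing z by
-- its multiples by roots of unity yields z = 0 or w = 0.
module Submission where

open import Defs
open import Algebra.Bundles using (CommutativeRing; RawRing)
import Algebra.Definitions.RawMonoid as RawMonoidSum
import Algebra.Properties.CommutativeMonoid.Mult as CommutativeMonoidMult
import Algebra.Properties.CommutativeSemigroup as CommutativeSemigroupProperties
import Algebra.Properties.CommutativeSemiring.Binomial as BinomialTheorem
import Algebra.Properties.Ring as RingProperties
import Algebra.Properties.Semiring.Exp as SemiringExp
import Algebra.Properties.Semiring.Mult as SemiringMult
import Algebra.Properties.Semiring.Sum as SemiringSum
open import Data.Bool using (if_then_else_)
open import Data.Empty using (⊥; ⊥-elim)
open import Data.Fin as Fin using (Fin; zero; suc; toℕ; fromℕ; fromℕ<; inject₁; punchIn; punchOut; remQuot; combine;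
    _↑ˡ_; _↑ʳ_)
open import Data.Fin.Induction using (<-weakInduction)
open import Data.Fin.Permutation using (Permutation; permutation)
open import Data.Fin.Properties using (_≟_; any?; pigeonhole; suc-injective; 0≢1+n; toℕ<n; toℕ-injective; toℕ-fromℕ;
    toℕ-fromℕ<; toℕ-inject₁; punchIn-punchOut; punchInᵢ≢i; punchIn-injective; remQuot-combine; combine-remQuot;
    splitAt-↑ˡ; splitAt-↑ʳ)
open import Data.Integer as ℤ using (ℤ; +_; -[1+_]; 0ℤ; 1ℤ; ∣_∣)
import Data.Integer.Properties as ℤ
open import Data.Integer.Solver using (module +-*-Solver)
open import Data.List using (List; []; _∷_; _++_; map)
open import Data.List.Relation.Unary.All using (All; []; _∷_)
open import Data.Nat as ℕ using (ℕ; zero; suc; NonZero; _%_; _!; _≤_; _<_; _∸_; z≤n; s≤s; _<?_)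
open import Data.Nat.Combinatorics using (nCk≡n!/k![n-k]!; k![n∸k]!∣n!; nCn≡1) renaming (_C_ to _choose_)
open import Data.Nat.Coprimality using (Coprime; coprime?; prime⇒coprime; coprime-Bézout)
open import Data.Nat.Divisibility using (_∣_; _∣?_; divides; ∣⇒≤; ∣-trans; ∣1⇒≡1; m∣m*n; n∣m*n; ∣n⇒∣m*n; ∣m+n∣m⇒∣n;
    m%n≡0⇒n∣m; n∣m⇒m%n≡0)
open import Data.Nat.DivMod using (_mod_; m%n<n; m<n⇒m%n≡m; m*n%n≡0; m/n*n≡m; n%n≡0; %-distribˡ-+; %-distribˡ-*;
    [m+kn]%n≡m%n)
open import Data.Nat.GCD using (module Bézout)
open import Data.Nat.ListAction using (product)
open import Data.Nat.Primality using (Prime; ¬prime[0]; ¬prime[1]; euclidsLemma; prime⇒irreducible; irreducible[2])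
open import Data.Nat.Primality.Factorisation using (factorise; PrimeFactorisation)
import Data.Nat.Properties as ℕ
open import Data.Nat.Tactic.RingSolver using (solve-∀)
open import Data.Product using (Σ; ∃; _×_; _,_; proj₁; proj₂)
open import Data.Sum using (_⊎_; inj₁; inj₂)
open import Data.Vec.Functional using (insertAt)
open import Data.Vec.Functional.Properties using (insertAt-lookup; insertAt-punchIn)
open import Function using (_∘_)
open import Function.Bundles using (_↔_; mk↔ₛ′)
open import Level using (0ℓ; _⊔_)
open import Relation.Binary.PropositionalEquality as ≡ using (_≡_; _≢_; module ≡-Reasoning)
import Relation.Binary.Reasoning.Setoid as SetoidReasoning
open import Relation.Nullary using (¬_; Dec; yes; no)
open import Relation.Nullary.Decidable using (⌊_⌋; ¬?; _×-dec_; decidable-stable)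
open +-*-Solver using (solve; _:+_; _:*_; :-_; _:-_; _:=_; con)

-- Residues

-- Two obstacles shape the development. The hypothesis compares characteristic polynomials at
-- integers only, whereas they are needed at a cyclotomic integer; they are therefore rebuilt as
-- integer coefficient lists, which specialise to any commutative ring. In that ring the character
-- table is not invertible, so diagonalisation becomes an identity of determinants: it requires
-- multiplicativity over an arbitrary commutative ring, and the absence of zero divisors both
-- cancels the determinant of the table and isolates one vanishing factor t - λ_{a,b}(β).
--
-- The absence of zero divisors is the irreducibility of cyclotomic polynomials in disguise. A
-- Galois automorphism is not represented by one large prime, which would call for Dirichlet's
-- theorem, but by an integer in the right class modulo p and ℓ all of whose prime factors are
-- large. Testing elements through the integers `κ z g`, the traces of ζ^g z, turns equality into
-- finitely many integer equations, so that divisibility by r can be played against size and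
-- vanishing is decidable.

module Residues (n : ℕ) .{{_ : NonZero n}} where

  toℕ-mod : ∀ k → toℕ (k mod n) ≡ k % n
  toℕ-mod k = toℕ-fromℕ< (m%n<n k n)

  mod-cong : ∀ {j k} → j % n ≡ k % n → j mod n ≡ k mod n
  mod-cong {j} {k} eq = toℕ-injective (≡.trans (toℕ-mod j) (≡.trans eq (≡.sym (toℕ-mod k))))

  mod-% : ∀ {j k} → j mod n ≡ k mod n → j % n ≡ k % n
  mod-% {j} {k} eq = ≡.trans (≡.sym (toℕ-mod j)) (≡.trans (≡.cong toℕ eq) (toℕ-mod k))

  mod-toℕ : ∀ x → toℕ x mod n ≡ x
  mod-toℕ x = toℕ-injective (≡.trans (toℕ-mod (toℕ x)) (m<n⇒m%n≡m (toℕ<n x)))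

  addM-mod : ∀ j k → addM n (j mod n) (k mod n) ≡ (j ℕ.+ k) mod n
  addM-mod j k rewrite toℕ-mod j | toℕ-mod k = mod-cong (≡.sym (%-distribˡ-+ j k n))

  mulM-mod : ∀ j k → mulM n (j mod n) (k mod n) ≡ (j ℕ.* k) mod n
  mulM-mod j k rewrite toℕ-mod j | toℕ-mod k = mod-cong (≡.sym (%-distribˡ-* j k n))

  0%n≡0 : 0 % n ≡ 0
  0%n≡0 = m*n%n≡0 0 n

  infixl 6 _+_
  infixl 7 _*_
  _+_ _*_ : Fin n → Fin n → Fin n
  _+_ = addM n
  _*_ = mulM n

  private
    -- A ring law on `Fin n` reduces to the same law in ℕ once every argument is the residue of a
    -- natural number; these four lemmas bring mixed terms into that shape.
    lift-+ˡ : ∀ j z → (j mod n) + z ≡ (j ℕ.+ toℕ z) mod n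
    lift-+ˡ j z = ≡.trans (≡.cong (addM n (j mod n)) (≡.sym (mod-toℕ z))) (addM-mod j (toℕ z))
    lift-+ʳ : ∀ x k → x + (k mod n) ≡ (toℕ x ℕ.+ k) mod n
    lift-+ʳ x k = ≡.trans (≡.cong (_+ (k mod n)) (≡.sym (mod-toℕ x))) (addM-mod (toℕ x) k)
    lift-*ˡ : ∀ j z → (j mod n) * z ≡ (j ℕ.* toℕ z) mod n
    lift-*ˡ j z = ≡.trans (≡.cong ((j mod n) *_) (≡.sym (mod-toℕ z))) (mulM-mod j (toℕ z))
    lift-*ʳ : ∀ x k → x * (k mod n) ≡ (toℕ x ℕ.* k) mod n
    lift-*ʳ x k = ≡.trans (≡.cong (_* (k mod n)) (≡.sym (mod-toℕ x))) (mulM-mod (toℕ x) k)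

  +-comm : ∀ x y → x + y ≡ y + x
  +-comm x y = ≡.cong (_mod n) (ℕ.+-comm (toℕ x) (toℕ y))

  +-assoc : ∀ x y z → x + y + z ≡ x + (y + z)
  +-assoc x y z = ≡.trans (lift-+ˡ (toℕ x ℕ.+ toℕ y) z) (≡.trans (≡.cong (_mod n) (ℕ.+-assoc (toℕ x) (toℕ y) (toℕ z)))
    (≡.sym (lift-+ʳ x (toℕ y ℕ.+ toℕ z))))

  +-identityˡ : ∀ x → zeroM n + x ≡ x
  +-identityˡ x = ≡.trans (lift-+ˡ 0 x) (mod-toℕ x)

  +-inverseʳ : ∀ x → x + negM n x ≡ zeroM n
  +-inverseʳ x = ≡.trans (lift-+ʳ x (n ℕ.∸ toℕ x)) (≡.trans (≡.cong (_mod n) (ℕ.m+[n∸m]≡n (ℕ.<⇒≤ (toℕ<n x))))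
    (mod-cong (≡.trans (n%n≡0 n) (≡.sym 0%n≡0))))

  *-comm : ∀ x y → x * y ≡ y * x
  *-comm x y = ≡.cong (_mod n) (ℕ.*-comm (toℕ x) (toℕ y))

  *-assoc : ∀ x y z → x * y * z ≡ x * (y * z)
  *-assoc x y z = ≡.trans (lift-*ˡ (toℕ x ℕ.* toℕ y) z) (≡.trans (≡.cong (_mod n) (ℕ.*-assoc (toℕ x) (toℕ y) (toℕ z)))
    (≡.sym (lift-*ʳ x (toℕ y ℕ.* toℕ z))))

  *-identityˡ : ∀ x → oneM n * x ≡ x
  *-identityˡ x = ≡.trans (lift-*ˡ 1 x) (≡.trans (≡.cong (_mod n) (ℕ.*-identityˡ (toℕ x))) (mod-toℕ x))

  *-distribˡ-+ : ∀ x y z → x * (y + z) ≡ x * y + x * z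
  *-distribˡ-+ x y z = ≡.trans (lift-*ʳ x (toℕ y ℕ.+ toℕ z)) (≡.trans
    (≡.cong (_mod n) (ℕ.*-distribˡ-+ (toℕ x) (toℕ y) (toℕ z)))
    (≡.sym (addM-mod (toℕ x ℕ.* toℕ y) (toℕ x ℕ.* toℕ z))))

  commutativeRing : CommutativeRing 0ℓ 0ℓ
  commutativeRing = record
    { Carrier = Fin n ; _≈_ = _≡_ ; _+_ = _+_ ; _*_ = _*_ ; -_ = negM n ; 0# = zeroM n ; 1# = oneM n
    ; isCommutativeRing = record
      { isRing = record
        { +-isAbelianGroup = record
          { isGroup = record
            { isMonoid = record
              { isSemigroup = record
                { isMagma = record { isEquivalence = ≡.isEquivalence ; ∙-cong = ≡.cong₂ _+_ }
                ; assoc = +-assoc }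
              ; identity = +-identityˡ , λ x → ≡.trans (+-comm x _) (+-identityˡ x) }
            ; inverse = (λ x → ≡.trans (+-comm _ x) (+-inverseʳ x)) , +-inverseʳ
            ; ⁻¹-cong = ≡.cong (negM n) }
          ; comm = +-comm }
        ; *-cong = ≡.cong₂ _*_
        ; *-assoc = *-assoc
        ; *-identity = *-identityˡ , λ x → ≡.trans (*-comm x _) (*-identityˡ x)
        ; distrib = *-distribˡ-+ , λ x y z → ≡.trans (*-comm (y + z) x)
            (≡.trans (*-distribˡ-+ x y z) (≡.cong₂ _+_ (*-comm x y) (*-comm x z))) }
      ; *-comm = *-comm } }

  +-cancel-subM : ∀ x y → subM n (x + y) x ≡ y
  +-cancel-subM x y = ≡.trans (≡.cong (λ z → subM n z x) (+-comm x y)) (≡.trans (+-assoc y x _)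
    (≡.trans (≡.cong (addM n y) (+-inverseʳ x)) (CommutativeRing.+-identityʳ commutativeRing y)))

  subM-cancel-+ : ∀ x y → x + subM n y x ≡ y
  subM-cancel-+ x y = ≡.trans (≡.sym (+-assoc x y _)) (+-cancel-subM x y)

  *-distribˡ-subM : ∀ c y x → c * subM n y x ≡ subM n (c * y) (c * x)
  *-distribˡ-subM = RingProperties.x[y-z]≈xy-xz (CommutativeRing.ring commutativeRing)

  *-inverse-cancel : ∀ c d → c * d ≡ oneM n → ∀ x → c * (d * x) ≡ x
  *-inverse-cancel c d cd≡1 x =
    ≡.trans (≡.sym (*-assoc c d x)) (≡.trans (≡.cong (_* x) cd≡1) (*-identityˡ x))

  mod≡0⇒∣ : ∀ k → k mod n ≡ zeroM n → n ∣ k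
  mod≡0⇒∣ k eq = m%n≡0⇒n∣m k n (≡.trans (mod-% eq) 0%n≡0)

  ∣⇒mod≡0 : ∀ k → n ∣ k → k mod n ≡ zeroM n
  ∣⇒mod≡0 k n∣k = mod-cong (≡.trans (n∣m⇒m%n≡0 k n n∣k) (≡.sym 0%n≡0))

  module _ (isPrime : Prime n) where

    1≢0 : oneM n ≢ zeroM n
    1≢0 eq = ¬prime[1] (≡.subst Prime (∣1⇒≡1 (mod≡0⇒∣ 1 eq)) isPrime)

    -- Bézout over ℕ comes with two signs: 1 + a n = b x makes b the inverse, and 1 + b x = a n
    -- makes -b the inverse. The representative is exposed as `suc k` because coprimality to n is
    -- available for nonzero numbers below n.
    inverse-suc : ∀ x k → toℕ x ≡ suc k → ∃ λ y → x * y ≡ oneM n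
    inverse-suc x k eq with coprime-Bézout (prime⇒coprime isPrime (≡.subst (ℕ._< n) eq (toℕ<n x)))
    ... | Bézout.-+ a b e = b mod n , (begin
      x * (b mod n) ≡⟨ *-comm x _ ⟩
      (b mod n) * x ≡⟨ lift-*ˡ b x ⟩
      (b ℕ.* toℕ x) mod n ≡⟨ ≡.cong (λ z → (b ℕ.* z) mod n) eq ⟩
      (b ℕ.* suc k) mod n ≡⟨ ≡.cong (_mod n) e ⟨
      (1 ℕ.+ a ℕ.* n) mod n ≡⟨ mod-cong ([m+kn]%n≡m%n 1 a n) ⟩
      oneM n ∎)
      where open ≡-Reasoning
    ... | Bézout.+- a b e = negM n (b mod n) , (begin
      x * negM n (b mod n)  ≡⟨ -‿distribʳ-* x (b mod n) ⟨
      negM n (x * (b mod n)) ≡⟨ +-inverseˡ-unique (oneM n) (x * (b mod n)) vanishes ⟨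
      oneM n ∎)
      where
      open ≡-Reasoning
      open RingProperties (CommutativeRing.ring commutativeRing) using (-‿distribʳ-*; +-inverseˡ-unique)
      vanishes : oneM n + x * (b mod n) ≡ zeroM n
      vanishes = begin
        oneM n + x * (b mod n) ≡⟨ ≡.cong (addM n (oneM n)) (≡.trans (*-comm x _) (lift-*ˡ b x)) ⟩
        oneM n + ((b ℕ.* toℕ x) mod n) ≡⟨ addM-mod 1 (b ℕ.* toℕ x) ⟩
        (1 ℕ.+ b ℕ.* toℕ x) mod n ≡⟨ ≡.cong (λ z → (1 ℕ.+ b ℕ.* z) mod n) eq ⟩
        (1 ℕ.+ b ℕ.* suc k) mod n ≡⟨ ≡.cong (_mod n) e ⟩
        (a ℕ.* n) mod n ≡⟨ ∣⇒mod≡0 (a ℕ.* n) (divides a ≡.refl) ⟩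
        zeroM n ∎

    inverse : ∀ x → x ≢ zeroM n → ∃ λ y → x * y ≡ oneM n
    inverse x x≢0 = nonzero (toℕ x) ≡.refl
      where
      nonzero : ∀ k → toℕ x ≡ k → ∃ λ y → x * y ≡ oneM n
      nonzero zero    eq = ⊥-elim (x≢0 (≡.trans (≡.sym (mod-toℕ x)) (≡.cong (_mod n) eq)))
      nonzero (suc k) eq = inverse-suc x k eq

    *-cancelˡ-≢0 : ∀ x {y z} → x ≢ zeroM n → x * y ≡ x * z → y ≡ z
    *-cancelˡ-≢0 x {y} {z} x≢0 eq with inverse x x≢0
    ... | x⁻¹ , inv = ≡.trans (≡.sym (undo y)) (≡.trans (≡.cong (x⁻¹ *_) eq) (undo z))
      where
      undo : ∀ y → x⁻¹ * (x * y) ≡ y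
      undo = *-inverse-cancel x⁻¹ x (≡.trans (*-comm x⁻¹ x) inv)

-- Determinants

module FiniteSum {c ℓ} (R : CommutativeRing c ℓ) where
  open CommutativeRing R hiding (zero)
  open SemiringSum semiring
  open SetoidReasoning setoid

  sum-zero : ∀ {n} (f : Fin n → Carrier) → (∀ i → f i ≈ 0#) → sum f ≈ 0#
  sum-zero {n} f eq = trans (sum-cong-≋ eq) (sum-replicate-zero n)

  sum-select : ∀ {n} (f : Fin n → Carrier) i → (∀ k → k ≢ i → f k ≈ 0#) → sum f ≈ f i
  sum-select {suc n} f i off = begin
    sum f                            ≈⟨ sum-remove {i = i} f ⟩
    f i + sum (λ k → f (punchIn i k)) ≈⟨ +-congˡ (sum-zero _ (λ k → off _ (punchInᵢ≢i i k))) ⟩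
    f i + 0#                         ≈⟨ +-identityʳ _ ⟩
    f i                              ∎

-- Over a raw ring, because the same expansion is also formed with coefficient lists, on which the
-- ring laws fail as identities.
module RawDeterminant {c ℓ} (S : RawRing c ℓ) where
  open RawRing S
  open RawMonoidSum +-rawMonoid using (sum)

  sign : ℕ → Carrier
  sign zero    = 1#
  sign (suc k) = - sign k

  determinant : ∀ n → (Fin n → Fin n → Carrier) → Carrier
  determinant zero    A = 1#
  determinant (suc n) A = sum {suc n} λ j →
    sign (toℕ j) * A zero j * determinant n (λ r c → A (suc r) (punchIn j c))

-- Coinciding columns are first treated for neighbours only: their two cofactors cancel because
-- consecutive signs are opposite, with no transpositions to count. The inductive form lets proofs
-- recurse along `punchIn`.
data Next : ∀ {n} → Fin n → Fin n → Set where
  here  : ∀ {n} → Next {suc (suc n)} zero (suc zero)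
  there : ∀ {n} {i k : Fin n} → Next i k → Next (suc i) (suc k)

next-inject₁ : ∀ {n} (i : Fin n) → Next (inject₁ i) (suc i)
next-inject₁ zero    = here
next-inject₁ (suc i) = there (next-inject₁ i)

next⇒≢ : ∀ {n} {i k : Fin n} → Next i k → i ≢ k
next⇒≢ here      ()
next⇒≢ (there x) eq = next⇒≢ x (suc-injective eq)

next⇒toℕ : ∀ {n} {i k : Fin n} → Next i k → toℕ k ≡ suc (toℕ i)
next⇒toℕ here      = ≡.refl
next⇒toℕ (there x) = ≡.cong suc (next⇒toℕ x)

-- Deleting an index outside the pair leaves its members adjacent, as the induction on minors in
-- `determinant-alternating` requires.
punchIn-next : ∀ {n} {i k : Fin (suc n)} → Next i k → ∀ j → j ≢ i → j ≢ k →
  ∃ λ i′ → ∃ λ k′ → Next i′ k′ × punchIn j i′ ≡ i × punchIn j k′ ≡ k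
punchIn-next here zero          j≢i j≢k = ⊥-elim (j≢i ≡.refl)
punchIn-next here (suc zero)    j≢i j≢k = ⊥-elim (j≢k ≡.refl)
punchIn-next {suc (suc n)} here (suc (suc j)) j≢i j≢k = zero , suc zero , here , ≡.refl , ≡.refl
punchIn-next (there x) zero     j≢i j≢k = _ , _ , x , ≡.refl , ≡.refl
punchIn-next {suc n} (there x) (suc j)  j≢i j≢k
  with punchIn-next x j (j≢i ∘ ≡.cong suc) (j≢k ∘ ≡.cong suc)
... | i′ , k′ , x′ , ≡.refl , ≡.refl = suc i′ , suc k′ , there x′ , ≡.refl , ≡.refl

-- Deleting i and deleting k leave the same sequence of indices, except at the one position where
-- the other member of the pair survives.
punchIn-next-agree : ∀ {n} {i k : Fin (suc n)} → Next i k → ∀ c →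
  punchIn i c ≡ punchIn k c ⊎ (punchIn i c ≡ k × punchIn k c ≡ i)
punchIn-next-agree here      zero    = inj₂ (≡.refl , ≡.refl)
punchIn-next-agree here      (suc c) = inj₁ ≡.refl
punchIn-next-agree (there x) zero    = inj₁ ≡.refl
punchIn-next-agree (there x) (suc c) with punchIn-next-agree x c
... | inj₁ eq        = inj₁ (≡.cong suc eq)
... | inj₂ (eq , eq′) = inj₂ (≡.cong suc eq , ≡.cong suc eq′)

punchIn-view : ∀ {n} (j c : Fin (suc n)) → j ≡ c ⊎ ∃ λ c′ → punchIn j c′ ≡ c
punchIn-view j c with j ≟ c
... | yes eq  = inj₁ eq
... | no  j≢c = inj₂ (punchOut j≢c , punchIn-punchOut j≢c)

module Determinant {c ℓ} (R : CommutativeRing c ℓ) where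
  open CommutativeRing R hiding (zero)
  open RawDeterminant rawRing public
  open SemiringSum semiring
  open FiniteSum R using (sum-zero; sum-select)
  open RingProperties ring using (-‿distribˡ-*; -0#≈0#)
  open SetoidReasoning setoid

  Matrix : ℕ → Set c
  Matrix n = Fin n → Fin n → Carrier

  δ : ∀ {n} → Matrix n
  δ i j with i ≟ j
  ... | yes _ = 1#
  ... | no  _ = 0#

  δ-refl : ∀ {n} (i : Fin n) → δ i i ≡ 1#
  δ-refl i with i ≟ i
  ... | yes _ = ≡.refl
  ... | no  q = ⊥-elim (q ≡.refl)

  δ-≢ : ∀ {n} {i j : Fin n} → i ≢ j → δ i j ≡ 0#
  δ-≢ {i = i} {j} i≢j with i ≟ j
  ... | yes q = ⊥-elim (i≢j q)
  ... | no  _ = ≡.refl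

  sum-next : ∀ {n} {i k : Fin n} → Next i k → (f : Fin n → Carrier) → f i + f k ≈ 0# →
    (∀ j → j ≢ i → j ≢ k → f j ≈ 0#) → sum f ≈ 0#
  sum-next here f fi+fk off = begin
    f zero + (f (suc zero) + sum (λ j → f (suc (suc j)))) ≈⟨ +-assoc _ _ _ ⟨
    (f zero + f (suc zero)) + sum (λ j → f (suc (suc j)))
        ≈⟨ +-cong fi+fk (sum-zero _ (λ j → off (suc (suc j)) (λ ()) (λ ()))) ⟩
    0# + 0#                                               ≈⟨ +-identityˡ _ ⟩
    0#                                                    ∎
  sum-next (there x) f fi+fk off = begin
    f zero + sum (λ j → f (suc j)) ≈⟨ +-cong (off zero (λ ()) (λ ())) (sum-next x (f ∘ suc) fi+fk
                                        (λ j j≢i j≢k → off (suc j) (j≢i ∘ suc-injective) (j≢k ∘ suc-injective))) ⟩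
    0# + 0#                        ≈⟨ +-identityˡ _ ⟩
    0#                             ∎

  -- The form acts on rows and stays abstract because uniqueness is applied to several: the
  -- determinant of the transpose, its composite with right multiplication by a fixed matrix, and a
  -- given form restricted to bordered matrices. `linear` relates its three matrices by hypotheses,
  -- so they need not literally be row updates of one another.
  record IsAlternating {n} (D : Matrix n → Carrier) : Set (c ⊔ ℓ) where
    field
      cong : ∀ {A B} → (∀ i j → A i j ≈ B i j) → D A ≈ D B
      linear : ∀ i {A B C} a b →
        (∀ k → k ≢ i → ∀ j → C k j ≈ A k j) →
        (∀ k → k ≢ i → ∀ j → C k j ≈ B k j) →
        (∀ j → C i j ≈ a * A i j + b * B i j) →
        D C ≈ a * D A + b * D B
      alternating : ∀ {i k} → Next i k → ∀ {A} → (∀ j → A i j ≈ A k j) → D A ≈ 0#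

  _ᵀ : ∀ {n} → Matrix n → Matrix n
  (A ᵀ) i j = A j i

  minor : ∀ {n} → Matrix (suc n) → Fin (suc n) → Matrix n
  minor A j r c = A (suc r) (punchIn j c)

  determinant-cong : ∀ n {A B : Matrix n} → (∀ i j → A i j ≈ B i j) → determinant n A ≈ determinant n B
  determinant-cong zero    eq = refl
  determinant-cong (suc n) eq = sum-cong-≋ λ j →
    *-cong (*-congˡ {x = sign (toℕ j)} (eq zero j)) (determinant-cong n (λ r c → eq (suc r) (punchIn j c)))

  -- In the expansion along row 0 exactly one factor of each term involves column i: the entry if
  -- column i is the deleted one, the minor otherwise.
  determinant-linear : ∀ n i {A B C : Matrix n} a b →
    (∀ k → k ≢ i → ∀ r → C r k ≈ A r k) →
    (∀ k → k ≢ i → ∀ r → C r k ≈ B r k) →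
    (∀ r → C r i ≈ a * A r i + b * B r i) →
    determinant n C ≈ a * determinant n A + b * determinant n B
  determinant-linear (suc n) i {A} {B} {C} a b eqA eqB eqC = begin
    sum (term C)                                    ≈⟨ sum-cong-≋ step ⟩
    sum (λ j → a * term A j + b * term B j)         ≈⟨ ∑-distrib-+ (λ j → a * term A j) (λ j → b * term B j) ⟩
    sum (λ j → a * term A j) + sum (λ j → b * term B j)
        ≈⟨ +-cong (*-distribˡ-sum a (term A)) (*-distribˡ-sum b (term B)) ⟨
    a * sum (term A) + b * sum (term B)             ∎
    where
    term : Matrix (suc n) → Fin (suc n) → Carrier
    term X j = sign (toℕ j) * X zero j * determinant n (minor X j)
    move : ∀ s a x m → s * (a * x) * m ≈ a * (s * x * m)
    move s a x m = trans (*-congʳ (trans (sym (*-assoc s a x)) (trans (*-congʳ (*-comm s a)) (*-assoc a s x))))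
                         (*-assoc a (s * x) m)
    move′ : ∀ s a x m → s * x * (a * m) ≈ a * (s * x * m)
    move′ s a x m = trans (sym (*-assoc (s * x) a m)) (trans (*-congʳ (*-comm (s * x) a)) (*-assoc a (s * x) m))
    step : ∀ j → term C j ≈ a * term A j + b * term B j
    step j with punchIn-view j i
    ... | inj₁ ≡.refl = begin
      s * C zero j * m C                            ≈⟨ *-congʳ (*-congˡ (eqC zero)) ⟩
      s * (a * A zero j + b * B zero j) * m C       ≈⟨ *-congʳ (distribˡ s _ _) ⟩
      (s * (a * A zero j) + s * (b * B zero j)) * m C ≈⟨ distribʳ (m C) _ _ ⟩
      s * (a * A zero j) * m C + s * (b * B zero j) * m C
        ≈⟨ +-cong (*-congˡ (determinant-cong n λ r k → eqA _ (punchInᵢ≢i j k) (suc r)))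
                  (*-congˡ (determinant-cong n λ r k → eqB _ (punchInᵢ≢i j k) (suc r))) ⟩
      s * (a * A zero j) * m A + s * (b * B zero j) * m B ≈⟨ +-cong (move s a _ _) (move s b _ _) ⟩
      a * term A j + b * term B j                   ∎
      where
      s = sign (toℕ j)
      m : Matrix (suc n) → Carrier
      m X = determinant n (minor X j)
    ... | inj₂ (i′ , ≡.refl) = begin
      s * C zero j * m C                            ≈⟨ *-congˡ (determinant-linear n i′ a b
                                                         (λ k k≢ r → eqA _ (k≢ ∘ punchIn-injective j k i′) (suc r))
                                                         (λ k k≢ r → eqB _ (k≢ ∘ punchIn-injective j k i′) (suc r))
                                                         (λ r → eqC (suc r))) ⟩
      s * C zero j * (a * m A + b * m B)            ≈⟨ distribˡ _ _ _ ⟩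
      s * C zero j * (a * m A) + s * C zero j * (b * m B)
        ≈⟨ +-cong (*-congʳ (*-congˡ (eqA j (λ e → punchInᵢ≢i j i′ (≡.sym e)) zero)))
                  (*-congʳ (*-congˡ (eqB j (λ e → punchInᵢ≢i j i′ (≡.sym e)) zero))) ⟩
      s * A zero j * (a * m A) + s * B zero j * (b * m B) ≈⟨ +-cong (move′ s a _ _) (move′ s b _ _) ⟩
      a * term A j + b * term B j                   ∎
      where
      s = sign (toℕ j)
      m : Matrix (suc n) → Carrier
      m X = determinant n (minor X j)

  -- The terms at i and k have equal minors and opposite signs; every other minor still contains two
  -- equal adjacent columns.
  determinant-alternating : ∀ n {i k} → Next i k → {A : Matrix n} → (∀ r → A r i ≈ A r k) → determinant n A ≈ 0#
  determinant-alternating (suc n) {i} {k} x {A} eq = sum-next x term cancel vanish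
    where
    term : Fin (suc n) → Carrier
    term j = sign (toℕ j) * A zero j * determinant n (minor A j)
    minors : ∀ r c → A (suc r) (punchIn k c) ≈ A (suc r) (punchIn i c)
    minors r c with punchIn-next-agree x c
    ... | inj₁ e        = reflexive (≡.cong (A (suc r)) (≡.sym e))
    ... | inj₂ (e , e′) = trans (reflexive (≡.cong (A (suc r)) e′))
                            (trans (eq (suc r)) (reflexive (≡.cong (A (suc r)) (≡.sym e))))
    cancel : term i + term k ≈ 0#
    cancel = begin
      term i + term k ≈⟨ +-congˡ (*-cong (*-cong (reflexive (≡.cong sign (next⇒toℕ x))) (sym (eq zero)))
          (determinant-cong n minors)) ⟩
      term i + - s * A zero i * m ≈⟨ +-congˡ (*-congʳ (-‿distribˡ-* s _)) ⟨
      term i + - (s * A zero i) * m ≈⟨ +-congˡ (-‿distribˡ-* _ m) ⟨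
      term i + - term i ≈⟨ -‿inverseʳ _ ⟩
      0# ∎
      where
      s = sign (toℕ i)
      m = determinant n (minor A i)
    vanish : ∀ j → j ≢ i → j ≢ k → term j ≈ 0#
    vanish j j≢i j≢k with punchIn-next x j j≢i j≢k
    ... | i′ , k′ , x′ , ≡.refl , ≡.refl =
      trans (*-congˡ (determinant-alternating n x′ (λ r → eq (suc r)))) (zeroʳ _)

  transpose-isAlternating : ∀ n → IsAlternating {n} (λ A → determinant n (A ᵀ))
  transpose-isAlternating n = record
    { cong        = λ eq → determinant-cong n (λ i j → eq j i)
    ; linear      = λ i a b eqA eqB eqC → determinant-linear n i a b eqA eqB eqC
    ; alternating = λ x eq → determinant-alternating n x eq
    }

  replace : ∀ {n} → Fin n → (Fin n → Carrier) → Matrix n → Matrix n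
  replace i u A r with r ≟ i
  ... | yes _ = u
  ... | no  _ = A r

  replace-at : ∀ {n} i u (A : Matrix n) → replace i u A i ≡ u
  replace-at i u A with i ≟ i
  ... | yes _ = ≡.refl
  ... | no  q = ⊥-elim (q ≡.refl)

  replace-off : ∀ {n} {i r} u (A : Matrix n) → r ≢ i → replace i u A r ≡ A r
  replace-off {i = i} {r} u A r≢i with r ≟ i
  ... | yes q = ⊥-elim (r≢i q)
  ... | no  _ = ≡.refl

  rowEq : ∀ {n} {u v : Fin n → Carrier} → u ≡ v → ∀ j → u j ≈ v j
  rowEq ≡.refl j = refl

  module AlternatingForm {n} {D : Matrix n → Carrier} (isAlternating : IsAlternating D) where
    open IsAlternating isAlternating

    linear-replace : ∀ i A u v w a b → (∀ j → w j ≈ a * u j + b * v j) →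
      D (replace i w A) ≈ a * D (replace i u A) + b * D (replace i v A)
    linear-replace i A u v w a b eq = linear i a b
      (λ k k≢ → rowEq (≡.trans (replace-off w A k≢) (≡.sym (replace-off u A k≢))))
      (λ k k≢ → rowEq (≡.trans (replace-off w A k≢) (≡.sym (replace-off v A k≢))))
      (λ j → trans (rowEq (replace-at i w A) j) (trans (eq j)
        (sym (+-cong (*-congˡ (rowEq (replace-at i u A) j)) (*-congˡ (rowEq (replace-at i v A) j))))))

    zero-row : ∀ i A → (∀ j → A i j ≈ 0#) → D A ≈ 0#
    zero-row i A eq = begin
      D A                   ≈⟨ linear i {A} {A} {A} 0# 0# (λ _ _ _ → refl) (λ _ _ _ → refl)
                                 (λ j → trans (eq j) (sym (trans (+-cong (zeroˡ _) (zeroˡ _)) (+-identityˡ _)))) ⟩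
      0# * D A + 0# * D A   ≈⟨ +-cong (zeroˡ _) (zeroˡ _) ⟩
      0# + 0#               ≈⟨ +-identityˡ _ ⟩
      0#                    ∎

    expand-row : ∀ {m} i A (a : Fin m → Carrier) (v : Fin m → Fin n → Carrier) u →
      (∀ j → u j ≈ sum (λ k → a k * v k j)) →
      D (replace i u A) ≈ sum (λ k → a k * D (replace i (v k) A))
    expand-row {zero}  i A a v u eq = zero-row i (replace i u A) (λ j → trans (rowEq (replace-at i u A) j) (eq j))
    expand-row {suc m} i A a v u eq = begin
      D (replace i u A) ≈⟨ linear-replace i A (v zero) rest u (a zero) 1#
                             (λ j → trans (eq j) (+-congˡ (sym (*-identityˡ _)))) ⟩
      a zero * D (replace i (v zero) A) + 1# * D (replace i rest A)
        ≈⟨ +-congˡ (trans (*-identityˡ _) (expand-row i A (a ∘ suc) (v ∘ suc) rest (λ _ → refl))) ⟩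
      sum (λ k → a k * D (replace i (v k) A)) ∎
      where
      rest : Fin n → Carrier
      rest j = sum (λ k → a (suc k) * v (suc k) j)

    VanishesOn : Fin n → Fin n → Set _
    VanishesOn i k = ∀ A → (∀ j → A i j ≈ A k j) → D A ≈ 0#

    -- Polarisation: with the sum of rows i and k of A placed in both positions the form vanishes,
    -- and expanding by linearity leaves D A + D B = 0.
    swap : ∀ {i k} → i ≢ k → VanishesOn i k → ∀ A B →
      (∀ j → B i j ≈ A k j) → (∀ j → B k j ≈ A i j) → (∀ r → r ≢ i → r ≢ k → ∀ j → B r j ≈ A r j) →
      D B ≈ - D A
    swap {i} {k} i≢k vanish A B eqi eqk eq = sym (begin
      - D A                      ≈⟨ +-identityʳ _ ⟨
      - D A + 0#                 ≈⟨ +-congˡ total ⟨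
      - D A + (D A + D B)        ≈⟨ +-assoc _ _ _ ⟨
      - D A + D A + D B          ≈⟨ +-congʳ (-‿inverseˡ _) ⟩
      0# + D B                   ≈⟨ +-identityˡ _ ⟩
      D B                        ∎)
      where
      M : (Fin n → Carrier) → (Fin n → Carrier) → Matrix n
      M u v = replace i u (replace k v A)
      M-i : ∀ u v → M u v i ≡ u
      M-i u v = replace-at i u _
      M-k : ∀ u v → M u v k ≡ v
      M-k u v = ≡.trans (replace-off u _ (i≢k ∘ ≡.sym)) (replace-at k v A)
      same : ∀ u → D (M u u) ≈ 0#
      same u = vanish _ (rowEq (≡.trans (M-i u u) (≡.sym (M-k u u))))
      t : Fin n → Carrier
      t j = A i j + A k j
      unit : ∀ x y → x + y ≈ 1# * x + 1# * y
      unit x y = sym (+-cong (*-identityˡ x) (*-identityˡ y))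
      left : ∀ v → D (M t v) ≈ D (M (A i) v) + D (M (A k) v)
      left v = trans (linear-replace i (replace k v A) (A i) (A k) t 1# 1# (λ j → unit _ _)) (sym (unit _ _))
      right : ∀ u → D (M u t) ≈ D (M u (A i)) + D (M u (A k))
      right u = trans (linear k {M u (A i)} {M u (A k)} {M u t} 1# 1# (off (A i)) (off (A k))
        (λ j → trans (rowEq (M-k u t) j) (trans (unit _ _)
          (sym (+-cong (*-congˡ (rowEq (M-k u (A i)) j)) (*-congˡ (rowEq (M-k u (A k)) j))))))) (sym (unit _ _))
        where
        off : ∀ v r → r ≢ k → ∀ j → M u t r j ≈ M u v r j
        off v r r≢k with r ≟ i
        ... | yes _   = λ j → refl
        ... | no  r≢i = rowEq (≡.trans (replace-off t A r≢k) (≡.sym (replace-off v A r≢k)))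
      fromM : ∀ u v X → (∀ j → X i j ≈ u j) → (∀ j → X k j ≈ v j) →
        (∀ r → r ≢ i → r ≢ k → ∀ j → X r j ≈ A r j) → D (M u v) ≈ D X
      fromM u v X ei ek eo = cong go
        where
        go : ∀ r j → M u v r j ≈ X r j
        go r j with r ≟ i | r ≟ k
        ... | yes ≡.refl | _          = sym (ei j)
        ... | no _       | yes ≡.refl = trans (rowEq (replace-at k v A) j) (sym (ek j))
        ... | no r≢i     | no r≢k     = trans (rowEq (replace-off v A r≢k) j) (sym (eo r r≢i r≢k j))
      total : D A + D B ≈ 0#
      total = begin
        D A + D B ≈⟨ +-cong (fromM (A i) (A k) A (λ _ → refl) (λ _ → refl) (λ _ _ _ _ → refl))
                            (fromM (A k) (A i) B eqi eqk eq) ⟨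
        D (M (A i) (A k)) + D (M (A k) (A i)) ≈⟨ +-cong (+-identityˡ _) (+-identityʳ _) ⟨
        (0# + D (M (A i) (A k))) + (D (M (A k) (A i)) + 0#) ≈⟨ +-cong (+-congʳ (same (A i))) (+-congˡ (same (A k))) ⟨
        (D (M (A i) (A i)) + D (M (A i) (A k))) +
            (D (M (A k) (A i)) + D (M (A k) (A k))) ≈⟨ +-cong (right (A i)) (right (A k)) ⟨
        D (M (A i) t) + D (M (A k) t) ≈⟨ left t ⟨
        D (M t t) ≈⟨ same t ⟩
        0# ∎

  open AlternatingForm

  -- Induction on the distance from row 0: exchanging two adjacent rows costs only a sign and moves
  -- the repeated row one place closer.
  vanishesOn-zero : ∀ {n} {D : Matrix (suc n) → Carrier} (alt : IsAlternating D) (k : Fin n) →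
    VanishesOn alt zero (suc k)
  vanishesOn-zero {suc n} {D} alt = <-weakInduction (λ k → VanishesOn alt zero (suc k))
    (λ A eq → IsAlternating.alternating alt here {A} eq) step
    where
    step : ∀ i → VanishesOn alt zero (suc (inject₁ i)) → VanishesOn alt zero (suc (suc i))
    step i vanish A eq = begin
      D A     ≈⟨ swap alt (next⇒≢ x) (λ X → IsAlternating.alternating alt x {X}) B A
                   (λ j → sym (B-r₂ j)) (λ j → sym (B-r₁ j)) (λ r p q j → sym (B-off r p q j)) ⟩
      - D B   ≈⟨ -‿cong (vanish B (λ j → trans (trans (B-off zero (λ ()) (λ ()) j) (eq j)) (sym (B-r₁ j)))) ⟩
      - 0#    ≈⟨ -0#≈0# ⟩
      0#      ∎
      where
      r₁ r₂ : Fin (suc (suc n))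
      r₁ = suc (inject₁ i)
      r₂ = suc (suc i)
      x : Next r₁ r₂
      x = there (next-inject₁ i)
      B : Matrix (suc (suc n))
      B = replace r₁ (A r₂) (replace r₂ (A r₁) A)
      B-r₁ : ∀ j → B r₁ j ≈ A r₂ j
      B-r₁ = rowEq (replace-at r₁ (A r₂) _)
      B-r₂ : ∀ j → B r₂ j ≈ A r₁ j
      B-r₂ = rowEq (≡.trans (replace-off (A r₂) _ (next⇒≢ x ∘ ≡.sym)) (replace-at r₂ (A r₁) A))
      B-off : ∀ r → r ≢ r₁ → r ≢ r₂ → ∀ j → B r j ≈ A r j
      B-off r p q = rowEq (≡.trans (replace-off (A r₂) _ p) (replace-off (A r₁) A q))

  module _ {n} {D : Matrix (suc n) → Carrier} (alt : IsAlternating D) where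
    open IsAlternating alt

    addMultiples : Matrix (suc n) → (Fin n → Carrier) → Matrix (suc n)
    addMultiples A a zero    j = A zero j
    addMultiples A a (suc r) j = A (suc r) j + a r * A zero j

    -- The bound k limits the rows that are still modified. Linearity in the last of them, row
    -- `suc q`, splits off the multiple of row 0, and the extra matrix has row 0 twice. Once k
    -- reaches n the condition on `a` is vacuous and k can simply be lowered.
    addMultiples-invariant′ : ∀ k A a → (∀ r → k ≤ toℕ r → a r ≈ 0#) → D (addMultiples A a) ≈ D A
    addMultiples-invariant′ zero A a eq = cong λ where
      zero    j → refl
      (suc r) j → trans (+-congˡ (trans (*-congʳ (eq r z≤n)) (zeroˡ _))) (+-identityʳ _)
    addMultiples-invariant′ (suc k) A a eq with k <? n
    ... | no k≮n = addMultiples-invariant′ k A a λ r k≤r → ⊥-elim (k≮n (ℕ.≤-<-trans k≤r (toℕ<n r)))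
    ... | yes k<n = begin
      D (addMultiples A a) ≈⟨ linear (suc q) {addMultiples A a′} {B} {addMultiples A a} 1# (a q) offA offB at ⟩
      1# * D (addMultiples A a′) + a q * D B
        ≈⟨ +-cong (trans (*-identityˡ _) (addMultiples-invariant′ k A a′ small))
                  (trans (*-congˡ (vanishesOn-zero alt q B (λ j → sym (rowEq (replace-at (suc q) (A zero) _) j))))
                      (zeroʳ _)) ⟩
      D A + 0# ≈⟨ +-identityʳ _ ⟩
      D A ∎
      where
      q : Fin n
      q = fromℕ< k<n
      a′ : Fin n → Carrier
      a′ r with r ≟ q
      ... | yes _ = 0#
      ... | no  _ = a r
      B : Matrix (suc n)
      B = replace (suc q) (A zero) (addMultiples A a)
      small : ∀ r → k ≤ toℕ r → a′ r ≈ 0#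
      small r k≤r with r ≟ q
      ... | yes _   = refl
      ... | no  r≢q = eq r (ℕ.≤∧≢⇒< k≤r λ k≡r → r≢q (toℕ-injective (≡.trans (≡.sym k≡r) (≡.sym (toℕ-fromℕ< k<n)))))
      offA : ∀ r → r ≢ suc q → ∀ j → addMultiples A a r j ≈ addMultiples A a′ r j
      offA zero    r≢ j = refl
      offA (suc r) r≢ j with r ≟ q
      ... | yes ≡.refl = ⊥-elim (r≢ ≡.refl)
      ... | no  _      = refl
      offB : ∀ r → r ≢ suc q → ∀ j → addMultiples A a r j ≈ B r j
      offB r r≢ = rowEq (≡.sym (replace-off (A zero) (addMultiples A a) r≢))
      a′-q : a′ q ≈ 0#
      a′-q with q ≟ q
      ... | yes _ = refl
      ... | no ¬e = ⊥-elim (¬e ≡.refl)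
      at : ∀ j → addMultiples A a (suc q) j ≈ 1# * addMultiples A a′ (suc q) j + a q * B (suc q) j
      at j = sym (+-cong
        (trans (*-identityˡ _) (trans (+-congˡ (trans (*-congʳ a′-q) (zeroˡ _))) (+-identityʳ _)))
        (*-congˡ (rowEq (replace-at (suc q) (A zero) _) j)))

    addMultiples-invariant : ∀ A a → D (addMultiples A a) ≈ D A
    addMultiples-invariant A a = addMultiples-invariant′ n A a λ r n≤r →
      ⊥-elim (ℕ.<-irrefl ≡.refl (ℕ.<-≤-trans (toℕ<n r) n≤r))

    -- The matrix that remains after row 0 is a standard basis vector and column j has been cleared
    -- below it. As a function of the block B, the form on it is again alternating, one size
    -- smaller.
    border : Fin (suc n) → Matrix n → Matrix (suc n)
    border j B zero    = δ j
    border j B (suc r) = insertAt (B r) j 0#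

    insertAt-elim : ∀ {p} (P : Fin (suc n) → Carrier → Set p) (v : Fin n → Carrier) j →
      P j 0# → (∀ c → P (punchIn j c) (v c)) → ∀ c → P c (insertAt v j 0# c)
    insertAt-elim P v j at off c with punchIn-view j c
    ... | inj₁ ≡.refl        = ≡.subst (P j) (≡.sym (insertAt-lookup v j 0#)) at
    ... | inj₂ (c′ , ≡.refl) = ≡.subst (P (punchIn j c′)) (≡.sym (insertAt-punchIn v j 0# c′)) (off c′)

    insertAt-cong : ∀ {u v : Fin n → Carrier} j → (∀ c → u c ≈ v c) → ∀ c → insertAt u j 0# c ≈ insertAt v j 0# c
    insertAt-cong {u} {v} j eq = insertAt-elim (λ c x → x ≈ insertAt v j 0# c) u j
      (reflexive (≡.sym (insertAt-lookup v j 0#)))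
      (λ c → trans (eq c) (reflexive (≡.sym (insertAt-punchIn v j 0# c))))

    border-isAlternating : ∀ j → IsAlternating (λ B → D (border j B))
    border-isAlternating j = record
      { cong = λ eq → cong λ where
          zero    c → refl
          (suc r) c → insertAt-cong j (eq r) c
      ; linear = λ i {A} {B} {C} a b eqA eqB eqC → linear (suc i) {border j A} {border j B} {border j C} a b
          (off {A} {C} eqA) (off {B} {C} eqB)
          (insertAt-elim (λ c x → x ≈ a * insertAt (A i) j 0# c + b * insertAt (B i) j 0# c) (C i) j
            (sym (trans (+-cong (trans (*-congˡ (reflexive (insertAt-lookup (A i) j 0#))) (zeroʳ a))
                                (trans (*-congˡ (reflexive (insertAt-lookup (B i) j 0#))) (zeroʳ b)))
                        (+-identityʳ 0#)))
            (λ c → trans (eqC c) (sym (+-cong (*-congˡ (reflexive (insertAt-punchIn (A i) j 0# c)))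
                                              (*-congˡ (reflexive (insertAt-punchIn (B i) j 0# c)))))))
      ; alternating = λ x eq → alternating (there x) (insertAt-cong j eq)
      }
      where
      off : ∀ {A C : Matrix n} {i} → (∀ k → k ≢ i → ∀ c → C k c ≈ A k c) →
        ∀ k → k ≢ suc i → ∀ c → border j C k c ≈ border j A k c
      off eq zero    k≢ c = refl
      off eq (suc k) k≢ c = insertAt-cong j (eq k (k≢ ∘ ≡.cong suc)) c

    δ-punchIn : ∀ j (r c : Fin n) → δ (punchIn j r) (punchIn j c) ≡ δ r c
    δ-punchIn j r c with r ≟ c
    ... | yes ≡.refl = δ-refl (punchIn j r)
    ... | no  r≢c    = δ-≢ (r≢c ∘ punchIn-injective j r c)

    border-δ-suc : ∀ j r c → border j δ (suc r) c ≈ δ (punchIn j r) c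
    border-δ-suc j r = insertAt-elim (λ c x → x ≈ δ (punchIn j r) c) (δ r) j
      (reflexive (≡.sym (δ-≢ (punchInᵢ≢i j r))))
      (λ c → reflexive (≡.sym (δ-punchIn j r c)))

    -- `border j δ` is the permutation matrix with rows e_j followed by the other basis vectors in
    -- order. Raising j by one exchanges row 0 with a single later row, hence one sign per step.
    border-δ : ∀ j → D (border j δ) ≈ sign (toℕ j) * D δ
    border-δ = <-weakInduction (λ j → D (border j δ) ≈ sign (toℕ j) * D δ)
      (trans (cong λ where
        zero    c → refl
        (suc r) c → border-δ-suc zero r c) (sym (*-identityˡ _)))
      step
      where
      step : ∀ i → D (border (inject₁ i) δ) ≈ sign (toℕ (inject₁ i)) * D δ →
        D (border (suc i) δ) ≈ sign (suc (toℕ i)) * D δ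
      step i ih = begin
        D (border (suc i) δ)               ≈⟨ swap alt 0≢1+n (vanishesOn-zero alt i) (border (inject₁ i) δ)
            (border (suc i) δ) eq₀ eqᵢ eq ⟩
        - D (border (inject₁ i) δ)         ≈⟨ -‿cong ih ⟩
        - (sign (toℕ (inject₁ i)) * D δ)   ≈⟨ -‿distribˡ-* _ _ ⟩
        - sign (toℕ (inject₁ i)) * D δ     ≈⟨ *-congʳ (-‿cong (reflexive (≡.cong sign (toℕ-inject₁ i)))) ⟩
        sign (suc (toℕ i)) * D δ           ∎
        where
        x : Next (inject₁ i) (suc i)
        x = next-inject₁ i
        punchIn-inject₁ : punchIn (inject₁ i) i ≡ suc i × punchIn (suc i) i ≡ inject₁ i
        punchIn-inject₁ with punchIn-next-agree x i
        ... | inj₂ e = e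
        ... | inj₁ e = ⊥-elim (different i e)
          where
          different : ∀ {m} (i : Fin m) → punchIn (inject₁ i) i ≢ punchIn (suc i) i
          different zero ()
          different (suc i) e = different i (suc-injective e)
        eq₀ : ∀ c → border (suc i) δ zero c ≈ border (inject₁ i) δ (suc i) c
        eq₀ c = sym (trans (border-δ-suc (inject₁ i) i c) (reflexive (≡.cong (λ z → δ z c) (proj₁ punchIn-inject₁))))
        eqᵢ : ∀ c → border (suc i) δ (suc i) c ≈ border (inject₁ i) δ zero c
        eqᵢ c = trans (border-δ-suc (suc i) i c) (reflexive (≡.cong (λ z → δ z c) (proj₂ punchIn-inject₁)))
        eq : ∀ r → r ≢ zero → r ≢ suc i → ∀ c → border (suc i) δ r c ≈ border (inject₁ i) δ r c
        eq zero    r≢0 _  c = ⊥-elim (r≢0 ≡.refl)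
        eq (suc r) _   r≢ c with punchIn-next-agree x r
        ... | inj₁ e = trans (border-δ-suc (suc i) r c)
                         (trans (reflexive (≡.cong (λ z → δ z c) (≡.sym e))) (sym (border-δ-suc (inject₁ i) r c)))
        ... | inj₂ (e , _) = ⊥-elim (r≢ (≡.cong suc
                (punchIn-injective (inject₁ i) r i (≡.trans e (≡.sym (proj₁ punchIn-inject₁))))))

  -- Uniqueness of alternating forms up to their value at the identity. Row 0 is expanded in the
  -- standard basis; for each basis vector, column j is cleared by adding multiples of row 0, and
  -- induction applies to the bordered minor. The sign in the Laplace expansion comes from
  -- `border-δ`.
  alternating⇒determinant : ∀ n {D : Matrix n → Carrier} → IsAlternating D → ∀ A → D A ≈ determinant n A * D δ
  alternating⇒determinant zero    alt A = trans (IsAlternating.cong alt (λ ())) (sym (*-identityˡ _))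
  alternating⇒determinant (suc n) {D} alt A = begin
    D A ≈⟨ IsAlternating.cong alt row₀ ⟩
    D (replace zero (A zero) A) ≈⟨ expand-row alt zero A (A zero) δ (A zero) expand ⟩
    sum (λ j → A zero j * D (replace zero (δ j) A)) ≈⟨ sum-cong-≋ (λ j → *-congˡ {x = A zero j} (clear j)) ⟩
    sum (λ j → A zero j * (determinant n (minor A j) * (sign (toℕ j) * D δ)))
        ≈⟨ sum-cong-≋ (λ j → shuffle (A zero j) (determinant n (minor A j)) (sign (toℕ j)) (D δ)) ⟩
    sum (λ j → sign (toℕ j) * A zero j * determinant n (minor A j) * D δ)
        ≈⟨ *-distribʳ-sum (D δ) (λ j → sign (toℕ j) * A zero j * determinant n (minor A j)) ⟨
    determinant (suc n) A * D δ ∎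
    where
    row₀ : ∀ i j → A i j ≈ replace zero (A zero) A i j
    row₀ zero    j = refl
    row₀ (suc i) j = refl
    expand : ∀ c → A zero c ≈ sum (λ j → A zero j * δ j c)
    expand c = sym (trans
      (sum-select (λ j → A zero j * δ j c) c (λ k k≢ → trans (*-congˡ (reflexive (δ-≢ k≢))) (zeroʳ _)))
      (trans (*-congˡ (reflexive (δ-refl c))) (*-identityʳ _)))
    shuffle : ∀ a m s d → a * (m * (s * d)) ≈ s * a * m * d
    shuffle a m s d = begin
      a * (m * (s * d)) ≈⟨ *-congˡ (*-assoc m s d) ⟨
      a * (m * s * d)   ≈⟨ *-assoc a _ d ⟨
      a * (m * s) * d   ≈⟨ *-congʳ (*-congˡ (*-comm m s)) ⟩
      a * (s * m) * d   ≈⟨ *-congʳ (*-assoc a s m) ⟨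
      a * s * m * d     ≈⟨ *-congʳ (*-congʳ (*-comm a s)) ⟩
      s * a * m * d     ∎
    clear : ∀ j → D (replace zero (δ j) A) ≈ determinant n (minor A j) * (sign (toℕ j) * D δ)
    clear j = begin
      D (replace zero (δ j) A) ≈⟨ IsAlternating.cong alt agree ⟩
      D (addMultiples alt (border alt j (minor A j)) (λ r → A (suc r) j)) ≈⟨ addMultiples-invariant alt _ _ ⟩
      D (border alt j (minor A j)) ≈⟨ alternating⇒determinant n (border-isAlternating alt j) (minor A j) ⟩
      determinant n (minor A j) * D (border alt j δ) ≈⟨ *-congˡ (border-δ alt j) ⟩
      determinant n (minor A j) * (sign (toℕ j) * D δ) ∎
      where
      agree : ∀ r c → replace zero (δ j) A r c ≈ addMultiples alt (border alt j (minor A j)) (λ r → A (suc r) j) r c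
      agree zero    c = refl
      agree (suc r) = insertAt-elim alt (λ c x → A (suc r) c ≈ x + A (suc r) j * δ j c) (minor A j r) j
        (sym (trans (+-identityˡ _) (trans (*-congˡ (reflexive (δ-refl j))) (*-identityʳ _))))
        (λ c → sym (trans (+-congˡ (trans (*-congˡ (reflexive (δ-≢ (λ e → punchInᵢ≢i j c (≡.sym e))))) (zeroʳ _)))
            (+-identityʳ _)))

  -- Matrix products and special determinants

  infixl 7 _·_
  _·_ : ∀ {n} → Matrix n → Matrix n → Matrix n
  (A · B) i j = sum (λ k → A i k * B k j)

  ·-isAlternating : ∀ {n} {D : Matrix n → Carrier} (B : Matrix n) → IsAlternating D → IsAlternating (λ A → D (A · B))
  ·-isAlternating {n} {D} B alt = record
    { cong = λ eq → cong (λ i j → sum-cong-≋ λ k → *-congʳ (eq i k))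
    ; linear = λ i {X} {Y} {Z} a b eqX eqY eqZ → linear i {X · B} {Y · B} {Z · B} a b
        (λ k k≢ j → sum-cong-≋ λ m → *-congʳ (eqX k k≢ m))
        (λ k k≢ j → sum-cong-≋ λ m → *-congʳ (eqY k k≢ m))
        (λ j → begin
          sum (λ m → Z i m * B m j) ≈⟨ sum-cong-≋ (λ m → trans (*-congʳ (eqZ m))
              (trans (distribʳ _ _ _) (+-cong (*-assoc a (X i m) (B m j)) (*-assoc b (Y i m) (B m j))))) ⟩
          sum (λ m → a * (X i m * B m j) + b * (Y i m * B m j))
            ≈⟨ ∑-distrib-+ (λ m → a * (X i m * B m j)) (λ m → b * (Y i m * B m j)) ⟩
          sum (λ m → a * (X i m * B m j)) + sum (λ m → b * (Y i m * B m j))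
            ≈⟨ +-cong (*-distribˡ-sum a (λ m → X i m * B m j)) (*-distribˡ-sum b (λ m → Y i m * B m j)) ⟨
          a * (X · B) i j + b * (Y · B) i j ∎)
    ; alternating = λ x eq → alternating x (λ j → sum-cong-≋ λ k → *-congʳ (eq k))
    }
    where open IsAlternating alt

  ∏ : ∀ {n} → (Fin n → Carrier) → Carrier
  ∏ {zero}  d = 1#
  ∏ {suc n} d = d zero * ∏ (d ∘ suc)

  determinant-diagonal : ∀ n (d : Fin n → Carrier) → determinant n (λ i j → d i * δ i j) ≈ ∏ d
  determinant-diagonal zero    d = refl
  determinant-diagonal (suc n) d = begin
    sum term ≈⟨ sum-select term zero vanish ⟩
    1# * (d zero * 1#) * determinant n (λ r c → d (suc r) * δ (suc r) (suc c))
      ≈⟨ *-cong (trans (*-identityˡ _) (*-identityʳ _)) (determinant-cong n λ r c → *-congˡ (reflexive (δ-suc r c))) ⟩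
    d zero * determinant n (λ r c → d (suc r) * δ r c) ≈⟨ *-congˡ (determinant-diagonal n (d ∘ suc)) ⟩
    d zero * ∏ (d ∘ suc) ∎
    where
    term : Fin (suc n) → Carrier
    term j = sign (toℕ j) * (d zero * δ zero j) * determinant n (minor (λ i j → d i * δ i j) j)
    vanish : ∀ k → k ≢ zero → term k ≈ 0#
    vanish k k≢0 = trans (*-congʳ (trans (*-congˡ (trans (*-congˡ (reflexive (δ-≢ (k≢0 ∘ ≡.sym)))) (zeroʳ _)))
        (zeroʳ _))) (zeroˡ _)
    δ-suc : ∀ {m} (r c : Fin m) → δ (suc r) (suc c) ≡ δ r c
    δ-suc r c with r ≟ c
    ... | yes _ = ≡.refl
    ... | no  _ = ≡.refl

  δ-transpose : ∀ {n} (i j : Fin n) → (δ ᵀ) i j ≡ δ i j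
  δ-transpose i j with i ≟ j
  ... | yes ≡.refl = δ-refl i
  ... | no  i≢j    = δ-≢ (i≢j ∘ ≡.sym)

  determinant-δ : ∀ n → determinant n δ ≈ 1#
  determinant-δ n = trans (determinant-cong n (λ i j → sym (*-identityˡ _)))
    (trans (determinant-diagonal n (λ _ → 1#)) (∏-1 n))
    where
    ∏-1 : ∀ n → ∏ {n} (λ _ → 1#) ≈ 1#
    ∏-1 zero    = refl
    ∏-1 (suc n) = trans (*-identityˡ _) (∏-1 n)

  determinant-transpose : ∀ n A → determinant n (A ᵀ) ≈ determinant n A
  determinant-transpose n A = begin
    determinant n (A ᵀ)                   ≈⟨ alternating⇒determinant n (transpose-isAlternating n) A ⟩
    determinant n A * determinant n (δ ᵀ) ≈⟨ *-congˡ
        (trans (determinant-cong n (λ i j → reflexive (δ-transpose i j))) (determinant-δ n)) ⟩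
    determinant n A * 1#                  ≈⟨ *-identityʳ _ ⟩
    determinant n A                       ∎

  -- Uniqueness is applied to the form sending A to the determinant of the transpose of A B. The
  -- transpose appears because linearity and alternation were verified for columns.
  determinant-· : ∀ n A B → determinant n (A · B) ≈ determinant n A * determinant n B
  determinant-· n A B = begin
    determinant n (A · B)                     ≈⟨ determinant-transpose n (A · B) ⟨
    determinant n ((A · B) ᵀ)
        ≈⟨ alternating⇒determinant n (·-isAlternating B (transpose-isAlternating n)) A ⟩
    determinant n A * determinant n ((δ · B) ᵀ) ≈⟨ *-congˡ (determinant-cong n λ i j → δ-·ˡ j i) ⟩
    determinant n A * determinant n (B ᵀ)     ≈⟨ *-congˡ (determinant-transpose n B) ⟩
    determinant n A * determinant n B         ∎
    where
    δ-·ˡ : ∀ i j → (δ · B) i j ≈ B i j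
    δ-·ˡ i j = trans
      (sum-select (λ k → δ i k * B k j) i (λ k k≢ → trans (*-congʳ (reflexive (δ-≢ (k≢ ∘ ≡.sym)))) (zeroˡ _)))
      (trans (*-congʳ (reflexive (δ-refl i))) (*-identityˡ _))

-- Frobenius congruences and integers without small prime factors

prime∣!⇒≤ : ∀ {r} → Prime r → ∀ k → r ∣ k ! → r ≤ k
prime∣!⇒≤ isPrime zero    r∣1 = ⊥-elim (¬prime[1] (≡.subst Prime (∣1⇒≡1 r∣1) isPrime))
prime∣!⇒≤ isPrime (suc k) r∣k! with euclidsLemma (suc k) (k !) isPrime r∣k!
... | inj₁ r∣1+k = ∣⇒≤ r∣1+k
... | inj₂ r∣k!  = ℕ.m≤n⇒m≤1+n (prime∣!⇒≤ isPrime k r∣k!)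

-- r divides r!, the product of the binomial coefficient with k! and (r - k)!, and divides neither
-- of these factorials, as k and r - k lie below r.
prime∣choose : ∀ {r} → Prime r → ∀ k → 0 < k → k < r → r ∣ r choose k
prime∣choose {suc r} isPrime k 0<k k<r with euclidsLemma (suc r choose k) (k ! ℕ.* (suc r ∸ k) !) isPrime r∣
  where
  instance
    _ = k ℕ.!* (suc r ∸ k) !≢0
  k≤r = ℕ.<⇒≤ k<r
  r∣ : suc r ∣ (suc r choose k) ℕ.* (k ! ℕ.* (suc r ∸ k) !)
  r∣ = ≡.subst (suc r ∣_)
    (≡.sym (≡.trans (≡.cong (ℕ._* (k ! ℕ.* (suc r ∸ k) !)) (nCk≡n!/k![n-k]! k≤r)) (m/n*n≡m (k![n∸k]!∣n! k≤r))))
    (m∣m*n (r !))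
... | inj₁ r∣choose = r∣choose
... | inj₂ r∣  with euclidsLemma (k !) ((suc r ∸ k) !) isPrime r∣
...   | inj₁ r∣k!    = ⊥-elim (ℕ.<⇒≱ k<r (prime∣!⇒≤ isPrime k r∣k!))
...   | inj₂ r∣r∸k!  = ⊥-elim (ℕ.<⇒≱ (ℕ.∸-monoʳ-< 0<k (ℕ.<⇒≤ k<r)) (prime∣!⇒≤ isPrime _ r∣r∸k!))

module Frobenius {c ℓ} (R : CommutativeRing c ℓ) {r : ℕ} (isPrime : Prime r) where
  open CommutativeRing R hiding (zero)
  open SemiringSum semiring using (sum; sum-init-last; sum-cong-≋)
  open SemiringMult semiring using (×-congʳ; ×-congˡ; ×-assocˡ; ×-homo-1) renaming (_×_ to _⋅_)
  open CommutativeMonoidMult +-commutativeMonoid using (×-distrib-+)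
  open SemiringExp semiring using (_^_; ^-congˡ)
  open RingProperties ring using (+-inverseʳ-unique; -‿+-comm)
  open SetoidReasoning setoid

  -- The congruence of x^r and x′ modulo r, with its quotient as explicit witness, so that no
  -- quotient ring has to be formed.
  FrobeniusImage : Carrier → Carrier → Set _
  FrobeniusImage x x′ = ∃ λ q → x ^ r ≈ x′ + r ⋅ q

  ⋅-zero : ∀ n → n ⋅ 0# ≈ 0#
  ⋅-zero zero    = refl
  ⋅-zero (suc n) = trans (+-identityˡ _) (⋅-zero n)

  ⋅-sum : ∀ {n} (q : Fin n → Carrier) → sum (λ k → r ⋅ q k) ≈ r ⋅ sum q
  ⋅-sum {zero}  q = sym (⋅-zero r)
  ⋅-sum {suc n} q = trans (+-congˡ (⋅-sum (q ∘ suc))) (sym (×-distrib-+ (q zero) _ r))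

  ∣⇒⋅ : ∀ {m} x → r ∣ m → ∃ λ q → m ⋅ x ≈ r ⋅ q
  ∣⇒⋅ {m} x (divides k m≡kr) = k ⋅ x , trans (×-congˡ (≡.trans m≡kr (ℕ.*-comm k r))) (sym (×-assocˡ x r k))

  freshman : ∀ x y → ∃ λ q → (x + y) ^ r ≈ x ^ r + y ^ r + r ⋅ q
  freshman x y = expand r ≡.refl
    where
    open BinomialTheorem commutativeSemiring using (theorem; binomialTerm)
    -- The exponent is generalised to m so that it can be split as a successor, while the modulus r
    -- stays fixed.
    expand : ∀ m → r ≡ m → ∃ λ q → (x + y) ^ m ≈ x ^ m + y ^ m + r ⋅ q
    expand zero    r≡0 = ⊥-elim (¬prime[0] (≡.subst Prime r≡0 isPrime))
    expand (suc m) r≡1+m = sum (proj₁ ∘ middle) , (begin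
      (x + y) ^ suc m                                  ≈⟨ theorem (suc m) x y ⟩
      term zero + sum (term ∘ suc)                     ≈⟨ +-congˡ (sum-init-last (term ∘ suc)) ⟩
      term zero + (sum (term ∘ suc ∘ inject₁) + term (suc (fromℕ m)))
        ≈⟨ +-cong first (+-cong (trans (sum-cong-≋ (proj₂ ∘ middle)) (⋅-sum (proj₁ ∘ middle))) last′) ⟩
      y ^ suc m + (r ⋅ sum (proj₁ ∘ middle) + x ^ suc m) ≈⟨ +-congˡ (+-comm _ _) ⟩
      y ^ suc m + (x ^ suc m + r ⋅ sum (proj₁ ∘ middle)) ≈⟨ +-assoc _ _ _ ⟨
      y ^ suc m + x ^ suc m + r ⋅ sum (proj₁ ∘ middle)   ≈⟨ +-congʳ (+-comm _ _) ⟩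
      x ^ suc m + y ^ suc m + r ⋅ sum (proj₁ ∘ middle)   ∎)
      where
      term : Fin (suc (suc m)) → Carrier
      term = binomialTerm x y (suc m)
      middle : ∀ (k : Fin m) → ∃ λ q → term (suc (inject₁ k)) ≈ r ⋅ q
      middle k = ∣⇒⋅ _ (≡.subst (_∣ (suc m choose suc (toℕ (inject₁ k)))) (≡.sym r≡1+m)
        (prime∣choose (≡.subst Prime r≡1+m isPrime) _ (s≤s z≤n)
            (s≤s (≡.subst (_< m) (≡.sym (toℕ-inject₁ k)) (toℕ<n k)))))
      first : term zero ≈ y ^ suc m
      first = trans (×-homo-1 _) (*-identityˡ _)
      last′ : term (suc (fromℕ m)) ≈ x ^ suc m
      last′ = begin
        term (suc (fromℕ m)) ≡⟨ ≡.cong (λ k → (suc m choose suc k) ⋅ (x ^ suc k * y ^ (m ∸ k))) (toℕ-fromℕ m) ⟩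
        (suc m choose suc m) ⋅ (x ^ suc m * y ^ (m ∸ m))
            ≡⟨ ≡.cong₂ (λ a b → a ⋅ (x ^ suc m * y ^ b)) (nCn≡1 (suc m)) (ℕ.n∸n≡0 m) ⟩
        1 ⋅ (x ^ suc m * 1#) ≈⟨ trans (×-homo-1 _) (*-identityʳ _) ⟩
        x ^ suc m ∎

  frobenius-≈ : ∀ {x y x′ y′} → x ≈ y → x′ ≈ y′ → FrobeniusImage x x′ → FrobeniusImage y y′
  frobenius-≈ eq eq′ (q , f) = q , trans (sym (^-congˡ r eq)) (trans f (+-congʳ eq′))

  frobenius-+ : ∀ {x y x′ y′} → FrobeniusImage x x′ → FrobeniusImage y y′ → FrobeniusImage (x + y) (x′ + y′)
  frobenius-+ {x} {y} {x′} {y′} (q , f) (q′ , f′) with freshman x y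
  ... | q″ , f″ = q + q′ + q″ , (begin
    (x + y) ^ r ≈⟨ f″ ⟩
    x ^ r + y ^ r + r ⋅ q″ ≈⟨ +-congʳ (+-cong f f′) ⟩
    x′ + r ⋅ q + (y′ + r ⋅ q′) + r ⋅ q″ ≈⟨ +-congʳ (interchange x′ (r ⋅ q) y′ (r ⋅ q′)) ⟩
    x′ + y′ + (r ⋅ q + r ⋅ q′) + r ⋅ q″ ≈⟨ +-assoc _ _ _ ⟩
    x′ + y′ + (r ⋅ q + r ⋅ q′ + r ⋅ q″) ≈⟨ +-congˡ (trans (×-distrib-+ _ _ r) (+-congʳ (×-distrib-+ _ _ r))) ⟨
    x′ + y′ + r ⋅ (q + q′ + q″) ∎)
    where open CommutativeSemigroupProperties +-commutativeSemigroup using (interchange)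

  frobenius-0 : FrobeniusImage 0# 0#
  frobenius-0 = 0# , go r ≡.refl
    where
    go : ∀ m → r ≡ m → 0# ^ m ≈ 0# + r ⋅ 0#
    go zero    r≡0 = ⊥-elim (¬prime[0] (≡.subst Prime r≡0 isPrime))
    go (suc m) _   = trans (zeroˡ _) (sym (trans (+-identityˡ _) (⋅-zero r)))

  -- Expanding (x + (-x))^r = 0 yields the sign without distinguishing r = 2 from odd r.
  frobenius-neg : ∀ {x x′} → FrobeniusImage x x′ → FrobeniusImage (- x) (- x′)
  frobenius-neg {x} {x′} (q , f) with freshman x (- x)
  ... | q′ , f′ = - (q + q′) , (begin
    (- x) ^ r                      ≈⟨ +-inverseʳ-unique _ _ cancel ⟩
    - (x′ + r ⋅ (q + q′))          ≈⟨ -‿+-comm x′ _ ⟨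
    - x′ + - (r ⋅ (q + q′))        ≈⟨ +-congˡ (⋅-neg (q + q′)) ⟨
    - x′ + r ⋅ (- (q + q′))        ∎)
    where
    ⋅-neg : ∀ y → r ⋅ (- y) ≈ - (r ⋅ y)
    ⋅-neg y = +-inverseʳ-unique _ _ (trans (sym (×-distrib-+ y (- y) r))
        (trans (×-congʳ r (-‿inverseʳ y)) (⋅-zero r)))
    cancel : x′ + r ⋅ (q + q′) + (- x) ^ r ≈ 0#
    cancel = begin
      x′ + r ⋅ (q + q′) + (- x) ^ r       ≈⟨ +-congʳ (+-congˡ (×-distrib-+ q q′ r)) ⟩
      x′ + (r ⋅ q + r ⋅ q′) + (- x) ^ r   ≈⟨ +-congʳ (+-assoc _ _ _) ⟨
      x′ + r ⋅ q + r ⋅ q′ + (- x) ^ r     ≈⟨ +-congʳ (+-congʳ f) ⟨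
      x ^ r + r ⋅ q′ + (- x) ^ r          ≈⟨ +-assoc _ _ _ ⟩
      x ^ r + (r ⋅ q′ + (- x) ^ r)        ≈⟨ +-congˡ (+-comm _ _) ⟩
      x ^ r + ((- x) ^ r + r ⋅ q′)        ≈⟨ +-assoc _ _ _ ⟨
      x ^ r + (- x) ^ r + r ⋅ q′          ≈⟨ f′ ⟨
      (x + - x) ^ r                       ≈⟨ ^-congˡ r (-‿inverseʳ x) ⟩
      0# ^ r                              ≈⟨ proj₂ frobenius-0 ⟩
      0# + r ⋅ 0#                         ≈⟨ trans (+-identityˡ _) (⋅-zero r) ⟩
      0#                                  ∎

-- t is the product of the k ≤ B coprime to c: a prime r ≤ B dividing c does not divide N t,
-- and a prime r ≤ B not dividing c divides N t, so r never divides c + N t.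
module _ (c : ℕ) where
  coprimePart : ℕ → ℕ
  coprimePart zero    = 1
  coprimePart (suc k) with coprime? (suc k) c
  ... | yes _ = suc k ℕ.* coprimePart k
  ... | no  _ = coprimePart k

  ∣coprimePart⇒∤ : ∀ {r} → Prime r → ∀ B → r ∣ coprimePart B → ¬ r ∣ c
  ∣coprimePart⇒∤ isPrime zero    r∣1 r∣c = ¬prime[1] (≡.subst Prime (∣1⇒≡1 r∣1) isPrime)
  ∣coprimePart⇒∤ isPrime (suc k) r∣t r∣c with coprime? (suc k) c
  ... | no  _ = ∣coprimePart⇒∤ isPrime k r∣t r∣c
  ... | yes coprime with euclidsLemma (suc k) (coprimePart k) isPrime r∣t
  ...   | inj₁ r∣1+k = ¬prime[1] (≡.subst Prime (coprime (r∣1+k , r∣c)) isPrime)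
  ...   | inj₂ r∣t′  = ∣coprimePart⇒∤ isPrime k r∣t′ r∣c

  ∤⇒∣coprimePart : ∀ {r} → Prime r → ¬ r ∣ c → ∀ B → r ≤ B → r ∣ coprimePart B
  ∤⇒∣coprimePart isPrime r∤c zero    z≤n = ⊥-elim (¬prime[0] isPrime)
  ∤⇒∣coprimePart {r} isPrime r∤c (suc k) r≤1+k with ℕ.m≤n⇒m<n∨m≡n r≤1+k | coprime? (suc k) c
  ... | inj₁ (s≤s r≤k) | yes _ = ∣n⇒∣m*n (suc k) (∤⇒∣coprimePart isPrime r∤c k r≤k)
  ... | inj₁ (s≤s r≤k) | no  _ = ∤⇒∣coprimePart isPrime r∤c k r≤k
  ... | inj₂ ≡.refl    | yes _ = m∣m*n (coprimePart k)
  ... | inj₂ ≡.refl    | no ¬coprime = ⊥-elim (¬coprime coprime)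
    where
    coprime : Coprime r c
    coprime (d∣r , d∣c) with prime⇒irreducible isPrime d∣r
    ... | inj₁ d≡1    = d≡1
    ... | inj₂ ≡.refl = ⊥-elim (r∤c d∣c)

  roughTranslate : ∀ N → (∀ {r} → Prime r → r ∣ c → ¬ r ∣ N) → ∀ B {r} →
    Prime r → r ∣ c ℕ.+ N ℕ.* coprimePart B → B < r
  roughTranslate N coprime B {r} isPrime r∣m with r ℕ.≤? B | r ∣? c
  ... | no r≰B | _ = ℕ.≰⇒> r≰B
  ... | yes r≤B | no r∤c = ⊥-elim (r∤c (∣m+n∣m⇒∣n (≡.subst (r ∣_) (ℕ.+-comm c _) r∣m)
      (∣n⇒∣m*n N (∤⇒∣coprimePart isPrime r∤c B r≤B))))
  ... | yes r≤B | yes r∣c with euclidsLemma N (coprimePart B) isPrime (∣m+n∣m⇒∣n r∣m r∣c)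
  ...   | inj₁ r∣N = ⊥-elim (coprime isPrime r∣c r∣N)
  ...   | inj₂ r∣t = ⊥-elim (∣coprimePart⇒∤ isPrime B r∣t r∣c)

prime∣prime⇒≡ : ∀ {r p} → Prime r → Prime p → r ∣ p → r ≡ p
prime∣prime⇒≡ r-prime p-prime r∣p with prime⇒irreducible p-prime r∣p
... | inj₁ r≡1 = ⊥-elim (¬prime[1] (≡.subst Prime r≡1 r-prime))
... | inj₂ r≡p = r≡p

-- Representatives of residue classes modulo p and ℓ

module _ {p ℓ : ℕ} .{{_ : NonZero p}} .{{_ : NonZero ℓ}} (p-prime : Prime p) (ℓ-prime : Prime ℓ) (ℓ≢p : ℓ ≢ p) where
  private
    module P = Residues p
    module L = Residues ℓ

  chineseRemainder : ∀ (x : Fin p) (y : Fin ℓ) → ∃ λ c → c mod p ≡ x × c mod ℓ ≡ y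
  chineseRemainder x y with P.inverse p-prime (ℓ mod p) ℓ≢0 | L.inverse ℓ-prime (p mod ℓ) p≢0
    where
    ℓ≢0 : ℓ mod p ≢ zeroM p
    ℓ≢0 eq = ℓ≢p (≡.sym (prime∣prime⇒≡ p-prime ℓ-prime (P.mod≡0⇒∣ ℓ eq)))
    p≢0 : p mod ℓ ≢ zeroM ℓ
    p≢0 eq = ℓ≢p (prime∣prime⇒≡ ℓ-prime p-prime (L.mod≡0⇒∣ p eq))
  ... | u , ℓu≡1 | v , pv≡1 = a ℕ.+ b
    , ≡.trans (≡.sym (P.addM-mod a b)) (≡.trans (≡.cong₂ (addM p) a≡x (P.∣⇒mod≡0 b (n∣m*n (toℕ (mulM ℓ y v)))))
        (CommutativeRing.+-identityʳ P.commutativeRing x))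
    , ≡.trans (≡.sym (L.addM-mod a b)) (≡.trans (≡.cong₂ (addM ℓ) (L.∣⇒mod≡0 a (n∣m*n (toℕ (mulM p x u)))) b≡y)
        (L.+-identityˡ y))
    where
    -- u inverts ℓ modulo p and v inverts p modulo ℓ, so a is x modulo p and 0 modulo ℓ, and b is 0
    -- modulo p and y modulo ℓ.
    a = toℕ (mulM p x u) ℕ.* ℓ
    b = toℕ (mulM ℓ y v) ℕ.* p
    a≡x : a mod p ≡ x
    a≡x = begin
      a mod p                          ≡⟨ P.mulM-mod (toℕ (x P.* u)) ℓ ⟨
      (toℕ (x P.* u) mod p) P.* (ℓ mod p) ≡⟨ ≡.cong (P._* (ℓ mod p)) (P.mod-toℕ (x P.* u)) ⟩
      x P.* u P.* (ℓ mod p)            ≡⟨ P.*-assoc x u _ ⟩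
      x P.* (u P.* (ℓ mod p))          ≡⟨ ≡.cong (x P.*_) (≡.trans (P.*-comm u _) ℓu≡1) ⟩
      x P.* oneM p                     ≡⟨ CommutativeRing.*-identityʳ P.commutativeRing x ⟩
      x                                ∎
      where open ≡.≡-Reasoning
    b≡y : b mod ℓ ≡ y
    b≡y = begin
      b mod ℓ                          ≡⟨ L.mulM-mod (toℕ (y L.* v)) p ⟨
      (toℕ (y L.* v) mod ℓ) L.* (p mod ℓ) ≡⟨ ≡.cong (L._* (p mod ℓ)) (L.mod-toℕ (y L.* v)) ⟩
      y L.* v L.* (p mod ℓ)            ≡⟨ L.*-assoc y v _ ⟩
      y L.* (v L.* (p mod ℓ))          ≡⟨ ≡.cong (y L.*_) (≡.trans (L.*-comm v _) pv≡1) ⟩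
      y L.* oneM ℓ                     ≡⟨ CommutativeRing.*-identityʳ L.commutativeRing y ⟩
      y                                ∎
      where open ≡.≡-Reasoning

  -- An elementary substitute for primes in arithmetic progressions. Adding a multiple of p ℓ to the
  -- solution c of the two congruences keeps both classes, and c shares no prime with p ℓ because x
  -- and y are nonzero; so the multiple can be chosen to avoid all primes up to B.
  roughRepresentative : ∀ x y → x ≢ zeroM p → y ≢ zeroM ℓ → ∀ B →
    ∃ λ m → m mod p ≡ x × m mod ℓ ≡ y × NonZero m × (∀ {r} → Prime r → r ∣ m → B < r)
  roughRepresentative x y x≢0 y≢0 B with chineseRemainder x y
  ... | c , c≡x , c≡y = m
    , ≡.trans (P.mod-cong (≡.trans (≡.cong (λ z → (c ℕ.+ z) % p) (regroup₁ p ℓ t)) ([m+kn]%n≡m%n c (ℓ ℕ.* t) p))) c≡x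
    , ≡.trans (L.mod-cong (≡.trans (≡.cong (λ z → (c ℕ.+ z) % ℓ) (regroup₂ p ℓ t)) ([m+kn]%n≡m%n c (p ℕ.* t) ℓ))) c≡y
    , nonZero
    , rough
    where
    t = coprimePart c B
    m = c ℕ.+ p ℕ.* ℓ ℕ.* t
    regroup₁ : ∀ p ℓ t → p ℕ.* ℓ ℕ.* t ≡ ℓ ℕ.* t ℕ.* p
    regroup₁ = solve-∀
    regroup₂ : ∀ p ℓ t → p ℕ.* ℓ ℕ.* t ≡ p ℕ.* t ℕ.* ℓ
    regroup₂ = solve-∀
    p∤c : ¬ p ∣ c
    p∤c p∣c = x≢0 (≡.trans (≡.sym c≡x) (P.∣⇒mod≡0 c p∣c))
    ℓ∤c : ¬ ℓ ∣ c
    ℓ∤c ℓ∣c = y≢0 (≡.trans (≡.sym c≡y) (L.∣⇒mod≡0 c ℓ∣c))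
    nonZero : NonZero m
    nonZero = ℕ.≢-nonZero λ m≡0 → p∤c (≡.subst (p ∣_) (≡.sym (ℕ.m+n≡0⇒m≡0 c m≡0)) (divides 0 ≡.refl))
    rough : ∀ {r} → Prime r → r ∣ m → B < r
    rough = roughTranslate c (p ℕ.* ℓ) coprime B
      where
      coprime : ∀ {r} → Prime r → r ∣ c → ¬ r ∣ p ℕ.* ℓ
      coprime r-prime r∣c r∣pℓ with euclidsLemma p ℓ r-prime r∣pℓ
      ... | inj₁ r∣p = p∤c (≡.subst (_∣ c) (prime∣prime⇒≡ r-prime p-prime r∣p) r∣c)
      ... | inj₂ r∣ℓ = ℓ∤c (≡.subst (_∣ c) (prime∣prime⇒≡ r-prime ℓ-prime r∣ℓ) r∣c)

-- Cyclotomic integers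

-- The ring ℤ[G] modulo the largest ideal contained in the kernel of the functional E.
module TraceRing {G : Set} (_∙_ : G → G → G) (ε : G)
  (∙-assoc : ∀ x y z → (x ∙ y) ∙ z ≡ x ∙ (y ∙ z))
  (∙-comm : ∀ x y → x ∙ y ≡ y ∙ x)
  (∙-identityˡ : ∀ x → ε ∙ x ≡ x)
  (E : G → ℤ) where

  Element : Set
  Element = List (ℤ × G)

  pairing : Element → (G → ℤ) → ℤ
  pairing []            φ = 0ℤ
  pairing ((c , h) ∷ z) φ = c ℤ.* φ h ℤ.+ pairing z φ

  -- The value of E on the translate of z by g. Elements are formal sums without normal form, and
  -- the values `κ z g` for all g are what determines them up to `_≈_`.
  κ : Element → G → ℤ
  κ z g = pairing z (λ h → E (g ∙ h))

  infix 4 _≈_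
  record _≈_ (z w : Element) : Set where
    constructor mk≈
    field
      κ-≡ : ∀ g → κ z g ≡ κ w g
  open _≈_ public

  monomial* : ℤ → G → Element → Element
  monomial* c h []            = []
  monomial* c h ((d , k) ∷ w) = (c ℤ.* d , h ∙ k) ∷ monomial* c h w

  infixl 7 _*_
  _*_ : Element → Element → Element
  []            * w = []
  ((c , h) ∷ z) * w = monomial* c h w ++ z * w

  infix 8 -_
  -_ : Element → Element
  - []            = []
  - ((c , h) ∷ z) = (ℤ.- c , h) ∷ - z

  ι : ℤ → Element
  ι c = (c , ε) ∷ []

  basis : G → Element
  basis g = (1ℤ , g) ∷ []

  pairing-cong : ∀ z {φ ψ} → (∀ h → φ h ≡ ψ h) → pairing z φ ≡ pairing z ψ
  pairing-cong []            eq = ≡.refl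
  pairing-cong ((c , h) ∷ z) eq = ≡.cong₂ (λ x y → c ℤ.* x ℤ.+ y) (eq h) (pairing-cong z eq)

  pairing-++ : ∀ z w φ → pairing (z ++ w) φ ≡ pairing z φ ℤ.+ pairing w φ
  pairing-++ []            w φ = ≡.sym (ℤ.+-identityˡ _)
  pairing-++ ((c , h) ∷ z) w φ = ≡.trans (≡.cong (ℤ._+_ (c ℤ.* φ h)) (pairing-++ z w φ))
      (≡.sym (ℤ.+-assoc (c ℤ.* φ h) _ _))

  pairing-neg : ∀ z φ → pairing (- z) φ ≡ ℤ.- pairing z φ
  pairing-neg []            φ = ≡.refl
  pairing-neg ((c , h) ∷ z) φ = ≡.trans (≡.cong (ℤ._+_ (ℤ.- c ℤ.* φ h)) (pairing-neg z φ))
    (solve 3 (λ c x y → :- c :* x :+ :- y := :- (c :* x :+ y)) ≡.refl c (φ h) (pairing z φ))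

  pairing-zero : ∀ z → pairing z (λ _ → 0ℤ) ≡ 0ℤ
  pairing-zero []            = ≡.refl
  pairing-zero ((c , h) ∷ z) = ≡.cong₂ ℤ._+_ (ℤ.*-zeroʳ c) (pairing-zero z)

  pairing-linear : ∀ z a φ ψ → pairing z (λ h → a ℤ.* φ h ℤ.+ ψ h) ≡ a ℤ.* pairing z φ ℤ.+ pairing z ψ
  pairing-linear []            a φ ψ = solve 1 (λ a → con 0ℤ := a :* con 0ℤ :+ con 0ℤ) ≡.refl a
  pairing-linear ((c , h) ∷ z) a φ ψ = ≡.trans (≡.cong (ℤ._+_ (c ℤ.* (a ℤ.* φ h ℤ.+ ψ h))) (pairing-linear z a φ ψ))
    (solve 6 (λ c a x y u v → c :* (a :* x :+ y) :+ (a :* u :+ v) := a :* (c :* x :+ u) :+ (c :* y :+ v)) ≡.refl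
      c a (φ h) (ψ h) (pairing z φ) (pairing z ψ))

  pairing-scale : ∀ z a φ → pairing z (λ h → a ℤ.* φ h) ≡ a ℤ.* pairing z φ
  pairing-scale z a φ = ≡.trans (pairing-cong z (λ h → ≡.sym (ℤ.+-identityʳ (a ℤ.* φ h))))
    (≡.trans (pairing-linear z a φ (λ _ → 0ℤ))
        (≡.trans (≡.cong (ℤ._+_ (a ℤ.* pairing z φ)) (pairing-zero z)) (ℤ.+-identityʳ _)))

  pairing-comm : ∀ z w (F : G → G → ℤ) →
    pairing z (λ h → pairing w (F h)) ≡ pairing w (λ k → pairing z (λ h → F h k))
  pairing-comm []            w F = ≡.sym (pairing-zero w)
  pairing-comm ((c , h) ∷ z) w F = ≡.trans (≡.cong (ℤ._+_ (c ℤ.* pairing w (F h))) (pairing-comm z w F))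
    (≡.sym (pairing-linear w c (F h) (λ k → pairing z (λ h → F h k))))

  pairing-monomial* : ∀ c h w φ → pairing (monomial* c h w) φ ≡ c ℤ.* pairing w (λ k → φ (h ∙ k))
  pairing-monomial* c h []            φ = ≡.sym (ℤ.*-zeroʳ c)
  pairing-monomial* c h ((d , k) ∷ w) φ = ≡.trans (≡.cong (ℤ._+_ (c ℤ.* d ℤ.* φ (h ∙ k))) (pairing-monomial* c h w φ))
    (solve 4 (λ c d x y → c :* d :* x :+ c :* y := c :* (d :* x :+ y)) ≡.refl c d (φ (h ∙ k))
        (pairing w (λ k → φ (h ∙ k))))

  pairing-* : ∀ z w φ → pairing (z * w) φ ≡ pairing z (λ h → pairing w (λ k → φ (h ∙ k)))
  pairing-* []            w φ = ≡.refl
  pairing-* ((c , h) ∷ z) w φ = ≡.trans (pairing-++ (monomial* c h w) (z * w) φ)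
    (≡.cong₂ ℤ._+_ (pairing-monomial* c h w φ) (pairing-* z w φ))

  κ-* : ∀ z w g → κ (z * w) g ≡ pairing z (λ h → κ w (g ∙ h))
  κ-* z w g = ≡.trans (pairing-* z w _)
    (pairing-cong z (λ h → pairing-cong w (λ k → ≡.cong E (≡.sym (∙-assoc g h k)))))

  κ-+ : ∀ z w g → κ (z ++ w) g ≡ κ z g ℤ.+ κ w g
  κ-+ z w g = pairing-++ z w _

  private
    -- The ring axioms already hold in ℤ[G], that is, under every functional φ; the particular
    -- functional E matters only for the congruence laws.
    from-pairing : ∀ {z w} → (∀ φ → pairing z φ ≡ pairing w φ) → z ≈ w
    from-pairing eq = mk≈ λ g → eq _

    *-comm : ∀ z w → z * w ≈ w * z
    *-comm z w = from-pairing λ φ → ≡.trans (pairing-* z w φ) (≡.trans (pairing-comm z w _)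
      (≡.trans (pairing-cong w (λ k → pairing-cong z (λ h → ≡.cong φ (∙-comm h k)))) (≡.sym (pairing-* w z φ))))

    *-assoc : ∀ x y z → (x * y) * z ≈ x * (y * z)
    *-assoc x y z = from-pairing λ φ → begin
      pairing ((x * y) * z) φ ≡⟨ pairing-* (x * y) z φ ⟩
      pairing (x * y) (λ h → pairing z (λ k → φ (h ∙ k))) ≡⟨ pairing-* x y _ ⟩
      pairing x (λ g → pairing y (λ h → pairing z (λ k → φ ((g ∙ h) ∙ k))))
        ≡⟨ pairing-cong x (λ g → pairing-cong y (λ h → pairing-cong z (λ k → ≡.cong φ (∙-assoc g h k)))) ⟩
      pairing x (λ g → pairing y (λ h → pairing z (λ k → φ (g ∙ (h ∙ k)))))
        ≡⟨ pairing-cong x (λ g → ≡.sym (pairing-* y z (λ k → φ (g ∙ k)))) ⟩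
      pairing x (λ g → pairing (y * z) (λ k → φ (g ∙ k))) ≡⟨ pairing-* x (y * z) φ ⟨
      pairing (x * (y * z)) φ ∎
      where open ≡-Reasoning

    ≈-refl : ∀ {z} → z ≈ z
    ≈-refl = mk≈ λ g → ≡.refl

    ≈-sym : ∀ {z w} → z ≈ w → w ≈ z
    ≈-sym eq = mk≈ λ g → ≡.sym (κ-≡ eq g)

    ≈-trans : ∀ {x y z} → x ≈ y → y ≈ z → x ≈ z
    ≈-trans eq eq′ = mk≈ λ g → ≡.trans (κ-≡ eq g) (κ-≡ eq′ g)

    -- The values of κ on x y are integer combinations of translated values of κ on y: the kernel of
    -- the form is an ideal.
    *-congˡ : ∀ x {y z} → y ≈ z → x * y ≈ x * z
    *-congˡ x {y} {z} eq = mk≈ λ g → ≡.trans (κ-* x y g)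
      (≡.trans (pairing-cong x (λ h → κ-≡ eq (g ∙ h))) (≡.sym (κ-* x z g)))

    *-cong : ∀ {x x′ y y′} → x ≈ x′ → y ≈ y′ → x * y ≈ x′ * y′
    *-cong {x} {x′} {y} {y′} eq eq′ = ≈-trans (*-congˡ x eq′)
      (≈-trans (*-comm x y′) (≈-trans (*-congˡ y′ eq) (*-comm y′ x′)))

    +-cong : ∀ {x x′ y y′} → x ≈ x′ → y ≈ y′ → x ++ y ≈ x′ ++ y′
    +-cong {x} {x′} {y} {y′} eq eq′ = mk≈ λ g → ≡.trans (κ-+ x y g)
      (≡.trans (≡.cong₂ ℤ._+_ (κ-≡ eq g) (κ-≡ eq′ g)) (≡.sym (κ-+ x′ y′ g)))

    +-assoc : ∀ x y z → (x ++ y) ++ z ≈ x ++ (y ++ z)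
    +-assoc x y z = from-pairing λ φ → begin
      pairing ((x ++ y) ++ z) φ ≡⟨ pairing-++ (x ++ y) z φ ⟩
      pairing (x ++ y) φ ℤ.+ pairing z φ ≡⟨ ≡.cong (ℤ._+ pairing z φ) (pairing-++ x y φ) ⟩
      pairing x φ ℤ.+ pairing y φ ℤ.+ pairing z φ ≡⟨ ℤ.+-assoc (pairing x φ) _ _ ⟩
      pairing x φ ℤ.+ (pairing y φ ℤ.+ pairing z φ) ≡⟨ ≡.cong (ℤ._+_ (pairing x φ)) (pairing-++ y z φ) ⟨
      pairing x φ ℤ.+ pairing (y ++ z) φ ≡⟨ pairing-++ x (y ++ z) φ ⟨
      pairing (x ++ (y ++ z)) φ ∎
      where open ≡-Reasoning

    +-comm : ∀ x y → x ++ y ≈ y ++ x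
    +-comm x y = from-pairing λ φ → ≡.trans (pairing-++ x y φ)
        (≡.trans (ℤ.+-comm (pairing x φ) _) (≡.sym (pairing-++ y x φ)))

    -‿inverseʳ : ∀ x → x ++ (- x) ≈ []
    -‿inverseʳ x = from-pairing λ φ → ≡.trans (pairing-++ x (- x) φ)
      (≡.trans (≡.cong (ℤ._+_ (pairing x φ)) (pairing-neg x φ)) (ℤ.+-inverseʳ (pairing x φ)))

    -‿cong : ∀ {x y} → x ≈ y → - x ≈ - y
    -‿cong {x} {y} eq = mk≈ λ g → ≡.trans (pairing-neg x _)
        (≡.trans (≡.cong ℤ.-_ (κ-≡ eq g)) (≡.sym (pairing-neg y _)))

    *-identityˡ : ∀ x → ι 1ℤ * x ≈ x
    *-identityˡ x = from-pairing λ φ → ≡.trans (pairing-* (ι 1ℤ) x φ)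
      (≡.trans (ℤ.+-identityʳ _) (≡.trans (ℤ.*-identityˡ _) (pairing-cong x (λ h → ≡.cong φ (∙-identityˡ h)))))

    distribʳ : ∀ x y z → (y ++ z) * x ≈ y * x ++ z * x
    distribʳ x y z = from-pairing λ φ → ≡.trans (pairing-* (y ++ z) x φ) (≡.trans (pairing-++ y z _)
      (≡.trans (≡.cong₂ ℤ._+_ (≡.sym (pairing-* y x φ)) (≡.sym (pairing-* z x φ)))
          (≡.sym (pairing-++ (y * x) (z * x) φ))))

  commutativeRing : CommutativeRing 0ℓ 0ℓ
  commutativeRing = record
    { Carrier = Element ; _≈_ = _≈_ ; _+_ = _++_ ; _*_ = _*_ ; -_ = -_ ; 0# = [] ; 1# = ι 1ℤ
    ; isCommutativeRing = record
      { isRing = record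
        { +-isAbelianGroup = record
          { isGroup = record
            { isMonoid = record
              { isSemigroup = record
                { isMagma = record
                  { isEquivalence = record { refl = ≈-refl ; sym = ≈-sym ; trans = ≈-trans }
                  ; ∙-cong = +-cong }
                ; assoc = +-assoc }
              ; identity = (λ x → ≈-refl) , (λ x → +-comm x []) }
            ; inverse = (λ x → ≈-trans (+-comm (- x) x) (-‿inverseʳ x)) , -‿inverseʳ
            ; ⁻¹-cong = -‿cong }
          ; comm = +-comm }
        ; *-cong = *-cong
        ; *-assoc = *-assoc
        ; *-identity = *-identityˡ , λ x → ≈-trans (*-comm x (ι 1ℤ)) (*-identityˡ x)
        ; distrib = (λ x y z → ≈-trans (*-comm x (y ++ z))
            (≈-trans (distribʳ x y z) (+-cong (*-comm y x) (*-comm z x))))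
                  , distribʳ }
      ; *-comm = *-comm } }

  open SemiringSum (CommutativeRing.semiring commutativeRing) using (sum)
  open SemiringSum (CommutativeRing.semiring ℤ.+-*-commutativeRing) using () renaming (sum to sumℤ)

  κ-sum : ∀ {n} (f : Fin n → Element) g → κ (sum f) g ≡ sumℤ (λ i → κ (f i) g)
  κ-sum {zero}  f g = ≡.refl
  κ-sum {suc n} f g = ≡.trans (κ-+ (f zero) _ g) (≡.cong (ℤ._+_ (κ (f zero) g)) (κ-sum (λ i → f (suc i)) g))

  κ-basis : ∀ h g → κ (basis h) g ≡ E (g ∙ h)
  κ-basis h g = ≡.trans (ℤ.+-identityʳ _) (ℤ.*-identityˡ _)

  κ-ι* : ∀ c z g → κ (ι c * z) g ≡ c ℤ.* κ z g
  κ-ι* c z g = ≡.trans (κ-* (ι c) z g) (≡.trans (ℤ.+-identityʳ _)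
    (≡.cong (λ h → c ℤ.* κ z h) (≡.trans (∙-comm g ε) (∙-identityˡ g))))

  κ-basis* : ∀ h z g → κ (basis h * z) g ≡ κ z (g ∙ h)
  κ-basis* h z g = ≡.trans (κ-* (basis h) z g) (≡.trans (ℤ.+-identityʳ _) (ℤ.*-identityˡ _))

  ι-+ : ∀ a b → ι (a ℤ.+ b) ≈ ι a ++ ι b
  ι-+ a b = from-pairing λ φ →
    solve 3 (λ a b x → (a :+ b) :* x :+ con 0ℤ := a :* x :+ (b :* x :+ con 0ℤ)) ≡.refl a b (φ ε)

  ι-* : ∀ a b → ι (a ℤ.* b) ≈ ι a * ι b
  ι-* a b = from-pairing λ φ → ≡.cong (λ h → a ℤ.* b ℤ.* φ h ℤ.+ 0ℤ) (≡.sym (∙-identityˡ ε))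

-- Integer sums and traces of roots of unity

open SemiringSum (CommutativeRing.semiring ℤ.+-*-commutativeRing) using (∑-permute)
  renaming (sum to ∑; sum-cong-≗ to ∑-cong; ∑-distrib-+ to ∑-+; *-distribˡ-sum to *-distribˡ-∑;
    *-distribʳ-sum to *-distribʳ-∑)
open FiniteSum ℤ.+-*-commutativeRing using () renaming (sum-select to ∑-select; sum-zero to ∑-zero)

𝟙 : ∀ {a} {A : Set a} → Dec A → ℤ
𝟙 d = if ⌊ d ⌋ then 1ℤ else 0ℤ

𝟙-yes : ∀ {a} {A : Set a} (d : Dec A) → A → 𝟙 d ≡ 1ℤ
𝟙-yes (yes _) _ = ≡.refl
𝟙-yes (no ¬x) x = ⊥-elim (¬x x)

𝟙-no : ∀ {a} {A : Set a} (d : Dec A) → ¬ A → 𝟙 d ≡ 0ℤ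
𝟙-no (yes x) ¬x = ⊥-elim (¬x x)
𝟙-no (no _)  _  = ≡.refl

∑-const : ∀ n x → ∑ {n} (λ _ → x) ≡ + n ℤ.* x
∑-const zero    x = ≡.refl
∑-const (suc n) x = ≡.trans (≡.cong (ℤ._+_ x) (∑-const n x)) (≡.sym (ℤ.suc-* (+ n) x))

∑-linear : ∀ {n} a b (f g : Fin n → ℤ) → ∑ (λ i → a ℤ.* f i ℤ.+ b ℤ.* g i) ≡ a ℤ.* ∑ f ℤ.+ b ℤ.* ∑ g
∑-linear a b f g = ≡.trans (∑-+ (λ i → a ℤ.* f i) (λ i → b ℤ.* g i))
  (≡.sym (≡.cong₂ ℤ._+_ (*-distribˡ-∑ a f) (*-distribˡ-∑ b g)))

-- For n prime and ζ a primitive n-th root of unity, the trace of ζ^x from ℚ(ζ) to ℚ.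
τ : ∀ n .{{_ : NonZero n}} → Fin n → ℤ
τ n x = + n ℤ.* 𝟙 (x ≟ zeroM n) ℤ.- 1ℤ

-- The indicator of the units modulo a prime n. As a weight, it turns a sum over all of `Fin n` into
-- one over the Galois group.
nonzero : ∀ n .{{_ : NonZero n}} → Fin n → ℤ
nonzero n x = 1ℤ ℤ.- 𝟙 (x ≟ zeroM n)

module _ {n : ℕ} .{{_ : NonZero n}} (isPrime : Prime n) where
  open Residues n renaming (_+_ to _⊕_; _*_ to _⊛_)
  open RingProperties (CommutativeRing.ring commutativeRing) using (+-inverseʳ-unique)

  ∑-τ-≡0 : ∀ g c → c ≡ zeroM n → ∑ (λ x → τ n (g ⊕ x ⊛ c)) ≡ + n ℤ.* τ n g
  ∑-τ-≡0 g c ≡.refl = ≡.trans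
    (∑-cong (λ x → ≡.cong (τ n) (≡.trans (≡.cong (g ⊕_) (CommutativeRing.zeroʳ commutativeRing x))
        (CommutativeRing.+-identityʳ commutativeRing g))))
    (∑-const n (τ n g))

  -- The exponent g + x c vanishes for exactly one x, so the sum is n · 1 - n.
  ∑-τ-≢0 : ∀ g c → c ≢ zeroM n → ∑ (λ x → τ n (g ⊕ x ⊛ c)) ≡ 0ℤ
  ∑-τ-≢0 g c c≢0 with inverse isPrime c c≢0
  ... | c⁻¹ , cc⁻¹≡1 = begin
    ∑ (λ x → τ n (g ⊕ x ⊛ c)) ≡⟨ ∑-cong (λ x → solve 2
        (λ n y → n :* y :- con 1ℤ := n :* y :+ con (ℤ.- 1ℤ) :* con 1ℤ) ≡.refl (+ n) (at x)) ⟩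
    ∑ (λ x → + n ℤ.* at x ℤ.+ ℤ.- 1ℤ ℤ.* 1ℤ) ≡⟨ ∑-linear (+ n) (ℤ.- 1ℤ) at (λ _ → 1ℤ) ⟩
    + n ℤ.* ∑ at ℤ.+ ℤ.- 1ℤ ℤ.* ∑ {n} (λ _ → 1ℤ) ≡⟨ ≡.cong₂ (λ a b → + n ℤ.* a ℤ.+ ℤ.- 1ℤ ℤ.* b) one (∑-const n 1ℤ) ⟩
    + n ℤ.* 1ℤ ℤ.+ ℤ.- 1ℤ ℤ.* (+ n ℤ.* 1ℤ) ≡⟨ solve 1
        (λ n → n :* con 1ℤ :+ con (ℤ.- 1ℤ) :* (n :* con 1ℤ) := con 0ℤ) ≡.refl (+ n) ⟩
    0ℤ ∎
    where
    open ≡-Reasoning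
    at : Fin n → ℤ
    at x = 𝟙 (g ⊕ x ⊛ c ≟ zeroM n)
    x₀ : Fin n
    x₀ = negM n g ⊛ c⁻¹
    cancel : ∀ y → y ⊛ c⁻¹ ⊛ c ≡ y
    cancel y = ≡.trans (*-assoc y c⁻¹ c) (≡.trans (≡.cong (y ⊛_) (≡.trans (*-comm c⁻¹ c) cc⁻¹≡1))
        (CommutativeRing.*-identityʳ commutativeRing y))
    root : g ⊕ x₀ ⊛ c ≡ zeroM n
    root = ≡.trans (≡.cong (g ⊕_) (cancel (negM n g))) (+-inverseʳ g)
    unique : ∀ x → g ⊕ x ⊛ c ≡ zeroM n → x ≡ x₀
    unique x eq = *-cancelˡ-≢0 isPrime c c≢0 (≡.trans (*-comm c x) (≡.trans (+-inverseʳ-unique g (x ⊛ c) eq)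
      (≡.sym (≡.trans (*-comm c x₀) (cancel (negM n g))))))
    one : ∑ at ≡ 1ℤ
    one = ≡.trans (∑-select at x₀ (λ k k≢ → 𝟙-no (g ⊕ k ⊛ c ≟ zeroM n) (λ eq → k≢ (unique k eq))))
        (𝟙-yes (g ⊕ x₀ ⊛ c ≟ zeroM n) root)

  -- The conjugates of ζ^i add up to its trace, which is an integer and leaves the trace of ζ^g as a
  -- factor. The sum over units is the complete sum minus the term at c = 0.
  ∑-nonzero-τ : ∀ g i → ∑ (λ c → nonzero n c ℤ.* τ n (g ⊕ c ⊛ i)) ≡ τ n i ℤ.* τ n g
  ∑-nonzero-τ g i = begin
    ∑ (λ c → nonzero n c ℤ.* t c) ≡⟨ ∑-cong (λ c → solve 2
        (λ d t → (con 1ℤ :- d) :* t := con 1ℤ :* t :+ con (ℤ.- 1ℤ) :* (d :* t)) ≡.refl (𝟙 (c ≟ zeroM n)) (t c)) ⟩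
    ∑ (λ c → 1ℤ ℤ.* t c ℤ.+ ℤ.- 1ℤ ℤ.* (𝟙 (c ≟ zeroM n) ℤ.* t c))
        ≡⟨ ∑-linear 1ℤ (ℤ.- 1ℤ) t (λ c → 𝟙 (c ≟ zeroM n) ℤ.* t c) ⟩
    1ℤ ℤ.* ∑ t ℤ.+ ℤ.- 1ℤ ℤ.* ∑ (λ c → 𝟙 (c ≟ zeroM n) ℤ.* t c)
        ≡⟨ ≡.cong (λ s → 1ℤ ℤ.* ∑ t ℤ.+ ℤ.- 1ℤ ℤ.* s) at-zero ⟩
    1ℤ ℤ.* ∑ t ℤ.+ ℤ.- 1ℤ ℤ.* τ n g ≡⟨ total ⟩
    τ n i ℤ.* τ n g ∎
    where
    open ≡-Reasoning
    t : Fin n → ℤ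
    t c = τ n (g ⊕ c ⊛ i)
    at-zero : ∑ (λ c → 𝟙 (c ≟ zeroM n) ℤ.* t c) ≡ τ n g
    at-zero = begin
      ∑ (λ c → 𝟙 (c ≟ zeroM n) ℤ.* t c) ≡⟨ ∑-select (λ c → 𝟙 (c ≟ zeroM n) ℤ.* t c) (zeroM n)
                                               (λ k k≢0 → ≡.cong (ℤ._* t k) (𝟙-no (k ≟ zeroM n) k≢0)) ⟩
      𝟙 (zeroM n ≟ zeroM n) ℤ.* t (zeroM n) ≡⟨ ≡.cong₂ ℤ._*_ (𝟙-yes (zeroM n ≟ zeroM n) ≡.refl)
          (≡.cong (τ n) (≡.trans (≡.cong (g ⊕_) (CommutativeRing.zeroˡ commutativeRing i))
              (CommutativeRing.+-identityʳ commutativeRing g))) ⟩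
      1ℤ ℤ.* τ n g ≡⟨ ℤ.*-identityˡ _ ⟩
      τ n g ∎
    total : 1ℤ ℤ.* ∑ t ℤ.+ ℤ.- 1ℤ ℤ.* τ n g ≡ τ n i ℤ.* τ n g
    total with i ≟ zeroM n
    ... | yes i≡0 = ≡.trans (≡.cong (λ s → 1ℤ ℤ.* s ℤ.+ ℤ.- 1ℤ ℤ.* τ n g) (∑-τ-≡0 g i i≡0))
      (solve 2 (λ n t → con 1ℤ :* (n :* t) :+ con (ℤ.- 1ℤ) :* t := (n :* con 1ℤ :- con 1ℤ) :* t) ≡.refl (+ n) (τ n g))
    ... | no i≢0  = ≡.trans (≡.cong (λ s → 1ℤ ℤ.* s ℤ.+ ℤ.- 1ℤ ℤ.* τ n g) (∑-τ-≢0 g i i≢0))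
      (solve 2 (λ n t → con 1ℤ :* con 0ℤ :+ con (ℤ.- 1ℤ) :* t := (n :* con 0ℤ :- con 1ℤ) :* t) ≡.refl (+ n) (τ n g))

finiteBound : ∀ {n} (f : Fin n → ℕ) → ∃ λ B → ∀ i → f i ≤ B
finiteBound {zero}  f = 0 , λ ()
finiteBound {suc n} f with finiteBound (λ i → f (suc i))
... | B , bound = f zero ℕ.⊔ B , λ where
  zero    → ℕ.m≤m⊔n (f zero) B
  (suc i) → ℕ.≤-trans (bound i) (ℕ.m≤n⊔m (f zero) B)

∣small⇒≡0 : ∀ {r B} x k → B < r → ∣ x ∣ ≤ B → x ℤ.+ + r ℤ.* k ≡ 0ℤ → x ≡ 0ℤ
∣small⇒≡0 {r} {B} x k B<r x≤B eq = go ∣ k ∣ ≡.refl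
  where
  abs : ∣ x ∣ ≡ r ℕ.* ∣ k ∣
  abs = ≡.trans (≡.sym (ℤ.∣-i∣≡∣i∣ x)) (≡.trans (≡.cong ∣_∣ -x≡rk) (ℤ.abs-* (+ r) k))
    where
    -x≡rk : ℤ.- x ≡ + r ℤ.* k
    -x≡rk = ≡.trans (solve 2 (λ x y → :- x := y :- (x :+ y)) ≡.refl x (+ r ℤ.* k))
      (≡.trans (≡.cong (λ e → + r ℤ.* k ℤ.- e) eq) (ℤ.+-identityʳ _))
  go : ∀ m → ∣ k ∣ ≡ m → x ≡ 0ℤ
  go zero    ∣k∣≡0 = ℤ.∣i∣≡0⇒i≡0 (≡.trans abs (≡.trans (≡.cong (r ℕ.*_) ∣k∣≡0) (ℕ.*-zeroʳ r)))
  go (suc m) ∣k∣≡1+m = ⊥-elim (ℕ.<⇒≱ B<r (ℕ.≤-trans (ℕ.m≤m*n r (suc m))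
    (ℕ.≤-trans (ℕ.≤-reflexive (≡.sym (≡.trans abs (≡.cong (r ℕ.*_) ∣k∣≡1+m)))) x≤B)))

-- The ring of integers of ℚ(ζ_p, ζ_ℓ).
module Cyclotomic (p ℓ : ℕ) .{{_ : NonZero p}} .{{_ : NonZero ℓ}} where
  module P = Residues p
  module L = Residues ℓ

  G : Set
  G = Fin p × Fin ℓ

  infixl 6 _∙_
  _∙_ : G → G → G
  (x , i) ∙ (y , j) = addM p x y , addM ℓ i j

  0G : G
  0G = zeroM p , zeroM ℓ

  ∙-assoc : ∀ g h k → (g ∙ h) ∙ k ≡ g ∙ (h ∙ k)
  ∙-assoc (x , i) (y , j) (z , k) = ≡.cong₂ _,_ (P.+-assoc x y z) (L.+-assoc i j k)

  ∙-comm : ∀ g h → g ∙ h ≡ h ∙ g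
  ∙-comm (x , i) (y , j) = ≡.cong₂ _,_ (P.+-comm x y) (L.+-comm i j)

  ∙-identityˡ : ∀ g → 0G ∙ g ≡ g
  ∙-identityˡ (x , i) = ≡.cong₂ _,_ (P.+-identityˡ x) (L.+-identityˡ i)

  -- For distinct primes the fields ℚ(ζ_p) and ℚ(ζ_ℓ) are linearly disjoint, so the trace of ζ_p^x
  -- ζ_ℓ^i is the product of the two traces.
  trace : G → ℤ
  trace (x , i) = τ p x ℤ.* τ ℓ i

  open TraceRing _∙_ 0G ∙-assoc ∙-comm ∙-identityˡ trace public
  open CommutativeRing commutativeRing using (semiring; sym; trans; *-congˡ; *-congʳ; *-assoc; distribʳ)
  open SemiringMult semiring using () renaming (_×_ to _⋅_)
  open SemiringExp semiring using (_^_)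

  infixr 7 _•_
  _•_ : G → G → G
  (a , b) • (x , i) = mulM p a x , mulM ℓ b i

  residue : ℕ → G
  residue m = m mod p , m mod ℓ

  -- The conjugate of an element under ζ_p ↦ ζ_p^a, ζ_ℓ ↦ ζ_ℓ^b.
  conjugate : G → Element → Element
  conjugate a []            = []
  conjugate a ((c , g) ∷ z) = (c , a • g) ∷ conjugate a z

  pairing-conjugate : ∀ a z φ → pairing (conjugate a z) φ ≡ pairing z (λ g → φ (a • g))
  pairing-conjugate a []            φ = ≡.refl
  pairing-conjugate a ((c , g) ∷ z) φ = ≡.cong (ℤ._+_ (c ℤ.* φ (a • g))) (pairing-conjugate a z φ)

  κ-⋅ : ∀ r z g → κ (r ⋅ z) g ≡ + r ℤ.* κ z g
  κ-⋅ zero    z g = ≡.refl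
  κ-⋅ (suc r) z g = ≡.trans (κ-+ z (r ⋅ z) g)
      (≡.trans (≡.cong (ℤ._+_ (κ z g)) (κ-⋅ r z g)) (≡.sym (ℤ.suc-* (+ r) (κ z g))))

  residue-0 : ∀ g → residue 0 • g ≡ 0G
  residue-0 (x , i) = ≡.cong₂ _,_ (CommutativeRing.zeroˡ P.commutativeRing x)
      (CommutativeRing.zeroˡ L.commutativeRing i)

  residue-1 : ∀ g → residue 1 • g ≡ g
  residue-1 (x , i) = ≡.cong₂ _,_ (P.*-identityˡ x) (L.*-identityˡ i)

  residue-suc : ∀ k g → residue (suc k) • g ≡ g ∙ residue k • g
  residue-suc k (x , i) = ≡.cong₂ _,_
    (≡.trans (≡.cong (P._* x) (≡.sym (P.addM-mod 1 k)))
        (≡.trans (CommutativeRing.distribʳ P.commutativeRing x (oneM p) (k mod p))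
        (≡.cong (P._+ mulM p (k mod p) x) (P.*-identityˡ x))))
    (≡.trans (≡.cong (L._* i) (≡.sym (L.addM-mod 1 k)))
        (≡.trans (CommutativeRing.distribʳ L.commutativeRing i (oneM ℓ) (k mod ℓ))
        (≡.cong (L._+ mulM ℓ (k mod ℓ) i) (L.*-identityˡ i))))

  residue-* : ∀ j k → residue (j ℕ.* k) ≡ residue j • residue k
  residue-* j k = ≡.sym (≡.cong₂ _,_ (P.mulM-mod j k) (L.mulM-mod j k))

  •-assoc : ∀ a b g → (a • b) • g ≡ a • (b • g)
  •-assoc (a , b) (c , d) (x , i) = ≡.cong₂ _,_ (P.*-assoc a c x) (L.*-assoc b d i)

  basis-^ : ∀ g k → basis g ^ k ≡ basis (residue k • g)
  basis-^ g zero    = ≡.cong basis (≡.sym (residue-0 g))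
  basis-^ g (suc k) = ≡.trans (≡.cong (basis g *_) (basis-^ g k)) (≡.cong basis (≡.sym (residue-suc k g)))

  module _ {r} (isPrime : Prime r) where
    open Frobenius commutativeRing isPrime

    -- Peeling off one copy of `basis g` at a time absorbs Fermat's congruence for n into
    -- additivity; on a single basis element the congruence is an equality with quotient zero.
    frobenius-ℕ : ∀ n g → FrobeniusImage ((+ n , g) ∷ []) ((+ n , residue r • g) ∷ [])
    frobenius-ℕ zero    g = frobenius-≈ (mk≈ λ _ → ≡.refl) (mk≈ λ _ → ≡.refl) frobenius-0
    frobenius-ℕ (suc n) g = frobenius-≈ (split n g) (split n (residue r • g))
      (frobenius-+ {basis g} ([] , CommutativeRing.reflexive commutativeRing
          (≡.trans (basis-^ g r) (≡.sym ++-zero))) (frobenius-ℕ n g))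
      where
      split : ∀ n g → basis g ++ ((+ n , g) ∷ []) ≈ (+ suc n , g) ∷ []
      split n g = mk≈ λ h → solve 2 (λ n e → con 1ℤ :* e :+ (n :* e :+ con 0ℤ) := (con 1ℤ :+ n) :* e :+ con 0ℤ)
          ≡.refl (+ n) (trace (h ∙ g))
      ++-zero : basis (residue r • g) ++ r ⋅ [] ≡ basis (residue r • g)
      ++-zero = ≡.cong ((1ℤ , residue r • g) ∷_) (⋅-[] r)
        where
        ⋅-[] : ∀ r → r ⋅ [] ≡ []
        ⋅-[] zero    = ≡.refl
        ⋅-[] (suc r) = ⋅-[] r

    frobenius-ℤ : ∀ c g → FrobeniusImage ((c , g) ∷ []) ((c , residue r • g) ∷ [])
    frobenius-ℤ (+ n)    g = frobenius-ℕ n g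
    frobenius-ℤ -[1+ n ] g = frobenius-neg (frobenius-ℕ (suc n) g)

    frobenius : ∀ z → FrobeniusImage z (conjugate (residue r) z)
    frobenius []            = frobenius-0
    frobenius ((c , g) ∷ z) = frobenius-+ (frobenius-ℤ c g) (frobenius z)

  conjugate-conjugate : ∀ a b z → conjugate a (conjugate b z) ≡ conjugate (a • b) z
  conjugate-conjugate a b []            = ≡.refl
  conjugate-conjugate a b ((c , g) ∷ z) = ≡.cong₂ (λ h w → (c , h) ∷ w) (≡.sym (•-assoc a b g))
      (conjugate-conjugate a b z)

  conjugate-1 : ∀ z → conjugate (residue 1) z ≡ z
  conjugate-1 []            = ≡.refl
  conjugate-1 ((c , g) ∷ z) = ≡.cong₂ (λ h w → (c , h) ∷ w) (residue-1 g) (conjugate-1 z)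

  ^-annihilates : ∀ {r} → Prime r → ∀ z w → z * w ≈ [] → z ^ r * w ≈ []
  ^-annihilates {zero}  isPrime z w zw = ⊥-elim (¬prime[0] isPrime)
  ^-annihilates {suc r} isPrime z w zw = trans (*-congʳ (CommutativeRing.*-comm commutativeRing z (z ^ r)))
    (trans (*-assoc (z ^ r) z w) (trans (*-congˡ {x = z ^ r} zw) (CommutativeRing.zeroʳ commutativeRing (z ^ r))))

  module _ (z w : Element) where
    -- The bound is uniform over all conjugates, so it is fixed before any prime is chosen and still
    -- applies after several conjugations.
    conjugateBound : ∃ λ B → ∀ a g → ∣ κ (conjugate a z * w) g ∣ ≤ B
    conjugateBound = proj₁ outer , λ (a , b) (x , i) → ℕ.≤-trans (proj₂ (bound₁ a b x) i)
        (ℕ.≤-trans (proj₂ (bound₂ a b) x) (ℕ.≤-trans (proj₂ (bound₃ a) b) (proj₂ outer a)))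
      where
      bound₁ : ∀ a b x → ∃ λ B → ∀ i → ∣ κ (conjugate (a , b) z * w) (x , i) ∣ ≤ B
      bound₁ a b x = finiteBound (λ i → ∣ κ (conjugate (a , b) z * w) (x , i) ∣)
      bound₂ : ∀ a b → ∃ λ B → ∀ x → proj₁ (bound₁ a b x) ≤ B
      bound₂ a b = finiteBound (λ x → proj₁ (bound₁ a b x))
      bound₃ : ∀ a → ∃ λ B → ∀ b → proj₁ (bound₂ a b) ≤ B
      bound₃ a = finiteBound (λ b → proj₁ (bound₂ a b))
      outer : ∃ λ B → ∀ a → proj₁ (bound₃ a) ≤ B
      outer = finiteBound (λ a → proj₁ (bound₃ a))

    conjugate-step : ∀ {r} → Prime r → proj₁ conjugateBound < r → ∀ a →
      conjugate a z * w ≈ [] → conjugate (residue r • a) z * w ≈ []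
    conjugate-step {r} isPrime B<r a zw≈0 with frobenius isPrime (conjugate a z)
    -- At each g the equation reads x + r k = 0 with x the wanted value of κ, an integer of absolute
    -- value below r.
    ... | q , eq = mk≈ λ g → ∣small⇒≡0 (κ (conjugate (residue r • a) z * w) g) (κ (q * w) g) B<r
        (proj₂ conjugateBound (residue r • a) g)
        (≡.trans (≡.sym (expand g)) (κ-≡ (trans (*-congʳ (sym eq)) (^-annihilates isPrime (conjugate a z) w zw≈0)) g))
      where
      expand : ∀ g → κ ((conjugate (residue r) (conjugate a z) ++ r ⋅ q) * w) g
        ≡ κ (conjugate (residue r • a) z * w) g ℤ.+ + r ℤ.* κ (q * w) g
      expand g = begin
        κ ((conjugate (residue r) (conjugate a z) ++ r ⋅ q) * w) g
          ≡⟨ κ-≡ (distribʳ w (conjugate (residue r) (conjugate a z)) (r ⋅ q)) g ⟩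
        κ (conjugate (residue r) (conjugate a z) * w ++ (r ⋅ q) * w) g
          ≡⟨ κ-+ (conjugate (residue r) (conjugate a z) * w) _ g ⟩
        κ (conjugate (residue r) (conjugate a z) * w) g ℤ.+ κ ((r ⋅ q) * w) g
          ≡⟨ ≡.cong₂ ℤ._+_ (≡.cong (λ y → κ (y * w) g) (conjugate-conjugate (residue r) a z))
               (≡.trans (κ-≡ (SemiringMult.×-assoc-* semiring r q w) g) (κ-⋅ r (q * w) g)) ⟩
        κ (conjugate (residue r • a) z * w) g ℤ.+ + r ℤ.* κ (q * w) g ∎
        where open ≡-Reasoning

    conjugate-product : ∀ rs → All Prime rs → All (proj₁ conjugateBound <_) rs → z * w ≈ [] →
      conjugate (residue (product rs)) z * w ≈ []
    conjugate-product []       _          _            zw≈0 = ≡.subst (λ y → y * w ≈ []) (≡.sym (conjugate-1 z)) zw≈0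
    conjugate-product (r ∷ rs) (pr ∷ prs) (B<r ∷ B<rs) zw≈0 =
      ≡.subst (λ a → conjugate a z * w ≈ []) (≡.sym (residue-* r (product rs)))
        (conjugate-step pr B<r (residue (product rs)) (conjugate-product rs prs B<rs zw≈0))

  pairing-∑ : ∀ {n} z (f : Fin n → ℤ) (F : Fin n → G → ℤ) →
    pairing z (λ h → ∑ (λ a → f a ℤ.* F a h)) ≡ ∑ (λ a → f a ℤ.* pairing z (F a))
  pairing-∑ {zero}  z f F = pairing-zero z
  pairing-∑ {suc n} z f F = ≡.trans (pairing-linear z (f zero) (F zero) _)
    (≡.cong (ℤ._+_ (f zero ℤ.* pairing z (F zero))) (pairing-∑ z (λ a → f (suc a)) (λ a → F (suc a))))

  module Domain (p-prime : Prime p) (ℓ-prime : Prime ℓ) (ℓ≢p : ℓ ≢ p) where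

    conjugate-annihilates : ∀ z w → z * w ≈ [] → ∀ a b → a ≢ zeroM p → b ≢ zeroM ℓ → conjugate (a , b) z * w ≈ []
    conjugate-annihilates z w zw≈0 a b a≢0 b≢0
      with m , m≡a , m≡b , m≢0 , rough ← roughRepresentative p-prime ℓ-prime ℓ≢p a b a≢0 b≢0
          (proj₁ (conjugateBound z w)) =
      ≡.subst (λ a → conjugate a z * w ≈ []) (≡.trans (≡.cong residue (≡.sym (isFactorisation)))
          (≡.cong₂ _,_ m≡a m≡b))
        (conjugate-product z w factors factorsPrime
            (large factors factorsPrime (λ r∣ → ≡.subst (_ ∣_) (≡.sym isFactorisation) r∣)) zw≈0)
      where
      open PrimeFactorisation (factorise m {{m≢0}})
      -- The factorisation is weakened to divisibility into m, which passes to the tail of the list.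
      large : ∀ rs → All Prime rs → (∀ {r} → r ∣ product rs → r ∣ m) → All (proj₁ (conjugateBound z w) <_) rs
      large []       _          _  = []
      large (r ∷ rs) (pr ∷ prs) ∣m = rough pr (∣m (m∣m*n (product rs))) ∷ large rs prs
          (λ d∣ → ∣m (∣-trans d∣ (n∣m*n r)))

    conjugateSum : Element → Element → G → ℤ
    conjugateSum z w g = ∑ λ a → nonzero p a ℤ.* ∑ λ b → nonzero ℓ b ℤ.* κ (conjugate (a , b) z * w) g

    -- The trace is a product over the two coordinates, so the double sum splits into two instances
    -- of `∑-nonzero-τ`.
    ∑-nonzero-trace : ∀ g h k → (∑ λ a → nonzero p a ℤ.* ∑ λ b → nonzero ℓ b ℤ.* trace ((g ∙ ((a , b) • h)) ∙ k)) ≡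
        trace h ℤ.* trace (g ∙ k)
    ∑-nonzero-trace (x , i) (y , j) (u , v) = begin
      (∑ λ a → nonzero p a ℤ.* ∑ λ b → nonzero ℓ b ℤ.* (s a ℤ.* t b))
        ≡⟨ ∑-cong (λ a → ≡.cong (ℤ._*_ (nonzero p a)) (≡.trans
             (∑-cong (λ b → solve 3 (λ n s t → n :* (s :* t) := s :* (n :* t)) ≡.refl (nonzero ℓ b) (s a) (t b)))
             (≡.sym (*-distribˡ-∑ (s a) (λ b → nonzero ℓ b ℤ.* t b))))) ⟩
      (∑ λ a → nonzero p a ℤ.* (s a ℤ.* T))
        ≡⟨ ∑-cong (λ a → ≡.sym (ℤ.*-assoc (nonzero p a) (s a) T)) ⟩
      (∑ λ a → nonzero p a ℤ.* s a ℤ.* T)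
        ≡⟨ *-distribʳ-∑ T (λ a → nonzero p a ℤ.* s a) ⟨
      S ℤ.* T
        ≡⟨ ≡.cong₂ ℤ._*_ (≡.trans (∑-cong (λ a → ≡.cong (λ q → nonzero p a ℤ.* τ p q) (P-swap x (mulM p a y) u)))
            (∑-nonzero-τ p-prime (addM p x u) y))
                         (≡.trans (∑-cong (λ b → ≡.cong (λ q → nonzero ℓ b ℤ.* τ ℓ q) (L-swap i (mulM ℓ b j) v)))
                             (∑-nonzero-τ ℓ-prime (addM ℓ i v) j)) ⟩
      (τ p y ℤ.* τ p (addM p x u)) ℤ.* (τ ℓ j ℤ.* τ ℓ (addM ℓ i v))
        ≡⟨ solve 4 (λ a b c d → (a :* b) :* (c :* d) := (a :* c) :* (b :* d)) ≡.refl (τ p y) (τ p (addM p x u))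
            (τ ℓ j) (τ ℓ (addM ℓ i v)) ⟩
      (τ p y ℤ.* τ ℓ j) ℤ.* (τ p (addM p x u) ℤ.* τ ℓ (addM ℓ i v)) ∎
      where
      open ≡-Reasoning
      s : Fin p → ℤ
      s a = τ p (addM p (addM p x (mulM p a y)) u)
      t : Fin ℓ → ℤ
      t b = τ ℓ (addM ℓ (addM ℓ i (mulM ℓ b j)) v)
      S T : ℤ
      S = ∑ λ a → nonzero p a ℤ.* s a
      T = ∑ λ b → nonzero ℓ b ℤ.* t b
      P-swap : ∀ x y z → addM p (addM p x y) z ≡ addM p (addM p x z) y
      P-swap x y z = ≡.trans (P.+-assoc x y z) (≡.trans (≡.cong (addM p x) (P.+-comm y z)) (≡.sym (P.+-assoc x z y)))
      L-swap : ∀ x y z → addM ℓ (addM ℓ x y) z ≡ addM ℓ (addM ℓ x z) y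
      L-swap x y z = ≡.trans (L.+-assoc x y z) (≡.trans (≡.cong (addM ℓ x) (L.+-comm y z)) (≡.sym (L.+-assoc x z y)))

    -- The conjugates of z add up to the trace of z.
    conjugateSum≡ : ∀ z w g → conjugateSum z w g ≡ κ z 0G ℤ.* κ w g
    conjugateSum≡ z w g = begin
      (∑ λ a → nonzero p a ℤ.* ∑ λ b → nonzero ℓ b ℤ.* κ (conjugate (a , b) z * w) g)
        ≡⟨ ∑-cong (λ a → ≡.cong (ℤ._*_ (nonzero p a))
            (≡.trans (∑-cong (λ b → ≡.cong (ℤ._*_ (nonzero ℓ b)) (unfold a b)))
             (≡.sym (pairing-∑ z (nonzero ℓ) (λ b h → κ w (g ∙ ((a , b) • h))))))) ⟩
      (∑ λ a → nonzero p a ℤ.* pairing z (λ h → ∑ λ b → nonzero ℓ b ℤ.* κ w (g ∙ ((a , b) • h))))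
        ≡⟨ pairing-∑ z (nonzero p) (λ a h → ∑ λ b → nonzero ℓ b ℤ.* κ w (g ∙ ((a , b) • h))) ⟨
      pairing z (λ h → ∑ λ a → nonzero p a ℤ.* ∑ λ b → nonzero ℓ b ℤ.* κ w (g ∙ ((a , b) • h)))
        ≡⟨ pairing-cong z inner ⟩
      pairing z (λ h → κ w g ℤ.* trace (0G ∙ h))
        ≡⟨ pairing-scale z (κ w g) (λ h → trace (0G ∙ h)) ⟩
      κ w g ℤ.* κ z 0G
        ≡⟨ ℤ.*-comm (κ w g) (κ z 0G) ⟩
      κ z 0G ℤ.* κ w g ∎
      where
      open ≡-Reasoning
      unfold : ∀ a b → κ (conjugate (a , b) z * w) g ≡ pairing z (λ h → κ w (g ∙ ((a , b) • h)))
      unfold a b = ≡.trans (κ-* (conjugate (a , b) z) w g) (pairing-conjugate (a , b) z (λ h → κ w (g ∙ h)))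
      inner : ∀ h → (∑ λ a → nonzero p a ℤ.* ∑ λ b → nonzero ℓ b ℤ.* κ w (g ∙ ((a , b) • h)))
        ≡ κ w g ℤ.* trace (0G ∙ h)
      inner h = begin
        (∑ λ a → nonzero p a ℤ.* ∑ λ b → nonzero ℓ b ℤ.* κ w (g ∙ ((a , b) • h)))
          ≡⟨ ∑-cong (λ a → ≡.cong (ℤ._*_ (nonzero p a))
              (≡.sym (pairing-∑ w (nonzero ℓ) (λ b k → trace ((g ∙ ((a , b) • h)) ∙ k))))) ⟩
        (∑ λ a → nonzero p a ℤ.* pairing w (λ k → ∑ λ b → nonzero ℓ b ℤ.* trace ((g ∙ ((a , b) • h)) ∙ k)))
          ≡⟨ pairing-∑ w (nonzero p) (λ a k → ∑ λ b → nonzero ℓ b ℤ.* trace ((g ∙ ((a , b) • h)) ∙ k)) ⟨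
        pairing w (λ k → ∑ λ a → nonzero p a ℤ.* ∑ λ b → nonzero ℓ b ℤ.* trace ((g ∙ ((a , b) • h)) ∙ k))
          ≡⟨ pairing-cong w (λ k → ∑-nonzero-trace g h k) ⟩
        pairing w (λ k → trace h ℤ.* trace (g ∙ k))
          ≡⟨ pairing-scale w (trace h) (λ k → trace (g ∙ k)) ⟩
        trace h ℤ.* κ w g
          ≡⟨ ℤ.*-comm (trace h) (κ w g) ⟩
        κ w g ℤ.* trace h
          ≡⟨ ≡.cong (λ k → κ w g ℤ.* trace k) (∙-identityˡ h) ⟨
        κ w g ℤ.* trace (0G ∙ h) ∎

    trace-annihilates : ∀ z w → z * w ≈ [] → ∀ g → κ z 0G ℤ.* κ w g ≡ 0ℤ
    trace-annihilates z w zw≈0 g = ≡.trans (≡.sym (conjugateSum≡ z w g))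
      (∑-zero _ λ a → outer a)
      where
      outer : ∀ a → nonzero p a ℤ.* (∑ λ b → nonzero ℓ b ℤ.* κ (conjugate (a , b) z * w) g) ≡ 0ℤ
      outer a with a ≟ zeroM p
      ... | yes _   = ≡.refl
      ... | no  a≢0 = ≡.trans (ℤ.*-identityˡ _) (∑-zero _ λ b → inner b)
        where
        inner : ∀ b → nonzero ℓ b ℤ.* κ (conjugate (a , b) z * w) g ≡ 0ℤ
        inner b with b ≟ zeroM ℓ
        ... | yes _   = ≡.refl
        ... | no  b≢0 = ≡.trans (ℤ.*-identityˡ _) (κ-≡ (conjugate-annihilates z w zw≈0 a b a≢0 b≢0) g)

    κ-annihilates : ∀ z w → z * w ≈ [] → ∀ h g → κ z h ℤ.* κ w g ≡ 0ℤ
    κ-annihilates z w zw≈0 h g = ≡.trans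
      (≡.cong (ℤ._* κ w g) (≡.sym (≡.trans (κ-basis* h z 0G) (≡.cong (κ z) (∙-identityˡ h)))))
      (trace-annihilates (basis h * z) w
        (trans (*-assoc (basis h) z w) (trans (*-congˡ {x = basis h} zw≈0)
            (CommutativeRing.zeroʳ commutativeRing (basis h)))) g)

    -- `κ w` has finitely many integer values. A nonzero one can be cancelled from `κ-annihilates`,
    -- giving z = 0; if none exists, w = 0.
    noZeroDivisors : ∀ z w → z * w ≈ [] → z ≈ [] ⊎ w ≈ []
    noZeroDivisors z w zw≈0 with any? (λ x → any? (λ i → ¬? (κ w (x , i) ℤ.≟ 0ℤ)))
    ... | yes (x , i , ≢0) = inj₁ (mk≈ λ h → cancel (ℤ.i*j≡0⇒i≡0∨j≡0 (κ z h) (κ-annihilates z w zw≈0 h (x , i))))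
      where
      cancel : ∀ {a} → a ≡ 0ℤ ⊎ κ w (x , i) ≡ 0ℤ → a ≡ 0ℤ
      cancel (inj₁ eq) = eq
      cancel (inj₂ eq) = ⊥-elim (≢0 eq)
    ... | no none = inj₂ (mk≈ λ (x , i) → decidable-stable (κ w (x , i) ℤ.≟ 0ℤ) (λ ≢0 → none (x , i , ≢0)))

-- Characteristic polynomials

-- The source is only a raw ring, so evaluation of coefficient lists qualifies although lists
-- satisfy the ring laws only up to trailing zeros.
record IsHomomorphism {a b c d} (S : RawRing a b) (R : CommutativeRing c d)
    (h : RawRing.Carrier S → CommutativeRing.Carrier R) : Set (a ⊔ d) where
  private
    module S = RawRing S
  open CommutativeRing R
  field
    h-0   : h S.0# ≈ 0#
    h-1   : h S.1# ≈ 1#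
    h-+   : ∀ x y → h (x S.+ y) ≈ h x + h y
    h-*   : ∀ x y → h (x S.* y) ≈ h x * h y
    h-neg : ∀ x → h (S.- x) ≈ - h x

module _ {a b c d} {S : RawRing a b} {R : CommutativeRing c d} {h} (isHomomorphism : IsHomomorphism S R h) where
  private
    module S = RawRing S
    module DS = RawDeterminant S
  open RawMonoidSum S.+-rawMonoid using () renaming (sum to sumS)
  open CommutativeRing R hiding (zero)
  open Determinant R
  open SemiringSum semiring using (sum; sum-cong-≋)
  open IsHomomorphism isHomomorphism

  homomorphism-sum : ∀ {n} (f : Fin n → S.Carrier) → h (sumS f) ≈ sum (λ i → h (f i))
  homomorphism-sum {zero}  f = h-0
  homomorphism-sum {suc n} f = trans (h-+ _ _) (+-congˡ (homomorphism-sum (λ i → f (suc i))))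

  homomorphism-sign : ∀ k → h (DS.sign k) ≈ sign k
  homomorphism-sign zero    = h-1
  homomorphism-sign (suc k) = trans (h-neg _) (-‿cong (homomorphism-sign k))

  homomorphism-determinant : ∀ n A → h (DS.determinant n A) ≈ determinant n (λ i j → h (A i j))
  homomorphism-determinant zero    A = h-1
  homomorphism-determinant (suc n) A = trans (homomorphism-sum term) (sum-cong-≋ step)
    where
    term : Fin (suc n) → S.Carrier
    term j = DS.sign (toℕ j) S.* A zero j S.* DS.determinant n (λ r c → A (suc r) (punchIn j c))
    step : ∀ j → h (term j) ≈ sign (toℕ j) * h (A zero j) * determinant n (λ r c → h (A (suc r) (punchIn j c)))
    step j = trans (h-* _ _) (*-cong (trans (h-* _ _) (*-congʳ (homomorphism-sign (toℕ j))))
      (homomorphism-determinant n (λ r c → A (suc r) (punchIn j c))))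

det≡determinant : ∀ n A → det n A ≡ Determinant.determinant ℤ.+-*-commutativeRing n A
det≡determinant zero    A = ≡.refl
det≡determinant (suc n) A = ≡.trans (sumFin≡sum
    (λ j → sgn (toℕ j) ℤ.* A zero j ℤ.* det n (λ r c → A (suc r) (punchIn j c))))
  (sum-cong-≗ λ j → ≡.cong₂ (λ s m → s ℤ.* A zero j ℤ.* m) (sgn≡sign (toℕ j))
      (det≡determinant n (λ r c → A (suc r) (punchIn j c))))
  where
  open SemiringSum (CommutativeRing.semiring ℤ.+-*-commutativeRing) using (sum; sum-cong-≗)
  sumFin≡sum : ∀ {n} (f : Fin n → ℤ) → sumFin n f ≡ sum f
  sumFin≡sum {zero}  f = ≡.refl
  sumFin≡sum {suc n} f = ≡.cong (ℤ._+_ (f zero)) (sumFin≡sum (λ i → f (suc i)))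
  sgn≡sign : ∀ k → sgn k ≡ Determinant.sign ℤ.+-*-commutativeRing k
  sgn≡sign zero    = ≡.refl
  sgn≡sign (suc k) = ≡.cong (λ x → ℤ.- x) (sgn≡sign k)

-- Coefficients in increasing degree, trailing zeros allowed. Equality of polynomials is expressed
-- by the vanishing of all coefficients of a difference.
Polynomial : Set
Polynomial = List ℤ

infixl 6 _⊞_
infixl 7 _⊠_
infix 8 ⊟_
_⊞_ _⊠_ : Polynomial → Polynomial → Polynomial
[]      ⊞ g       = g
(a ∷ f) ⊞ []      = a ∷ f
(a ∷ f) ⊞ (b ∷ g) = a ℤ.+ b ∷ f ⊞ g

⊟_ : Polynomial → Polynomial
⊟ []      = []
⊟ (a ∷ f) = ℤ.- a ∷ ⊟ f

[]      ⊠ g = []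
(a ∷ f) ⊠ g = map (a ℤ.*_) g ⊞ (0ℤ ∷ f ⊠ g)

polynomialRawRing : RawRing 0ℓ 0ℓ
polynomialRawRing = record
  { Carrier = Polynomial ; _≈_ = _≡_ ; _+_ = _⊞_ ; _*_ = _⊠_ ; -_ = ⊟_ ; 0# = [] ; 1# = 1ℤ ∷ [] }

ℤ-rawRing : RawRing 0ℓ 0ℓ
ℤ-rawRing = CommutativeRing.rawRing ℤ.+-*-commutativeRing

module Evaluation {c ℓ} (R : CommutativeRing c ℓ) {ι} (isHomomorphism : IsHomomorphism ℤ-rawRing R ι)
    (t : CommutativeRing.Carrier R) where
  open CommutativeRing R hiding (zero)
  open IsHomomorphism isHomomorphism
  open RingProperties ring using (-‿+-comm; -‿distribʳ-*; -0#≈0#)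
  open CommutativeSemigroupProperties +-commutativeSemigroup using (interchange)
  open SetoidReasoning setoid

  eval : Polynomial → Carrier
  eval []      = 0#
  eval (a ∷ f) = ι a + t * eval f

  eval-⊞ : ∀ f g → eval (f ⊞ g) ≈ eval f + eval g
  eval-⊞ []      g       = sym (+-identityˡ _)
  eval-⊞ (a ∷ f) []      = sym (+-identityʳ _)
  eval-⊞ (a ∷ f) (b ∷ g) = begin
    ι (a ℤ.+ b) + t * eval (f ⊞ g)             ≈⟨ +-cong (h-+ a b) (*-congˡ (eval-⊞ f g)) ⟩
    ι a + ι b + t * (eval f + eval g)          ≈⟨ +-congˡ (distribˡ t _ _) ⟩
    ι a + ι b + (t * eval f + t * eval g)      ≈⟨ interchange _ _ _ _ ⟩
    ι a + t * eval f + (ι b + t * eval g)      ∎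

  eval-⊟ : ∀ f → eval (⊟ f) ≈ - eval f
  eval-⊟ []      = sym -0#≈0#
  eval-⊟ (a ∷ f) = trans (+-cong (h-neg a) (trans (*-congˡ (eval-⊟ f)) (sym (-‿distribʳ-* t (eval f)))))
      (-‿+-comm _ _)

  eval-scale : ∀ a g → eval (map (a ℤ.*_) g) ≈ ι a * eval g
  eval-scale a []      = sym (zeroʳ _)
  eval-scale a (b ∷ g) = begin
    ι (a ℤ.* b) + t * eval (map (a ℤ.*_) g) ≈⟨ +-cong (h-* a b) (*-congˡ (eval-scale a g)) ⟩
    ι a * ι b + t * (ι a * eval g)          ≈⟨ +-congˡ
        (trans (sym (*-assoc t _ _)) (trans (*-congʳ (*-comm t _)) (*-assoc _ t _))) ⟩
    ι a * ι b + ι a * (t * eval g)          ≈⟨ distribˡ _ _ _ ⟨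
    ι a * (ι b + t * eval g)                ∎

  eval-⊠ : ∀ f g → eval (f ⊠ g) ≈ eval f * eval g
  eval-⊠ []      g = sym (zeroˡ _)
  eval-⊠ (a ∷ f) g = begin
    eval (map (a ℤ.*_) g ⊞ (0ℤ ∷ f ⊠ g))         ≈⟨ eval-⊞ (map (a ℤ.*_) g) _ ⟩
    eval (map (a ℤ.*_) g) + (ι 0ℤ + t * eval (f ⊠ g))
        ≈⟨ +-cong (eval-scale a g) (trans (+-congʳ h-0) (+-identityˡ _)) ⟩
    ι a * eval g + t * eval (f ⊠ g)              ≈⟨ +-congˡ (trans (*-congˡ (eval-⊠ f g)) (sym (*-assoc t _ _))) ⟩
    ι a * eval g + t * eval f * eval g           ≈⟨ distribʳ _ _ _ ⟨
    (ι a + t * eval f) * eval g                  ∎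

  eval-isHomomorphism : IsHomomorphism polynomialRawRing R eval
  eval-isHomomorphism = record
    { h-0 = refl ; h-1 = trans (+-cong h-1 (zeroʳ t)) (+-identityʳ _)
    ; h-+ = eval-⊞ ; h-* = eval-⊠ ; h-neg = eval-⊟ }

  eval-zero : ∀ {f} → All (_≡ 0ℤ) f → eval f ≈ 0#
  eval-zero []             = refl
  eval-zero (≡.refl ∷ eqs) = trans (+-cong h-0 (trans (*-congˡ (eval-zero eqs)) (zeroʳ t))) (+-identityˡ _)

ℤ-isHomomorphism : IsHomomorphism ℤ-rawRing ℤ.+-*-commutativeRing (λ z → z)
ℤ-isHomomorphism = record { h-0 = ≡.refl ; h-1 = ≡.refl ; h-+ = λ _ _ → ≡.refl ; h-* = λ _ _ → ≡.refl ; h-neg =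
    λ _ → ≡.refl }

open Evaluation ℤ.+-*-commutativeRing ℤ-isHomomorphism using () renaming
    (eval to evalℤ; eval-⊞ to evalℤ-⊞; eval-⊟ to evalℤ-⊟; eval-isHomomorphism to evalℤ-isHomomorphism)

-- The constant coefficient a is divisible by every t > 0, in particular by ∣a∣ + 1.
vanishing⇒zero : ∀ f → (∀ n → evalℤ (+ suc n) f ≡ 0ℤ) → All (_≡ 0ℤ) f
vanishing⇒zero []      eq = []
vanishing⇒zero (a ∷ f) eq = a≡0 ∷ vanishing⇒zero f rest
  where
  a≡0 : a ≡ 0ℤ
  a≡0 = ∣small⇒≡0 a _ (ℕ.n<1+n ∣ a ∣) ℕ.≤-refl (eq ∣ a ∣)
  rest : ∀ n → evalℤ (+ suc n) f ≡ 0ℤ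
  rest n with ℤ.i*j≡0⇒i≡0∨j≡0 (+ suc n) (≡.trans (≡.sym (ℤ.+-identityˡ _))
      (≡.trans (≡.cong (ℤ._+ (+ suc n ℤ.* evalℤ (+ suc n) f)) (≡.sym a≡0)) (eq n)))
  ... | inj₂ e = e

-- The list `0ℤ ∷ 1ℤ ∷ []` is the indeterminate.
characteristicEntry : ∀ {n} → (Fin n → Fin n → ℤ) → Fin n → Fin n → Polynomial
characteristicEntry A u v = (if ⌊ u ≟ v ⌋ then 0ℤ ∷ 1ℤ ∷ [] else []) ⊞ (⊟ (A u v ∷ []))

characteristicPolynomial : ∀ n → (Fin n → Fin n → ℤ) → Polynomial
characteristicPolynomial n A = RawDeterminant.determinant polynomialRawRing n (characteristicEntry A)

evalℤ-characteristic : ∀ n A t → evalℤ t (characteristicPolynomial n A) ≡ charPoly n A t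
evalℤ-characteristic n A t = ≡.trans
  (homomorphism-determinant (evalℤ-isHomomorphism t) n (characteristicEntry A))
  (≡.trans (Determinant.determinant-cong ℤ.+-*-commutativeRing n entry) (≡.sym (det≡determinant n _)))
  where
  entry : ∀ u v → evalℤ t (characteristicEntry A u v) ≡ (if ⌊ u ≟ v ⌋ then t else 0ℤ) ℤ.- A u v
  entry u v = ≡.trans (evalℤ-⊞ t (if ⌊ u ≟ v ⌋ then 0ℤ ∷ 1ℤ ∷ [] else []) (⊟ (A u v ∷ [])))
    (≡.cong₂ ℤ._+_ diagonal (≡.trans (≡.cong (ℤ._+_ (ℤ.- A u v)) (ℤ.*-zeroʳ t)) (ℤ.+-identityʳ _)))
    where
    diagonal : evalℤ t (if ⌊ u ≟ v ⌋ then 0ℤ ∷ 1ℤ ∷ [] else []) ≡ (if ⌊ u ≟ v ⌋ then t else 0ℤ)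
    diagonal with u ≟ v
    ... | no  _ = ≡.refl
    ... | yes _ = ≡.trans (ℤ.+-identityˡ _) (≡.trans (≡.cong (λ x → t ℤ.* (1ℤ ℤ.+ x)) (ℤ.*-zeroʳ t))
        (ℤ.*-identityʳ t))

module Specialisation {c ℓ} (R : CommutativeRing c ℓ) {ι} (isHomomorphism : IsHomomorphism ℤ-rawRing R ι) where
  open CommutativeRing R hiding (zero)
  open Determinant R
  open IsHomomorphism isHomomorphism
  open RingProperties ring using (x∙y⁻¹≈ε⇒x≈y)

  characteristicMatrix : ∀ {n} → (Fin n → Fin n → ℤ) → Carrier → Matrix n
  characteristicMatrix A t u v = (t * δ u v) - ι (A u v)

  -- The two characteristic polynomials agree at all positive integers, so their difference has only
  -- zero coefficients and vanishes at every point of every commutative ring. This carries the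
  -- hypothesis from ℤ to the cyclotomic integers.
  charPoly-specialise : ∀ n A B → (∀ t → charPoly n A t ≡ charPoly n B t) →
    ∀ t → determinant n (characteristicMatrix A t) ≈ determinant n (characteristicMatrix B t)
  charPoly-specialise n A B eq t = trans (sym (specialise A)) (trans same (specialise B))
    where
    open Evaluation R isHomomorphism t
    specialise : ∀ A → eval (characteristicPolynomial n A) ≈ determinant n (characteristicMatrix A t)
    specialise A = trans (homomorphism-determinant eval-isHomomorphism n (characteristicEntry A))
        (determinant-cong n entry)
      where
      diagonal : ∀ u v → eval (if ⌊ u ≟ v ⌋ then 0ℤ ∷ 1ℤ ∷ [] else []) ≈ t * δ u v
      diagonal u v with u ≟ v
      ... | no  _ = sym (zeroʳ t)
      ... | yes _ = trans (+-cong h-0 (*-congˡ (trans (+-cong h-1 (zeroʳ t)) (+-identityʳ _)))) (+-identityˡ _)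
      entry : ∀ u v → eval (characteristicEntry A u v) ≈ characteristicMatrix A t u v
      entry u v = trans (eval-⊞ (if ⌊ u ≟ v ⌋ then 0ℤ ∷ 1ℤ ∷ [] else []) (⊟ (A u v ∷ [])))
        (+-cong (diagonal u v) (trans (+-cong (h-neg (A u v)) (zeroʳ t)) (+-identityʳ _)))
    difference : Polynomial
    difference = characteristicPolynomial n A ⊞ (⊟ characteristicPolynomial n B)
    vanishes : All (_≡ 0ℤ) difference
    vanishes = vanishing⇒zero difference λ k →
      ≡.trans (evalℤ-⊞ (+ suc k) (characteristicPolynomial n A) _)
      (≡.trans (≡.cong (ℤ._+_ (evalℤ (+ suc k) (characteristicPolynomial n A)))
          (evalℤ-⊟ (+ suc k) (characteristicPolynomial n B)))
      (ℤ.i≡j⇒i-j≡0 (≡.trans (evalℤ-characteristic n A (+ suc k))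
          (≡.trans (eq (+ suc k)) (≡.sym (evalℤ-characteristic n B (+ suc k)))))))
    same : eval (characteristicPolynomial n A) ≈ eval (characteristicPolynomial n B)
    same = x∙y⁻¹≈ε⇒x≈y _ _ (trans (+-congˡ (sym (eval-⊟ (characteristicPolynomial n B))))
      (trans (sym (eval-⊞ (characteristicPolynomial n A) _)) (eval-zero vanishes)))

-- The spectrum of a cover

module _ {c ℓ} (R : CommutativeRing c ℓ) where
  open CommutativeRing R hiding (zero)
  open Determinant R
  open FiniteSum R using (sum-select)
  open SemiringSum semiring using (sum; sum-cong-≋; ∑-distrib-+; *-distribʳ-sum)
  open RingProperties ring using (-‿distribˡ-*; -‿distribʳ-*)
  open SetoidReasoning setoid

  -- Determinants of (t - B) F = F diag(t - μ). Nothing is cancelled, so F need not be invertible.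
  determinant-eigenbasis : ∀ n (B F : Matrix n) (μ : Fin n → Carrier) → (∀ u v → (B · F) u v ≈ F u v * μ v) → ∀ t →
    determinant n (λ u v → (t * δ {n} u v) - B u v) * determinant n F ≈ determinant n F * ∏ {n} (λ v → t - μ v)
  determinant-eigenbasis n B F μ eigen t = begin
    determinant n M * determinant n F ≈⟨ determinant-· n M F ⟨
    determinant n (M · F)             ≈⟨ determinant-cong n (λ u v → trans (left u v) (sym (right u v))) ⟩
    determinant n (F · D)             ≈⟨ determinant-· n F D ⟩
    determinant n F * determinant n D ≈⟨ *-congˡ (determinant-diagonal n (λ v → t - μ v)) ⟩
    determinant n F * ∏ (λ v → t - μ v) ∎
    where
    M D : Matrix n
    M u v = (t * δ u v) - B u v
    D u v = (t - μ u) * δ u v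
    left : ∀ u v → (M · F) u v ≈ F u v * (t - μ v)
    left u v = begin
      sum (λ w → M u w * F w v)
        ≈⟨ sum-cong-≋ (λ w → trans (distribʳ (F w v) (t * δ u w) (- B u w))
             (+-congˡ (trans (sym (-‿distribˡ-* (B u w) (F w v)))
                 (trans (-‿cong (sym (*-identityʳ _))) (-‿distribʳ-* _ 1#))))) ⟩
      -- Negation is written as right multiplication by -1, which distributivity then pulls out of
      -- the sum.
      sum (λ w → t * δ u w * F w v + B u w * F w v * - 1#)
        ≈⟨ ∑-distrib-+ (λ w → t * δ u w * F w v) (λ w → B u w * F w v * - 1#) ⟩
      sum (λ w → t * δ u w * F w v) + sum (λ w → B u w * F w v * - 1#)
        ≈⟨ +-cong (sum-select (λ w → t * δ u w * F w v) u
                    (λ k k≢u → trans (*-congʳ (trans (*-congˡ (reflexive (δ-≢ (k≢u ∘ ≡.sym)))) (zeroʳ t))) (zeroˡ _)))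
                  (sym (*-distribʳ-sum (- 1#) (λ w → B u w * F w v))) ⟩
      t * δ u u * F u v + (B · F) u v * - 1#
        ≈⟨ +-cong (trans (*-congʳ (trans (*-congˡ (reflexive (δ-refl u))) (*-identityʳ t))) (*-comm t _))
                  (trans (*-congʳ (eigen u v)) (trans (sym (-‿distribʳ-* _ 1#))
                      (trans (-‿cong (*-identityʳ _)) (-‿distribʳ-* _ _)))) ⟩
      F u v * t + F u v * - μ v
        ≈⟨ distribˡ _ _ _ ⟨
      F u v * (t - μ v) ∎
    right : ∀ u v → (F · D) u v ≈ F u v * (t - μ v)
    right u v = trans (sum-select (λ w → F u w * D w v) v
        (λ k k≢v → trans (*-congˡ (trans (*-congˡ (reflexive (δ-≢ k≢v))) (zeroʳ _))) (zeroʳ _)))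
      (*-congˡ (trans (*-congˡ (reflexive (δ-refl v))) (*-identityʳ _)))

  ∏-zero : ∀ {n} (d : Fin n → Carrier) i → d i ≈ 0# → ∏ d ≈ 0#
  ∏-zero d zero    eq = trans (*-congʳ eq) (zeroˡ _)
  ∏-zero d (suc i) eq = trans (*-congˡ (∏-zero (d ∘ suc) i eq)) (zeroʳ _)

  module DiagonalisationLemmas (noZeroDivisors : ∀ x y → x * y ≈ 0# → x ≈ 0# ⊎ y ≈ 0#)
    (n : ℕ) (F : Matrix n) where

    -- C is an inverse of F only up to the factors d, which is all that character orthogonality
    -- offers in a ring where the group order is not a unit.
    determinant≉0 : ∀ (C : Matrix n) (d : Fin n → Carrier) → (∀ u v → (C · F) u v ≈ d u * δ u v) →
      ¬ ∏ d ≈ 0# → ¬ determinant n F ≈ 0#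
    determinant≉0 C d orthogonal ∏≉0 eq = ∏≉0 (begin
      ∏ d                                  ≈⟨ determinant-diagonal n d ⟨
      determinant n (λ u v → d u * δ u v)  ≈⟨ determinant-cong n orthogonal ⟨
      determinant n (C · F)                ≈⟨ determinant-· n C F ⟩
      determinant n C * determinant n F    ≈⟨ *-congˡ eq ⟩
      determinant n C * 0#                 ≈⟨ zeroʳ _ ⟩
      0#                                   ∎)

    module _ (F≉0 : ¬ determinant n F ≈ 0#) (B : Matrix n) (μ : Fin n → Carrier)
      (eigen : ∀ u v → (B · F) u v ≈ F u v * μ v) (t : Carrier) where

      -- Without zero divisors the nonzero factor det F cancels from `determinant-eigenbasis`. This
      -- direction serves α, the converse below serves β.
      eigenvalue⇒root : ∀ v → t ≈ μ v → determinant n (λ u v → (t * δ u v) - B u v) ≈ 0#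
      eigenvalue⇒root v t≈μ with noZeroDivisors _ _ (trans (determinant-eigenbasis n B F μ eigen t)
        (trans (*-congˡ (∏-zero (λ v → t - μ v) v (trans (+-congʳ t≈μ) (-‿inverseʳ (μ v))))) (zeroʳ _)))
      ... | inj₁ e = e
      ... | inj₂ e = ⊥-elim (F≉0 e)

      root⇒∏≈0 : determinant n (λ u v → (t * δ u v) - B u v) ≈ 0# → ∏ (λ v → t - μ v) ≈ 0#
      root⇒∏≈0 eq with noZeroDivisors _ _ (trans (sym (determinant-eigenbasis n B F μ eigen t))
          (trans (*-congʳ eq) (zeroˡ _)))
      ... | inj₁ e = ⊥-elim (F≉0 e)
      ... | inj₂ e = e

-- Sums over products and over the vertices of the cover

∑-split : ∀ m {n} (f : Fin (m ℕ.+ n) → ℤ) → ∑ f ≡ ∑ (λ i → f (i ↑ˡ n)) ℤ.+ ∑ (λ j → f (m ↑ʳ j))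
∑-split zero    f = ≡.sym (ℤ.+-identityˡ _)
∑-split (suc m) f = ≡.trans (≡.cong (ℤ._+_ (f zero)) (∑-split m (λ i → f (suc i)))) (≡.sym (ℤ.+-assoc (f zero) _ _))

∑-remQuot : ∀ m n (f : Fin m × Fin n → ℤ) → ∑ {m ℕ.* n} (λ u → f (remQuot n u)) ≡ ∑ λ x → ∑ λ i → f (x , i)
∑-remQuot zero    n f = ≡.refl
∑-remQuot (suc m) n f = ≡.trans (∑-split n (λ u → f (remQuot {suc m} n u)))
  (≡.cong₂ ℤ._+_ (∑-cong first) (≡.trans (∑-cong rest) (∑-remQuot m n (λ (x , i) → f (suc x , i)))))
  where
  first : ∀ i → f (remQuot {suc m} n (i ↑ˡ (m ℕ.* n))) ≡ f (zero , i)
  first i rewrite splitAt-↑ˡ n i (m ℕ.* n) = ≡.refl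
  rest : ∀ u → f (remQuot {suc m} n (n ↑ʳ u)) ≡ f (suc (proj₁ (remQuot {m} n u)) , proj₂ (remQuot {m} n u))
  rest u rewrite splitAt-↑ʳ n (m ℕ.* n) u = ≡.refl

∑-product : ∀ {m n} (s : Fin m → ℤ) (t : Fin n → ℤ) → (∑ λ x → ∑ λ i → s x ℤ.* t i) ≡ ∑ s ℤ.* ∑ t
∑-product s t = ≡.trans (∑-cong (λ x → ≡.sym (*-distribˡ-∑ (s x) t))) (≡.sym (*-distribʳ-∑ (∑ t) s))

𝟙-cong : ∀ {a b} {A : Set a} {B : Set b} (d : Dec A) (e : Dec B) → (A → B) → (B → A) → 𝟙 d ≡ 𝟙 e
𝟙-cong (yes x) e f g = ≡.sym (𝟙-yes e (f x))
𝟙-cong (no ¬x) e f g = ≡.sym (𝟙-no e (λ y → ¬x (g y)))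

τ-zero≢0 : ∀ n .{{_ : NonZero n}} → Prime n → τ n (zeroM n) ≢ 0ℤ
τ-zero≢0 n isPrime eq = ¬prime[1] (≡.subst Prime (ℤ.+-injective n≡1) isPrime)
  where
  n≡1 : + n ≡ + 1
  n≡1 = begin
    + n ≡⟨ solve 1 (λ n → n := n :* con 1ℤ :- con 1ℤ :+ con 1ℤ) ≡.refl (+ n) ⟩
    + n ℤ.* 1ℤ ℤ.- 1ℤ ℤ.+ 1ℤ ≡⟨ ≡.cong (λ d → + n ℤ.* d ℤ.- 1ℤ ℤ.+ 1ℤ) (𝟙-yes (zeroM n ≟ zeroM n) ≡.refl) ⟨
    τ n (zeroM n) ℤ.+ 1ℤ ≡⟨ ≡.cong (ℤ._+ 1ℤ) eq ⟩
    + 1 ∎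
    where open ≡-Reasoning

module Spectrum (p ℓ : ℕ) .{{_ : NonZero p}} .{{_ : NonZero ℓ}} (p-prime : Prime p) (ℓ-prime : Prime ℓ)
    (ℓ≢p : ℓ ≢ p) where
  open Cyclotomic p ℓ
  open Domain p-prime ℓ-prime ℓ≢p
  open CommutativeRing commutativeRing using (semiring; ring; refl; sym; trans; zeroʳ)
  open Determinant commutativeRing
  open SemiringSum semiring using (sum)

  N : ℕ
  N = p ℕ.* ℓ

  vertex : Fin N → G
  vertex = remQuot ℓ

  vertex-injective : ∀ {u v} → vertex u ≡ vertex v → u ≡ v
  vertex-injective {u} {v} eq = ≡.trans (≡.sym (combine-remQuot {p} ℓ u))
      (≡.trans (≡.cong (λ (x , i) → combine x i) eq) (combine-remQuot {p} ℓ v))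

  negG : G → G
  negG (x , i) = negM p x , negM ℓ i

  open RingProperties (CommutativeRing.ring P.commutativeRing) using () renaming (x∙y⁻¹≈ε⇒x≈y to P-sub≡0)
  open RingProperties (CommutativeRing.ring L.commutativeRing) using () renaming (x∙y⁻¹≈ε⇒x≈y to L-sub≡0)

  ι-isHomomorphism : IsHomomorphism ℤ-rawRing commutativeRing ι
  ι-isHomomorphism = record
    { h-0 = mk≈ λ _ → ≡.refl ; h-1 = refl ; h-+ = ι-+ ; h-* = ι-* ; h-neg = λ _ → refl }

  open Specialisation commutativeRing ι-isHomomorphism

  -- The character table of ℤ/p × ℤ/ℓ, and its transposed complex conjugate; the table is symmetric,
  -- so the indices may be read either way.
  character conjugateCharacter : Matrix N
  character u v = basis (vertex v • vertex u)
  conjugateCharacter u v = basis (negG (vertex u) • vertex v)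

  •-distribˡ : ∀ a g h → a • (g ∙ h) ≡ a • g ∙ a • h
  •-distribˡ (a , b) (x , i) (y , j) = ≡.cong₂ _,_ (P.*-distribˡ-+ a x y) (L.*-distribˡ-+ b i j)

  •-distribʳ : ∀ g a b → (a ∙ b) • g ≡ a • g ∙ b • g
  •-distribʳ (x , i) (a , b) (c , d) = ≡.cong₂ _,_ (CommutativeRing.distribʳ P.commutativeRing x a c)
      (CommutativeRing.distribʳ L.commutativeRing i b d)

  ∑-trace : ∀ g c → (∑ λ x → ∑ λ i → trace (g ∙ c • (x , i)))
    ≡ (∑ λ x → τ p (addM p (proj₁ g) (mulM p x (proj₁ c)))) ℤ.* (∑ λ i → τ ℓ (addM ℓ (proj₂ g) (mulM ℓ i (proj₂ c))))
  ∑-trace (g₁ , g₂) (c₁ , c₂) = ≡.trans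
    (∑-cong (λ x → ∑-cong (λ i → ≡.cong₂ (λ a b → τ p (addM p g₁ a) ℤ.* τ ℓ (addM ℓ g₂ b)) (P.*-comm c₁ x)
        (L.*-comm c₂ i))))
    (∑-product (λ x → τ p (addM p g₁ (mulM p x c₁))) (λ i → τ ℓ (addM ℓ g₂ (mulM ℓ i c₂))))

  ∑-trace-≡0 : ∀ g → (∑ λ x → ∑ λ i → trace (g ∙ 0G • (x , i))) ≡ + N ℤ.* trace g
  ∑-trace-≡0 (g₁ , g₂) = begin
    _ ≡⟨ ∑-trace (g₁ , g₂) 0G ⟩
    _ ≡⟨ ≡.cong₂ ℤ._*_ (∑-τ-≡0 p-prime g₁ (zeroM p) ≡.refl) (∑-τ-≡0 ℓ-prime g₂ (zeroM ℓ) ≡.refl) ⟩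
    + p ℤ.* τ p g₁ ℤ.* (+ ℓ ℤ.* τ ℓ g₂) ≡⟨ solve 4 (λ a b c d → a :* b :* (c :* d) := a :* c :* (b :* d)) ≡.refl
        (+ p) (τ p g₁) (+ ℓ) (τ ℓ g₂) ⟩
    + p ℤ.* + ℓ ℤ.* (τ p g₁ ℤ.* τ ℓ g₂) ≡⟨ ≡.cong (ℤ._* (τ p g₁ ℤ.* τ ℓ g₂)) (ℤ.pos-* p ℓ) ⟨
    + N ℤ.* trace (g₁ , g₂) ∎
    where open ≡-Reasoning

  ∑-trace-≢0 : ∀ g c → c ≢ 0G → (∑ λ x → ∑ λ i → trace (g ∙ c • (x , i))) ≡ 0ℤ
  ∑-trace-≢0 g@(g₁ , g₂) c@(c₁ , c₂) c≢0 = ≡.trans (∑-trace g c) vanish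
    where
    vanish : (∑ λ x → τ p (addM p g₁ (mulM p x c₁))) ℤ.* (∑ λ i → τ ℓ (addM ℓ g₂ (mulM ℓ i c₂))) ≡ 0ℤ
    vanish with c₁ ≟ zeroM p | c₂ ≟ zeroM ℓ
    ... | no c₁≢0  | _        = ≡.cong (ℤ._* _) (∑-τ-≢0 p-prime g₁ c₁ c₁≢0)
    ... | yes _    | no c₂≢0  = ≡.trans (≡.cong (ℤ._*_ (∑ λ x → τ p (addM p g₁ (mulM p x c₁))))
        (∑-τ-≢0 ℓ-prime g₂ c₂ c₂≢0)) (ℤ.*-zeroʳ (∑ λ x → τ p (addM p g₁ (mulM p x c₁))))
    ... | yes c₁≡0 | yes c₂≡0 = ⊥-elim (c≢0 (≡.cong₂ _,_ c₁≡0 c₂≡0))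

  -- The entry is the sum over all w of ζ to the power (v - u) · w. The identity is checked on
  -- traces of its multiples by ζ^g, where it becomes a product of two complete sums of `τ`.
  orthogonality : ∀ u v → (conjugateCharacter · character) u v ≈ ι (+ N) * δ u v
  orthogonality u v = mk≈ λ g → ≡.trans (≡.trans (κ-sum (λ w → conjugateCharacter u w * character w v) g)
      (≡.trans (∑-cong {N} (λ w → term g w)) (∑-remQuot p ℓ (λ h → trace (g ∙ c • h)))))
      (main g)
    where
    c : G
    c = negG (vertex u) ∙ vertex v
    term : ∀ g w → κ (conjugateCharacter u w * character w v) g ≡ trace (g ∙ c • vertex w)
    term g w = ≡.trans (κ-basis (negG (vertex u) • vertex w ∙ vertex v • vertex w) g)
      (≡.cong (λ h → trace (g ∙ h)) (≡.sym (•-distribʳ (vertex w) (negG (vertex u)) (vertex v))))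
    main : ∀ g → (∑ λ x → ∑ λ i → trace (g ∙ c • (x , i))) ≡ κ (ι (+ N) * δ u v) g
    main g with u ≟ v
    ... | yes ≡.refl = ≡.trans (≡.cong (λ c → ∑ λ x → ∑ λ i → trace (g ∙ c • (x , i))) c≡0) (≡.trans (∑-trace-≡0 g)
        (≡.sym (≡.trans (κ-ι* (+ N) (ι 1ℤ) g)
            (≡.cong (ℤ._*_ (+ N)) (≡.trans (κ-basis 0G g) (≡.cong trace (≡.trans (∙-comm g 0G) (∙-identityˡ g))))))))
      where
      c≡0 : c ≡ 0G
      c≡0 = ≡.cong₂ _,_ (≡.trans (P.+-comm _ (proj₁ (vertex u))) (P.+-inverseʳ (proj₁ (vertex u))))
                        (≡.trans (L.+-comm _ (proj₂ (vertex u))) (L.+-inverseʳ (proj₂ (vertex u))))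
    ... | no u≢v = ≡.trans (∑-trace-≢0 g c (λ c≡0 → u≢v (≡.sym (vertex-injective (≡.cong₂ _,_
        (P-sub≡0 _ _ (≡.trans (P.+-comm (proj₁ (vertex v)) _) (≡.cong proj₁ c≡0)))
        (L-sub≡0 _ _ (≡.trans (L.+-comm (proj₂ (vertex v)) _) (≡.cong proj₂ c≡0))))))))
      (≡.sym (κ-≡ (zeroʳ (ι (+ N))) g))

  trace-0G≢0 : trace 0G ≢ 0ℤ
  trace-0G≢0 eq with ℤ.i*j≡0⇒i≡0∨j≡0 (τ p (zeroM p)) eq
  ... | inj₁ e = τ-zero≢0 p p-prime e
  ... | inj₂ e = τ-zero≢0 ℓ ℓ-prime e

  -- An integer c has trace c (p - 1)(ℓ - 1), and neither prime is 1.
  ι-≉0 : ∀ c → c ≢ 0ℤ → ¬ ι c ≈ []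
  ι-≉0 c c≢0 eq with ℤ.i*j≡0⇒i≡0∨j≡0 c (≡.trans (≡.sym (ℤ.+-identityʳ _)) (κ-≡ eq 0G))
  ... | inj₁ e = c≢0 e
  ... | inj₂ e = trace-0G≢0 (≡.trans (≡.cong trace (≡.sym (∙-identityˡ 0G))) e)

  ∏≈0⇒factor≈0 : ∀ {n} (d : Fin n → Element) → ∏ d ≈ [] → ∃ λ i → d i ≈ []
  ∏≈0⇒factor≈0 {zero}  d eq = ⊥-elim (ι-≉0 1ℤ (λ ()) eq)
  ∏≈0⇒factor≈0 {suc n} d eq with noZeroDivisors (d zero) (∏ (d ∘ suc)) eq
  ... | inj₁ e = zero , e
  ... | inj₂ e with ∏≈0⇒factor≈0 (d ∘ suc) e
  ...   | i , e′ = suc i , e′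

  N≢0 : + N ≢ 0ℤ
  N≢0 eq with ℕ.m*n≡0⇒m≡0∨n≡0 p (ℤ.+-injective eq)
  ... | inj₁ p≡0 = ¬prime[0] (≡.subst Prime p≡0 p-prime)
  ... | inj₂ ℓ≡0 = ¬prime[0] (≡.subst Prime ℓ≡0 ℓ-prime)

  open DiagonalisationLemmas commutativeRing noZeroDivisors N character

  determinant-character≉0 : ¬ determinant N character ≈ []
  determinant-character≉0 = determinant≉0 conjugateCharacter (λ _ → ι (+ N)) orthogonality
    λ eq → ι-≉0 (+ N) N≢0 (proj₂ (∏≈0⇒factor≈0 {N} (λ _ → ι (+ N)) eq))

  -- The character sum λ_{a,b}(α) for v = (a , b), with the indicator of nonzero squares as weight
  -- so that s ranges over `Fin p`.
  eigenvalue : (Fin p → Fin ℓ) → G → Element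
  eigenvalue α v = sum λ s → ι (𝟙 (nonzeroSquare? p s)) * basis (v • (s , α s))

  κ-eigenvalue : ∀ α v g → κ (eigenvalue α v) g ≡ ∑ λ s → 𝟙 (nonzeroSquare? p s) ℤ.* trace (g ∙ v • (s , α s))
  κ-eigenvalue α v g = ≡.trans (κ-sum (λ s → ι (𝟙 (nonzeroSquare? p s)) * basis (v • (s , α s))) g)
    (∑-cong λ s → ≡.trans (κ-ι* (𝟙 (nonzeroSquare? p s)) (basis (v • (s , α s))) g)
      (≡.cong (ℤ._*_ (𝟙 (nonzeroSquare? p s))) (κ-basis (v • (s , α s)) g)))

  translation : Fin p → Permutation p p
  translation x = permutation (addM p x) (λ y → subM p y x) (P.subM-cancel-+ x) (P.+-cancel-subM x)

  -- Substitute y = x + s: over a square s exactly one fibre coordinate is adjacent, namely i +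
  -- α(s).
  ∑-neighbours : ∀ α (u : G) (φ : G → ℤ) →
    (∑ λ y → ∑ λ j → 𝟙 (adj? p ℓ α u (y , j)) ℤ.* φ (y , j)) ≡ ∑ λ s → 𝟙 (nonzeroSquare? p s) ℤ.* φ (u ∙ (s , α s))
  ∑-neighbours α (x , i) φ = ≡.trans
    (∑-permute (λ y → ∑ λ j → 𝟙 (adj? p ℓ α (x , i) (y , j)) ℤ.* φ (y , j)) (translation x))
    (∑-cong λ s → ≡.trans (∑-select (row s) (addM ℓ i (α s)) (off s)) (at s))
    where
    row : ∀ s j → ℤ
    row s j = 𝟙 (adj? p ℓ α (x , i) (addM p x s , j)) ℤ.* φ (addM p x s , j)
    off : ∀ s j → j ≢ addM ℓ i (α s) → row s j ≡ 0ℤ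
    off s j j≢ = ≡.cong (ℤ._* φ (addM p x s , j)) (𝟙-no (adj? p ℓ α (x , i) (addM p x s , j))
      λ (_ , eq) → j≢ (≡.trans (≡.sym (L.subM-cancel-+ i j))
          (≡.cong (addM ℓ i) (≡.trans eq (≡.cong α (P.+-cancel-subM x s))))))
    at : ∀ s → row s (addM ℓ i (α s)) ≡ 𝟙 (nonzeroSquare? p s) ℤ.* φ (addM p x s , addM ℓ i (α s))
    at s = ≡.cong (ℤ._* φ (addM p x s , addM ℓ i (α s)))
        (𝟙-cong (adj? p ℓ α (x , i) (addM p x s , addM ℓ i (α s))) (nonzeroSquare? p s)
      (λ (sq , _) → ≡.subst (NonzeroSquare p) (P.+-cancel-subM x s) sq)
      (λ sq → ≡.subst (NonzeroSquare p) (≡.sym (P.+-cancel-subM x s)) sq , ≡.trans (L.+-cancel-subM i (α s))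
          (≡.cong α (≡.sym (P.+-cancel-subM x s)))))

  -- Neighbours of u are its translates by (s , α s), and a character turns such a translation into
  -- multiplication by its value there.
  character-eigenvector : ∀ α u v → ((λ u w → ι (adjMatrix p ℓ α u w)) · character) u v ≈
      character u v * eigenvalue α (vertex v)
  character-eigenvector α u v = mk≈ λ g → begin
    κ (sum (λ w → ι (adjMatrix p ℓ α u w) * character w v)) g
      ≡⟨ κ-sum (λ w → ι (adjMatrix p ℓ α u w) * character w v) g ⟩
    ∑ (λ w → κ (ι (adjMatrix p ℓ α u w) * character w v) g)
      ≡⟨ ∑-cong {N} (λ w → ≡.trans (κ-ι* (adjMatrix p ℓ α u w) (character w v) g)
          (≡.cong (ℤ._*_ (adjMatrix p ℓ α u w)) (κ-basis (vertex v • vertex w) g))) ⟩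
    ∑ {N} (λ w → 𝟙 (adj? p ℓ α (vertex u) (vertex w)) ℤ.* trace (g ∙ vertex v • vertex w))
      ≡⟨ ∑-remQuot p ℓ (λ h → 𝟙 (adj? p ℓ α (vertex u) h) ℤ.* trace (g ∙ vertex v • h)) ⟩
    (∑ λ y → ∑ λ j → 𝟙 (adj? p ℓ α (vertex u) (y , j)) ℤ.* trace (g ∙ vertex v • (y , j)))
      ≡⟨ ∑-neighbours α (vertex u) (λ h → trace (g ∙ vertex v • h)) ⟩
    (∑ λ s → 𝟙 (nonzeroSquare? p s) ℤ.* trace (g ∙ vertex v • (vertex u ∙ (s , α s))))
      ≡⟨ ∑-cong (λ s → ≡.cong (λ h → 𝟙 (nonzeroSquare? p s) ℤ.* trace h)
          (≡.trans (≡.cong (g ∙_) (•-distribˡ (vertex v) (vertex u) (s , α s)))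
          (≡.sym (∙-assoc g (vertex v • vertex u) (vertex v • (s , α s)))))) ⟩
    (∑ λ s → 𝟙 (nonzeroSquare? p s) ℤ.* trace (g ∙ vertex v • vertex u ∙ vertex v • (s , α s)))
      ≡⟨ κ-eigenvalue α (vertex v) (g ∙ vertex v • vertex u) ⟨
    κ (eigenvalue α (vertex v)) (g ∙ vertex v • vertex u)
      ≡⟨ κ-basis* (vertex v • vertex u) (eigenvalue α (vertex v)) g ⟨
    κ (character u v * eigenvalue α (vertex v)) g ∎
    where open ≡-Reasoning

  open RingProperties ring using (x∙y⁻¹≈ε⇒x≈y)

  module _ (α β : Fin p → Fin ℓ) (cospectral : Cospectral p ℓ α β) where
    private
      t : Element
      t = eigenvalue α (oneM p , oneM ℓ)

    root-α : determinant N (characteristicMatrix (adjMatrix p ℓ α) t) ≈ []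
    root-α = eigenvalue⇒root determinant-character≉0 (λ u v → ι (adjMatrix p ℓ α u v))
      (λ v → eigenvalue α (vertex v)) (character-eigenvector α) t (combine (oneM p) (oneM ℓ))
      (CommutativeRing.reflexive commutativeRing (≡.cong (eigenvalue α) (≡.sym (remQuot-combine (oneM p) (oneM ℓ)))))

    root-β : determinant N (characteristicMatrix (adjMatrix p ℓ β) t) ≈ []
    root-β = trans (sym (charPoly-specialise N (adjMatrix p ℓ α) (adjMatrix p ℓ β) cospectral t)) root-α

    vanishingFactor : ∃ λ v → t ++ (- eigenvalue β (vertex v)) ≈ []
    vanishingFactor = ∏≈0⇒factor≈0 {N} (λ v → t ++ (- eigenvalue β (vertex v)))
      (root⇒∏≈0 determinant-character≉0 (λ u v → ι (adjMatrix p ℓ β u v))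
        (λ v → eigenvalue β (vertex v)) (character-eigenvector β) t root-β)

    commonEigenvalue : ∃ λ v → t ≈ eigenvalue β v
    commonEigenvalue = vertex (proj₁ vanishingFactor) ,
      x∙y⁻¹≈ε⇒x≈y t (eigenvalue β (vertex (proj₁ vanishingFactor))) (proj₂ vanishingFactor)

-- Covers with a common eigenvalue

module _ (n : ℕ) .{{_ : NonZero n}} where

  τ-at-zero : τ n (zeroM n) ≡ + n ℤ.- 1ℤ
  τ-at-zero = ≡.trans (≡.cong (λ d → + n ℤ.* d ℤ.- 1ℤ) (𝟙-yes (zeroM n ≟ zeroM n) ≡.refl))
      (≡.cong (ℤ._- 1ℤ) (ℤ.*-identityʳ (+ n)))

  τ-off-zero : ∀ {x} → x ≢ zeroM n → τ n x ≡ ℤ.- 1ℤ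
  τ-off-zero {x} x≢0 = ≡.trans (≡.cong (λ d → + n ℤ.* d ℤ.- 1ℤ) (𝟙-no (x ≟ zeroM n) x≢0))
      (≡.cong (ℤ._- 1ℤ) (ℤ.*-zeroʳ (+ n)))

  τ-zero-injective : ∀ x → τ n (zeroM n) ≡ τ n x → x ≡ zeroM n
  τ-zero-injective x eq = decidable-stable (x ≟ zeroM n) λ x≢0 → ℕ.≢-nonZero⁻¹ n (ℤ.+-injective (begin
    + n              ≡⟨ solve 1 (λ n → n := n :- con 1ℤ :+ con 1ℤ) ≡.refl (+ n) ⟩
    + n ℤ.- 1ℤ ℤ.+ 1ℤ ≡⟨ ≡.cong (ℤ._+ 1ℤ) (≡.trans (≡.sym τ-at-zero) (≡.trans eq (τ-off-zero x≢0))) ⟩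
    + 0              ∎))
    where open ≡-Reasoning

module _ (p : ℕ) .{{_ : NonZero p}} (p-prime : Prime p) (p≢2 : p ≢ 2) where
  open Residues p
  open RingProperties (CommutativeRing.ring commutativeRing) using (-‿distribˡ-*; -‿distribʳ-*; -‿involutive)

  -- If every nonzero element were a square, a choice of square roots r together with
  -- −r(1) ≠ r(1) would inject p + 1 elements into Fin p.
  nonsquare : ∃ λ x → x ≢ zeroM p × ¬ NonzeroSquare p x
  nonsquare with any? (λ x → ¬? (x ≟ zeroM p) ×-dec ¬? (nonzeroSquare? p x))
  ... | yes found = found
  ... | no none = ⊥-elim (collide (pigeonhole (ℕ.n<1+n p) f))
    where
    hasRoot : ∀ x → ∃ λ y → y * y ≡ x
    hasRoot x with x ≟ zeroM p | nonzeroSquare? p x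
    ... | yes ≡.refl | _                 = zeroM p , CommutativeRing.zeroˡ commutativeRing (zeroM p)
    ... | no _       | yes (_ , root)    = root
    ... | no x≢0     | no ¬square        = ⊥-elim (none (x , x≢0 , ¬square))
    root : Fin p → Fin p
    root x = proj₁ (hasRoot x)
    root² : ∀ x → root x * root x ≡ x
    root² x = proj₂ (hasRoot x)
    f : Fin (suc p) → Fin p
    f zero    = negM p (root (oneM p))
    f (suc x) = root x
    neg² : ∀ x → negM p x * negM p x ≡ x * x
    neg² x = ≡.trans (≡.sym (-‿distribˡ-* x (negM p x)))
        (≡.trans (≡.cong (negM p) (≡.sym (-‿distribʳ-* x x))) (-‿involutive (x * x)))
    root-injective : ∀ {x y} → root x ≡ root y → x ≡ y
    root-injective {x} {y} eq = ≡.trans (≡.sym (root² x)) (≡.trans (≡.cong₂ _*_ eq eq) (root² y))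
    r : Fin p
    r = root (oneM p)
    r≢0 : r ≢ zeroM p
    r≢0 eq = 1≢0 p-prime (≡.trans (≡.sym (root² (oneM p)))
        (≡.trans (≡.cong (_* r) eq) (CommutativeRing.zeroˡ commutativeRing r)))
    2≢0 : oneM p + oneM p ≢ zeroM p
    2≢0 eq with irreducible[2] (mod≡0⇒∣ 2 (≡.trans (≡.sym (addM-mod 1 1)) eq))
    ... | inj₁ p≡1 = ¬prime[1] (≡.subst Prime p≡1 p-prime)
    ... | inj₂ p≡2 = p≢2 p≡2
    r+r≢0 : r + r ≢ zeroM p
    r+r≢0 eq = 2≢0 (*-cancelˡ-≢0 p-prime r r≢0 (≡.trans (*-distribˡ-+ r (oneM p) (oneM p))
      (≡.trans (≡.cong₂ _+_ (CommutativeRing.*-identityʳ commutativeRing r)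
          (CommutativeRing.*-identityʳ commutativeRing r))
        (≡.trans eq (≡.sym (CommutativeRing.zeroʳ commutativeRing r))))))
    collide : (∃ λ i → ∃ λ j → i Fin.< j × f i ≡ f j) → ⊥
    -- If -r(1) = r(y), squaring gives y = 1, hence 2 r(1) = 0, which is impossible as p is not 2.
    collide (zero , suc y , _ , eq) = r+r≢0 (≡.trans (≡.cong (addM p r) r≡-r) (+-inverseʳ r))
      where
      1≡y : oneM p ≡ y
      1≡y = ≡.trans (≡.sym (root² (oneM p))) (≡.trans (≡.sym (neg² r)) (≡.trans (≡.cong₂ _*_ eq eq) (root² y)))
      r≡-r : r ≡ negM p r
      r≡-r = ≡.sym (≡.trans eq (≡.cong root (≡.sym 1≡y)))
    collide (suc x , suc y , x<y , eq) = ℕ.<-irrefl (≡.cong toℕ (≡.cong suc (root-injective eq))) x<y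

module Comparison (p ℓ : ℕ) .{{_ : NonZero p}} .{{_ : NonZero ℓ}} (p-prime : Prime p) (ℓ-prime : Prime ℓ)
    (ℓ≢p : ℓ ≢ p) (p≢2 : p ≢ 2) where
  open Spectrum p ℓ p-prime ℓ-prime ℓ≢p
  open Cyclotomic p ℓ
  open RingProperties (CommutativeRing.ring P.commutativeRing) using () renaming
      (x∙y⁻¹≈ε⇒x≈y to P-sub≡0; -0#≈0# to P-neg-0)
  open RingProperties (CommutativeRing.ring L.commutativeRing) using () renaming (x∙y⁻¹≈ε⇒x≈y to L-sub≡0)

  □ : Fin p → ℤ
  □ s = 𝟙 (nonzeroSquare? p s)

  -- The trace of ζ_ℓ^(γ(s) - j) on squares and 0 elsewhere: for fixed s, these integers over all j
  -- are the coordinates of the coefficient of ζ_p^s in λ_{1,1}(γ).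
  weight : (Fin p → Fin ℓ) → Fin ℓ → Fin p → ℤ
  weight γ j s = □ s ℤ.* τ ℓ (addM ℓ (negM ℓ j) (γ s))

  total : (Fin p → Fin ℓ) → Fin ℓ → ℤ
  total γ j = ∑ (weight γ j)

  -- The p-part of the trace is p at a s = x, minus 1 everywhere. The first contribution isolates
  -- one coefficient, at s = x/a; the second subtracts the sum of all coefficients, the same for
  -- every x.
  κ-eigenvalue-≢0 : ∀ α a a′ b → mulM p a a′ ≡ oneM p → ∀ x j →
    κ (eigenvalue α (a , b)) (negM p x , negM ℓ j)
      ≡ + p ℤ.* weight (scaleV p ℓ b α) j (mulM p a′ x) ℤ.- total (scaleV p ℓ b α) j
  κ-eigenvalue-≢0 α a a′ b aa′≡1 x j = begin
    κ (eigenvalue α (a , b)) (negM p x , negM ℓ j) ≡⟨ κ-eigenvalue α (a , b) (negM p x , negM ℓ j) ⟩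
    (∑ λ s → □ s ℤ.* (τ p (arg s) ℤ.* t s))
      ≡⟨ ∑-cong (λ s → solve 4 (λ q n d t → q :* ((n :* d :- con 1ℤ) :* t) := n :* (d :* (q :* t)) :+ con
          (ℤ.- 1ℤ) :* (q :* t)) ≡.refl (□ s) (+ p) (𝟙 (arg s ≟ zeroM p)) (t s)) ⟩
    (∑ λ s → + p ℤ.* (𝟙 (arg s ≟ zeroM p) ℤ.* w s) ℤ.+ ℤ.- 1ℤ ℤ.* w s)
      ≡⟨ ∑-linear (+ p) (ℤ.- 1ℤ) (λ s → 𝟙 (arg s ≟ zeroM p) ℤ.* w s) w ⟩
    + p ℤ.* (∑ λ s → 𝟙 (arg s ≟ zeroM p) ℤ.* w s) ℤ.+ ℤ.- 1ℤ ℤ.* ∑ w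
      ≡⟨ ≡.cong₂ (λ a b → + p ℤ.* a ℤ.+ b) selected (ℤ.-1*i≡-i (∑ w)) ⟩
    + p ℤ.* w (mulM p a′ x) ℤ.- ∑ w ∎
    where
    open ≡-Reasoning
    arg : Fin p → Fin p
    arg s = addM p (negM p x) (mulM p a s)
    t : Fin p → ℤ
    t s = τ ℓ (addM ℓ (negM ℓ j) (mulM ℓ b (α s)))
    w : Fin p → ℤ
    w = weight (scaleV p ℓ b α) j
    unique : ∀ s → arg s ≡ zeroM p → s ≡ mulM p a′ x
    unique s eq = ≡.trans (≡.sym (P.*-inverse-cancel a′ a (≡.trans (P.*-comm a′ a) aa′≡1) s))
        (≡.cong (mulM p a′) (P-sub≡0 (mulM p a s) x (≡.trans (P.+-comm (mulM p a s) _) eq)))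
    root : arg (mulM p a′ x) ≡ zeroM p
    root = ≡.trans (≡.cong (addM p (negM p x)) (P.*-inverse-cancel a a′ aa′≡1 x))
        (≡.trans (P.+-comm _ x) (P.+-inverseʳ x))
    selected : (∑ λ s → 𝟙 (arg s ≟ zeroM p) ℤ.* w s) ≡ w (mulM p a′ x)
    selected = ≡.trans (∑-select (λ s → 𝟙 (arg s ≟ zeroM p) ℤ.* w s) (mulM p a′ x)
        (λ s s≢ → ≡.cong (ℤ._* w s) (𝟙-no (arg s ≟ zeroM p) (λ eq → s≢ (unique s eq)))))
      (≡.trans (≡.cong (ℤ._* w (mulM p a′ x)) (𝟙-yes (arg (mulM p a′ x) ≟ zeroM p) root)) (ℤ.*-identityˡ _))

  κ-eigenvalue-≡0 : ∀ α b x j →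
    κ (eigenvalue α (zeroM p , b)) (negM p x , negM ℓ j) ≡ τ p (negM p x) ℤ.* total (scaleV p ℓ b α) j
  κ-eigenvalue-≡0 α b x j = begin
    κ (eigenvalue α (zeroM p , b)) (negM p x , negM ℓ j) ≡⟨ κ-eigenvalue α (zeroM p , b) (negM p x , negM ℓ j) ⟩
    (∑ λ s → □ s ℤ.* (τ p (addM p (negM p x) (mulM p (zeroM p) s)) ℤ.* t s))
      ≡⟨ ∑-cong (λ s → ≡.trans (≡.cong (λ y → □ s ℤ.* (τ p y ℤ.* t s))
          (≡.trans (≡.cong (addM p (negM p x)) (CommutativeRing.zeroˡ P.commutativeRing s))
          (CommutativeRing.+-identityʳ P.commutativeRing (negM p x))))
           (solve 3 (λ q u t → q :* (u :* t) := u :* (q :* t)) ≡.refl (□ s) (τ p (negM p x)) (t s))) ⟩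
    (∑ λ s → τ p (negM p x) ℤ.* weight (scaleV p ℓ b α) j s)
        ≡⟨ *-distribˡ-∑ (τ p (negM p x)) (weight (scaleV p ℓ b α) j) ⟨
    τ p (negM p x) ℤ.* total (scaleV p ℓ b α) j ∎
    where
    open ≡-Reasoning
    t : Fin p → ℤ
    t s = τ ℓ (addM ℓ (negM ℓ j) (mulM ℓ b (α s)))

  p-cancel : ∀ i j → + p ℤ.* i ≡ + p ℤ.* j → i ≡ j
  p-cancel i j eq = ℤ.*-cancelˡ-≡ (+ p) i j eq

  weight-at : ∀ γ x → NonzeroSquare p x → weight γ (γ x) x ≡ τ ℓ (zeroM ℓ)
  weight-at γ x sq = ≡.trans (≡.cong₂ ℤ._*_ (𝟙-yes (nonzeroSquare? p x) sq)
      (≡.cong (τ ℓ) (≡.trans (L.+-comm _ (γ x)) (L.+-inverseʳ (γ x))))) (ℤ.*-identityˡ _)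

  weight-nonsquare : ∀ γ j x → ¬ NonzeroSquare p x → weight γ j x ≡ 0ℤ
  weight-nonsquare γ j x ¬sq = ≡.cong (ℤ._* τ ℓ (addM ℓ (negM ℓ j) (γ x))) (𝟙-no (nonzeroSquare? p x) ¬sq)

  -- Take j = γ(x). The left weight is τ(0) = ℓ - 1, which is nonzero, so y must be a square; then
  -- τ(γ′(y) - γ(x)) = τ(0) forces equality because `τ` attains this value only at 0.
  weight-match : ∀ γ γ′ x y → (∀ j → weight γ j x ≡ weight γ′ j y) →
    NonzeroSquare p x → NonzeroSquare p y × γ x ≡ γ′ y
  weight-match γ γ′ x y eq sq = square-y , ≡.sym
      (L-sub≡0 (γ′ y) (γ x) (≡.trans (L.+-comm (γ′ y) _) (τ-zero-injective ℓ _ (≡.trans (≡.sym (weight-at γ x sq))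
      (≡.trans (eq (γ x)) (≡.trans (≡.cong (ℤ._* τ ℓ (addM ℓ (negM ℓ (γ x)) (γ′ y)))
          (𝟙-yes (nonzeroSquare? p y) square-y)) (ℤ.*-identityˡ _)))))))
    where
    square-y : NonzeroSquare p y
    square-y = decidable-stable (nonzeroSquare? p y) λ ¬sq → τ-zero≢0 ℓ ℓ-prime
      (≡.trans (≡.sym (weight-at γ x sq)) (≡.trans (eq (γ x)) (weight-nonsquare γ′ (γ x) y ¬sq)))

  1*1≡1 : mulM p (oneM p) (oneM p) ≡ oneM p
  1*1≡1 = P.*-identityˡ (oneM p)

  module _ (α β : Fin p → Fin ℓ) (a : Fin p) (b : Fin ℓ)
    (same : eigenvalue α (oneM p , oneM ℓ) ≈ eigenvalue β (a , b)) where

    private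
      α′ β′ : Fin p → Fin ℓ
      α′ = scaleV p ℓ (oneM ℓ) α
      β′ = scaleV p ℓ b β

    κ-α : ∀ x j → κ (eigenvalue α (oneM p , oneM ℓ)) (negM p x , negM ℓ j) ≡ + p ℤ.* weight α′ j x ℤ.- total α′ j
    κ-α x j = ≡.trans (κ-eigenvalue-≢0 α (oneM p) (oneM p) (oneM ℓ) 1*1≡1 x j)
      (≡.cong (λ y → + p ℤ.* weight α′ j y ℤ.- total α′ j) (P.*-identityˡ x))

    -- If a = 0, the right side is a total times τ(-x). Evaluation at x = 0, where the weight
    -- vanishes, expresses one total through the other and makes the weight of α equal to the
    -- constant -`total β′ j` at all x other than 0. A nonsquare shows this constant to be 0, while
    -- the square 1 with j = α′(1) gives ℓ - 1.
    a≢0 : a ≢ zeroM p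
    a≢0 ≡.refl = τ-zero≢0 ℓ ℓ-prime (≡.trans (≡.sym (weight-at α′ (oneM p) (1≢0 , oneM p , 1*1≡1)))
        (≡.trans (constant (oneM p) (α′ (oneM p)) 1≢0) (≡.cong (λ z → ℤ.- z) (total≡0 (α′ (oneM p))))))
      where
      1≢0 : oneM p ≢ zeroM p
      1≢0 = P.1≢0 p-prime
      compare : ∀ x j → + p ℤ.* weight α′ j x ℤ.- total α′ j ≡ τ p (negM p x) ℤ.* total β′ j
      compare x j = ≡.trans (≡.sym (κ-α x j)) (≡.trans (κ-≡ same (negM p x , negM ℓ j)) (κ-eigenvalue-≡0 β b x j))
      at-zero : ∀ j → total α′ j ≡ total β′ j ℤ.- + p ℤ.* total β′ j
      at-zero j = begin
        total α′ j ≡⟨ solve 2 (λ n c → c := :- (n :* con 0ℤ :- c)) ≡.refl (+ p) (total α′ j) ⟩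
        ℤ.- (+ p ℤ.* 0ℤ ℤ.- total α′ j) ≡⟨ ≡.cong (λ z → ℤ.- (+ p ℤ.* z ℤ.- total α′ j))
            (weight-nonsquare α′ j (zeroM p) (λ (≢0 , _) → ≢0 ≡.refl)) ⟨
        ℤ.- (+ p ℤ.* weight α′ j (zeroM p) ℤ.- total α′ j) ≡⟨ ≡.cong (λ z → ℤ.- z) (compare (zeroM p) j) ⟩
        ℤ.- (τ p (negM p (zeroM p)) ℤ.* total β′ j)
            ≡⟨ ≡.cong (λ z → ℤ.- (z ℤ.* total β′ j)) (≡.trans (≡.cong (τ p) P-neg-0) (τ-at-zero p)) ⟩
        ℤ.- ((+ p ℤ.- 1ℤ) ℤ.* total β′ j) ≡⟨ solve 2 (λ n c → :- ((n :- con 1ℤ) :* c) := c :- n :* c) ≡.refl (+ p)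
            (total β′ j) ⟩
        total β′ j ℤ.- + p ℤ.* total β′ j ∎
        where open ≡-Reasoning
      constant : ∀ x j → x ≢ zeroM p → weight α′ j x ≡ ℤ.- total β′ j
      constant x j x≢0 = p-cancel (weight α′ j x) (ℤ.- total β′ j) (begin
        + p ℤ.* weight α′ j x ≡⟨ solve 2 (λ w c → w := w :- c :+ c) ≡.refl (+ p ℤ.* weight α′ j x) (total α′ j) ⟩
        + p ℤ.* weight α′ j x ℤ.- total α′ j ℤ.+ total α′ j
            ≡⟨ ≡.cong₂ ℤ._+_ (≡.trans (compare x j) (≡.cong (ℤ._* total β′ j) (τ-off-zero p -x≢0))) (at-zero j) ⟩
        ℤ.- 1ℤ ℤ.* total β′ j ℤ.+ (total β′ j ℤ.- + p ℤ.* total β′ j)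
            ≡⟨ solve 2 (λ n c → con (ℤ.- 1ℤ) :* c :+ (c :- n :* c) := n :* :- c) ≡.refl (+ p) (total β′ j) ⟩
        + p ℤ.* (ℤ.- total β′ j) ∎)
        where
        open ≡-Reasoning
        -x≢0 : negM p x ≢ zeroM p
        -x≢0 eq = x≢0 (≡.trans (≡.sym (CommutativeRing.+-identityʳ P.commutativeRing x))
            (≡.trans (≡.cong (addM p x) (≡.sym eq)) (P.+-inverseʳ x)))
      total≡0 : ∀ j → total β′ j ≡ 0ℤ
      total≡0 j = from (nonsquare p p-prime p≢2)
        where
        from : (∃ λ x → x ≢ zeroM p × ¬ NonzeroSquare p x) → total β′ j ≡ 0ℤ
        from (x , x≢0 , ¬sq) = ℤ.neg-injective (≡.trans (≡.sym (constant x j x≢0)) (weight-nonsquare α′ j x ¬sq))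

    -- At x = 0 both weights vanish because 0 is not among the nonzero squares. This equates the
    -- totals, after which they drop out and p cancels.
    weights-agree : ∀ a′ → mulM p a a′ ≡ oneM p → ∀ x j → weight α′ j x ≡ weight β′ j (mulM p a′ x)
    weights-agree a′ aa′≡1 x j = p-cancel _ _ (begin
      + p ℤ.* weight α′ j x ≡⟨ solve 2 (λ w c → w := w :- c :+ c) ≡.refl (+ p ℤ.* weight α′ j x) (total α′ j) ⟩
      + p ℤ.* weight α′ j x ℤ.- total α′ j ℤ.+ total α′ j ≡⟨ ≡.cong₂ ℤ._+_ (compare x) totals ⟩
      + p ℤ.* weight β′ j (mulM p a′ x) ℤ.- total β′ j ℤ.+ total β′ j
          ≡⟨ solve 2 (λ w c → w :- c :+ c := w) ≡.refl (+ p ℤ.* weight β′ j (mulM p a′ x)) (total β′ j) ⟩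
      + p ℤ.* weight β′ j (mulM p a′ x) ∎)
      where
      open ≡-Reasoning
      compare : ∀ x → + p ℤ.* weight α′ j x ℤ.- total α′ j ≡ + p ℤ.* weight β′ j (mulM p a′ x) ℤ.- total β′ j
      compare x = ≡.trans (≡.sym (κ-α x j)) (≡.trans (κ-≡ same (negM p x , negM ℓ j))
          (κ-eigenvalue-≢0 β a a′ b aa′≡1 x j))
      zero-nonsquare : ¬ NonzeroSquare p (zeroM p)
      zero-nonsquare (≢0 , _) = ≢0 ≡.refl
      totals : total α′ j ≡ total β′ j
      totals = begin
        total α′ j ≡⟨ solve 2 (λ n c → c := :- (n :* con 0ℤ :- c)) ≡.refl (+ p) (total α′ j) ⟩
        ℤ.- (+ p ℤ.* 0ℤ ℤ.- total α′ j) ≡⟨ ≡.cong (λ z → ℤ.- (+ p ℤ.* z ℤ.- total α′ j))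
            (weight-nonsquare α′ j (zeroM p) zero-nonsquare) ⟨
        ℤ.- (+ p ℤ.* weight α′ j (zeroM p) ℤ.- total α′ j) ≡⟨ ≡.cong (λ z → ℤ.- z) (compare (zeroM p)) ⟩
        ℤ.- (+ p ℤ.* weight β′ j (mulM p a′ (zeroM p)) ℤ.- total β′ j)
          ≡⟨ ≡.cong (λ z → ℤ.- (+ p ℤ.* z ℤ.- total β′ j))
              (≡.trans (≡.cong (weight β′ j) (CommutativeRing.zeroʳ P.commutativeRing a′))
              (weight-nonsquare β′ j (zeroM p) zero-nonsquare)) ⟩
        ℤ.- (+ p ℤ.* 0ℤ ℤ.- total β′ j) ≡⟨ solve 2 (λ n c → :- (n :* con 0ℤ :- c) := c) ≡.refl (+ p) (total β′ j) ⟩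
        total β′ j ∎

    voltages-agree : ∀ a′ → mulM p a a′ ≡ oneM p → ∀ x →
      (NonzeroSquare p x → NonzeroSquare p (mulM p a′ x) × α x ≡ mulM ℓ b (β (mulM p a′ x)))
      × (NonzeroSquare p (mulM p a′ x) → NonzeroSquare p x)
    voltages-agree a′ aa′≡1 x =
      (λ sq → let sq′ , eq = weight-match α′ β′ x (mulM p a′ x) (weights-agree a′ aa′≡1 x) sq
              in sq′ , ≡.trans (≡.sym (L.*-identityˡ (α x))) eq) ,
      (λ sq → proj₁ (weight-match β′ α′ (mulM p a′ x) x (λ j → ≡.sym (weights-agree a′ aa′≡1 x j)) sq))

-- Isomorphisms from matching voltages

module Isomorphisms (p ℓ : ℕ) .{{_ : NonZero p}} .{{_ : NonZero ℓ}} (α β : Fin p → Fin ℓ)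
  (a a′ : Fin p) (aa′≡1 : mulM p a a′ ≡ oneM p) (b b′ : Fin ℓ) (bb′≡1 : mulM ℓ b b′ ≡ oneM ℓ)
  (agree : ∀ x → (NonzeroSquare p x → NonzeroSquare p (mulM p a′ x) × α x ≡ mulM ℓ b (β (mulM p a′ x)))
               × (NonzeroSquare p (mulM p a′ x) → NonzeroSquare p x)) where
  private
    module P = Residues p
    module L = Residues ℓ

  a′a≡1 : mulM p a′ a ≡ oneM p
  a′a≡1 = ≡.trans (P.*-comm a′ a) aa′≡1

  b′b≡1 : mulM ℓ b′ b ≡ oneM ℓ
  b′b≡1 = ≡.trans (L.*-comm b′ b) bb′≡1

  coverBijection : Vtx p ℓ ↔ Vtx p ℓ
  coverBijection = mk↔ₛ′ (λ (x , i) → mulM p a′ x , i) (λ (x , i) → mulM p a x , i)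
    (λ (x , i) → ≡.cong (_, i) (P.*-inverse-cancel a′ a a′a≡1 x))
        (λ (x , i) → ≡.cong (_, i) (P.*-inverse-cancel a a′ aa′≡1 x))

  -- Multiplication by a′ takes the difference y - x to a′(y - x), where `agree` matches squares and
  -- voltages. The fibre coordinate is untouched, so compatibility with the shift holds by
  -- computation.
  coverIsomorphism : CoverIsomorphic p ℓ α (scaleV p ℓ b β)
  coverIsomorphism = coverBijection , iso , λ _ → ≡.refl
    where
    iso : IsGraphIso p ℓ α (scaleV p ℓ b β) coverBijection
    iso (x , i) (y , j) rewrite ≡.sym (P.*-distribˡ-subM a′ y x) =
      (λ (sq , eq) → let sq′ , αβ = proj₁ (agree (subM p y x)) sq in sq′ , ≡.trans eq αβ) ,
      (λ (sq , eq) → let sq′ = proj₂ (agree (subM p y x)) sq in sq′ , ≡.trans eq (≡.sym (proj₂ (proj₁ (agree (subM p y x)) sq′))))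

  graphBijection : Vtx p ℓ ↔ Vtx p ℓ
  graphBijection = mk↔ₛ′ (λ (x , i) → mulM p a′ x , mulM ℓ b′ i) (λ (x , i) → mulM p a x , mulM ℓ b i)
    (λ (x , i) → ≡.cong₂ _,_ (P.*-inverse-cancel a′ a a′a≡1 x) (L.*-inverse-cancel b′ b b′b≡1 i))
    (λ (x , i) → ≡.cong₂ _,_ (P.*-inverse-cancel a a′ aa′≡1 x) (L.*-inverse-cancel b b′ bb′≡1 i))

  -- Dividing the fibre coordinate by b as well turns the voltage bβ into β, at the price that the
  -- shift by 1 becomes the shift by b′.
  graphIsomorphism : GraphIsomorphic p ℓ α β
  graphIsomorphism = graphBijection , iso
    where
    iso : IsGraphIso p ℓ α β graphBijection
    iso (x , i) (y , j) rewrite ≡.sym (P.*-distribˡ-subM a′ y x) | ≡.sym (L.*-distribˡ-subM b′ j i) =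
      (λ (sq , eq) → let sq′ , αβ = proj₁ (agree (subM p y x)) sq
                     in sq′ , ≡.trans (≡.cong (mulM ℓ b′) (≡.trans eq αβ))
                         (L.*-inverse-cancel b′ b b′b≡1 (β (mulM p a′ (subM p y x))))) ,
      (λ (sq , eq) → let sq′ = proj₂ (agree (subM p y x)) sq
                     in sq′ , ≡.trans (≡.sym (L.*-inverse-cancel b b′ bb′≡1 (subM ℓ j i)))
                                (≡.trans (≡.cong (mulM ℓ b) eq) (≡.sym (proj₂ (proj₁ (agree (subM p y x)) sq′)))))

theorem3p4 : (p ℓ : ℕ) .{{_ : NonZero p}} .{{_ : NonZero ℓ}} →
    Prime p → p % 4 ≡ 1 → Prime ℓ → ¬ ℓ ≡ p →
    (α β : Fin p → Fin ℓ) → IsVoltage p ℓ α → IsVoltage p ℓ β →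
    Cospectral p ℓ α β →
    Σ (Fin ℓ) (λ n → IsUnit ℓ n × CoverIsomorphic p ℓ α (scaleV p ℓ n β))
    × GraphIsomorphic p ℓ α β
theorem3p4 p ℓ p-prime p%4≡1 ℓ-prime ℓ≢p α β ((s , s-square , αs≢0) , _) _ cospectral =
  (b , (b′ , bb′≡1) , coverIsomorphism) , graphIsomorphism
  where
  module P = Residues p
  module L = Residues ℓ

  p≢2 : p ≢ 2
  p≢2 p≡2 with () ← ≡.trans (≡.cong (_% 4) (≡.sym p≡2)) p%4≡1

  open Spectrum p ℓ p-prime ℓ-prime ℓ≢p using (commonEigenvalue)
  open Comparison p ℓ p-prime ℓ-prime ℓ≢p p≢2

  common = commonEigenvalue α β cospectral
  a = proj₁ (proj₁ common)
  b = proj₂ (proj₁ common)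

  a-inverse : ∃ λ a′ → mulM p a a′ ≡ oneM p
  a-inverse = P.inverse p-prime a (a≢0 α β a b (proj₂ common))

  a′ = proj₁ a-inverse
  aa′≡1 = proj₂ a-inverse
  agree = voltages-agree α β a b (proj₂ common) a′ aa′≡1

  -- For b = 0 the relation α(x) = bβ(x/a) would make α vanish at the square s where it is known to
  -- be nonzero.
  b≢0 : b ≢ zeroM ℓ
  b≢0 b≡0 = αs≢0 (≡.trans (proj₂ (proj₁ (agree s) s-square))
    (≡.trans (≡.cong (λ c → mulM ℓ c (β (mulM p a′ s))) b≡0) (CommutativeRing.zeroˡ L.commutativeRing _)))

  b-inverse : ∃ λ b′ → mulM ℓ b b′ ≡ oneM ℓ
  b-inverse = L.inverse ℓ-prime b b≢0

  b′ = proj₁ b-inverse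
  bb′≡1 = proj₂ b-inverse

  open Isomorphisms p ℓ α β a a′ aa′≡1 b b′ bb′≡1 agree
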